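{- Let $\alpha,\beta\ge1$ be real numbers, let $X>0$, and let $j\in\mathbb{Q}\setminus\{0,1728\}$. Then the set $\widetilde{\mathcal{E}}_j(X;H_{\alpha,\beta})$ of all elliptic curves $E_{A,B}:y^2=x^3+Ax+B$ with $A,B\in\mathbb{Z}$, $j(E_{A,B})=j$ and $H_{\alpha,\beta}(E_{A,B})\le X$ is described parametrically by $$\widetilde{\mathcal{E}}_j(X;H_{\alpha,\beta})=\left\{E_{A(j,m),B(j,m)} : m\in\mathbb{Z}\setminus\{0\},\ |m|\le c(j;H_{\alpha,\beta})X^{1/6}\right\},$$ where $A(j,m)$ and $B(j,m)$ are the integers defined by $$A(j,m)=\frac{N_{a(j)}^2m^2}{a(j)},\qquad B(j,m)=\frac{N_{a(j)}^3m^3}{a(j)},$$ and $$c(j;H_{\alpha,\beta}):=\min\left\{\frac{|a(j)|^{1/2}}{N_{a(j)}\alpha^{1/6}},\frac{|a(j)|^{1/3}}{N_{a(j)}\beta^{1/6}}\right\}.$$ This implies that $$\#\widetilde{\mathcal{E}}_j(X;H_{\alpha,\beta})=2\left\lfloor c(j;H_{\alpha,\beta})X^{1/6}\right\rfloor.$$ Moreover, for any $m\in\mathbb{Z}\setminus\{0\}$ and any prime $p$, $$2\operatorname{ord}_p(m)\le\operatorname{ord}_p(A(j,m))\le2\operatorname{ord}_p(m)+1\quad\text{if }\operatorname{ord}_p(a(j))\ge0,$$ $$3\operatorname{ord}_p(m)\le\operatorname{ord}_p(B(j,m))\le3\operatorname{ord}_p(m)+2\quad\text{if }\operatorname{ord}_p(a(j))<0.$$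 In particular, $E_{A(j,m),B(j,m)}\in\mathcal{E}_j(X;H_{\alpha,\beta})$ if and only if $m$ is square-free and $|m|\le c(j;H_{\alpha,\beta})X^{1/6}$; in other words, $$\mathcal{E}_j(X;H_{\alpha,\beta})=\left\{E_{A(j,m),B(j,m)} : m\in\mathbb{Z}\setminus\{0\}\text{ is square-free and }|m|\le c(j;H_{\alpha,\beta})X^{1/6}\right\}.$$
   Context: For $(A,B)\in\mathbb{Z}^2$ let $E_{A,B}$ denote the curve $y^2=x^3+Ax+B$; curves are identified with their pairs $(A,B)$. Let $\widetilde{\mathcal{E}}$ be the set of all $E_{A,B}$ with $A,B\in\mathbb{Z}$ and $-16(4A^3+27B^2)\neq 0$, and let $\mathcal{E}$ be the set of $E_{A,B}\in\widetilde{\mathcal{E}}$ such that there is no prime $p$ with $p^4\mid A$ and $p^6\mid B$. The $j$-invariant is $j(E_{A,B})=1728\cdot\frac{4A^3}{4A^3+27B^2}$. For $j\in\mathbb{Q}$, $\widetilde{\mathcal{E}}_j:=\{E_{A,B}\in\widetilde{\mathcal{E}}: j(E_{A,B})=j\}$ and $\mathcal{E}_j:=\{E_{A,B}\in\mathcal{E}: j(E_{A,B})=j\}$. For real $\alpha,\beta\ge1$, $H_{\alpha,\beta}(E_{A,B}):=\max\{\alpha|A|^3,\beta B^2\}$, and for a family $\mathcal{F}$ and $X>0$, $\mathcal{F}(X;H_{\alpha,\beta}):=\{E_{A,B}\in\mathcal{F}: H_{\alpha,\beta}(E_{A,B})\le X\}$. For $a\in\mathbb{Q}^\times$ and a prime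 $p$, let $\alpha_p(a):=\lceil \operatorname{ord}_p(a)/2\rceil$ if $\operatorname{ord}_p(a)\ge0$ and $\alpha_p(a):=\lceil\operatorname{ord}_p(a)/3\rceil$ if $\operatorname{ord}_p(a)<0$, where $\operatorname{ord}_p$ is the $p$-adic valuation; let $N_a:=\prod_p p^{\alpha_p(a)}\in\mathbb{Q}^\times$ (product over all primes). For $j\in\mathbb{Q}\setminus\{0,1728\}$ let $a(j):=\frac{4(1728-j)}{27j}\in\mathbb{Q}^\times$. -}

module Defs where

open import Level using (0ℓ)
open import Data.Nat.Base as ℕ using (ℕ; zero; suc)
import Data.Nat.Properties as ℕₚ
import Data.Nat.Divisibility as ℕ∣
open import Data.Nat.Primality using (Prime; prime?; prime⇒nonZero)
open import Data.Integer.Base as ℤ using (ℤ; +_; -[1+_])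
import Data.Integer.Properties as ℤₚ
import Data.Integer.Divisibility as ℤ∣
open import Data.Integer.GCD using (gcd)
open import Data.Rational.Base
open import Data.Rational.Properties
open import Data.Rational.Solver using (module +-*-Solver)
open import Algebra.Definitions.RawSemiring +-*-rawSemiring using (_^_)
open import Data.List.Base using (List; length)
open import Data.List.Membership.Propositional using (_∈_)
open import Data.List.Relation.Unary.Unique.Propositional using (Unique)
open import Data.Product using (∃-syntax; Σ-syntax; _×_; _,_; proj₁; proj₂)
open import Data.Sum using (_⊎_; inj₁; inj₂; [_,_]′)
open import Data.Bool.Base using (if_then_else_)
open import Data.Empty using (⊥-elim)
open import Function.Base using (_∘_)
open import Function.Bundles using (_⇔_)
open import Relation.Nullary using (¬_; yes; no; does)
open import Relation.Unary using (Pred)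
open import Relation.Binary.Definitions using (tri<; tri≈; tri>)
open import Relation.Binary.PropositionalEquality
  using (_≡_; _≢_; refl; sym; trans; cong; subst; subst₂; module ≡-Reasoning)

open +-*-Solver using (solve; _:+_; _:*_; _:-_; :-_; _:=_; con)

*-monoʳ-≤-0≤ : ∀ {r p q} → 0ℚ ≤ r → p ≤ q → p * r ≤ q * r
*-monoʳ-≤-0≤ {r} 0≤r = *-monoʳ-≤-nonNeg r {{nonNegative 0≤r}}

*-monoˡ-≤-0≤ : ∀ {r p q} → 0ℚ ≤ r → p ≤ q → r * p ≤ r * q
*-monoˡ-≤-0≤ {r} 0≤r = *-monoˡ-≤-nonNeg r {{nonNegative 0≤r}}

*-monoʳ-≥-≤0 : ∀ {r p q} → r ≤ 0ℚ → p ≤ q → q * r ≤ p * r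
*-monoʳ-≥-≤0 {r} r≤0 = *-monoʳ-≤-nonPos r {{nonPositive r≤0}}

*-monoʳ-<-0< : ∀ {r p q} → 0ℚ < r → p < q → p * r < q * r
*-monoʳ-<-0< {r} 0<r = *-monoˡ-<-pos r {{positive 0<r}}

*-monoˡ-<-0< : ∀ {r p q} → 0ℚ < r → p < q → r * p < r * q
*-monoˡ-<-0< {r} 0<r = *-monoʳ-<-pos r {{positive 0<r}}

*-cancelʳ-<-0< : ∀ {r p q} → 0ℚ < r → p * r < q * r → p < q
*-cancelʳ-<-0< {r} 0<r = *-cancelʳ-<-nonNeg r {{nonNegative (<⇒≤ 0<r)}}

0≤* : ∀ {p q} → 0ℚ ≤ p → 0ℚ ≤ q → 0ℚ ≤ p * q
0≤* {p} {q} 0≤p 0≤q = subst (_≤ p * q) (*-zeroˡ q) (*-monoʳ-≤-0≤ 0≤q 0≤p)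

0<* : ∀ {p q} → 0ℚ < p → 0ℚ < q → 0ℚ < p * q
0<* {p} {q} 0<p 0<q = subst (_< p * q) (*-zeroˡ q) (*-monoʳ-<-0< 0<q 0<p)

0<1ℚ : 0ℚ < 1ℚ
0<1ℚ = positive⁻¹ 1ℚ

p<p+q : ∀ p {q} → 0ℚ < q → p < p + q
p<p+q p {q} 0<q = subst (_< p + q) (+-identityʳ p) (+-monoʳ-< p 0<q)

p-1<p : ∀ p → p - 1ℚ < p
p-1<p p = subst (p - 1ℚ <_) (+-identityʳ p) (+-monoʳ-< p (neg-antimono-< 0<1ℚ))

0<q-p : ∀ {p q} → p < q → 0ℚ < q - p
0<q-p {p} {q} p<q = subst (_< q - p) (+-inverseʳ p) (+-monoˡ-< (- p) p<q)

p-q≤r : ∀ {p q r} → p ≤ q + r → p - q ≤ r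
p-q≤r {p} {q} {r} h = subst (p - q ≤_)
  (solve 2 (λ q r → (q :+ r) :- q := r) refl q r) (+-monoˡ-≤ (- q) h)

0<M+M : ∀ {M} → 0ℚ < M → 0ℚ < M + M
0<M+M {M} 0<M = <-trans 0<M (p<p+q M 0<M)

recip : ∀ {q} → 0ℚ < q → ∃[ r ] 0ℚ < r × q * r ≡ 1ℚ
recip {q} 0<q = r , positive⁻¹ r {{1/pos⇒pos q {{q>0}}}} , *-inverseʳ q {{q≢0}}
  where
  q>0 = positive 0<q
  q≢0 = pos⇒nonZero q {{q>0}}
  r   = (1/ q) {{q≢0}}

p≤∣p∣ : ∀ p → p ≤ ∣ p ∣
p≤∣p∣ p with ≤-total 0ℚ p
... | inj₁ 0≤p = ≤-reflexive (sym (0≤p⇒∣p∣≡p 0≤p))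
... | inj₂ p≤0 = ≤-trans p≤0 (0≤∣p∣ p)

∣p∣≤ : ∀ {p r} → p ≤ r → - p ≤ r → ∣ p ∣ ≤ r
∣p∣≤ {p} {r} p≤r -p≤r with ∣p∣≡p∨∣p∣≡-p p
... | inj₁ eq = subst (_≤ r) (sym eq) p≤r
... | inj₂ eq = subst (_≤ r) (sym eq) -p≤r

p-q-neg : ∀ p q → - (p - q) ≡ q - p
p-q-neg = solve 2 (λ p q → :- (p :- q) := q :- p) refl

<-⊓ : ∀ {p x y} → p < x → p < y → p < x ⊓ y
<-⊓ {p} {x} {y} p<x p<y with ≤-total x y
... | inj₁ x≤y = subst (p <_) (sym (p≤q⇒p⊓q≡p x≤y)) p<x
... | inj₂ y≤x = subst (p <_) (sym (p≥q⇒p⊓q≡q y≤x)) p<y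

min₄ : ∀ {p a b c d} → p < a → p < b → p < c → p < d →
       ∃[ q ] p < q × q < a × q < b × q < c × q < d
min₄ {p} {a} {b} {c} {d} p<a p<b p<c p<d
  with <-dense {p} {(a ⊓ b) ⊓ (c ⊓ d)} (<-⊓ (<-⊓ p<a p<b) (<-⊓ p<c p<d))
... | q , p<q , q<m =
  q , p<q
  , <-≤-trans q<m (≤-trans (p⊓q≤p (a ⊓ b) (c ⊓ d)) (p⊓q≤p a b))
  , <-≤-trans q<m (≤-trans (p⊓q≤p (a ⊓ b) (c ⊓ d)) (p⊓q≤q a b))
  , <-≤-trans q<m (≤-trans (p⊓q≤q (a ⊓ b) (c ⊓ d)) (p⊓q≤p c d))
  , <-≤-trans q<m (≤-trans (p⊓q≤q (a ⊓ b) (c ⊓ d)) (p⊓q≤q c d))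

^-0≤ : ∀ n {p} → 0ℚ ≤ p → 0ℚ ≤ p ^ n
^-0≤ zero    0≤p = <⇒≤ 0<1ℚ
^-0≤ (suc n) 0≤p = 0≤* 0≤p (^-0≤ n 0≤p)

^-mono-≤ : ∀ n {p q} → 0ℚ ≤ p → p ≤ q → p ^ n ≤ q ^ n
^-mono-≤ zero    0≤p p≤q = ≤-refl
^-mono-≤ (suc n) 0≤p p≤q = ≤-trans
  (*-monoʳ-≤-0≤ (^-0≤ n 0≤p) p≤q)
  (*-monoˡ-≤-0≤ (≤-trans 0≤p p≤q) (^-mono-≤ n 0≤p p≤q))

^-0< : ∀ n {p} → 0ℚ < p → 0ℚ < p ^ n
^-0< zero    0<p = 0<1ℚ
^-0< (suc n) 0<p = 0<* 0<p (^-0< n 0<p)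

^-mono-< : ∀ n .{{_ : ℕ.NonZero n}} {p q} → 0ℚ ≤ p → p < q → p ^ n < q ^ n
^-mono-< (suc n) 0≤p p<q = ≤-<-trans
  (*-monoˡ-≤-0≤ 0≤p (^-mono-≤ n 0≤p (<⇒≤ p<q)))
  (*-monoʳ-<-0< (^-0< n (≤-<-trans 0≤p p<q)) p<q)

1≤^ : ∀ n {p} → 1ℚ ≤ p → 1ℚ ≤ p ^ n
1≤^ zero    1≤p = ≤-refl
1≤^ (suc n) {p} 1≤p = ≤-trans 1≤p (subst (_≤ p * p ^ n) (*-identityʳ p)
  (*-monoˡ-≤-0≤ (≤-trans (<⇒≤ 0<1ℚ) 1≤p) (1≤^ n 1≤p)))

p≤p^n : ∀ n .{{_ : ℕ.NonZero n}} {p} → 1ℚ ≤ p → p ≤ p ^ n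
p≤p^n (suc n) {p} 1≤p = subst (_≤ p * p ^ n) (*-identityʳ p)
  (*-monoˡ-≤-0≤ (≤-trans (<⇒≤ 0<1ℚ) 1≤p) (1≤^ n 1≤p))

^≤1 : ∀ n {p} → 0ℚ ≤ p → p ≤ 1ℚ → p ^ n ≤ 1ℚ
^≤1 zero    0≤p p≤1 = ≤-refl
^≤1 (suc n) 0≤p p≤1 = ≤-trans (*-monoʳ-≤-0≤ (^-0≤ n 0≤p) p≤1)
  (subst (_≤ 1ℚ) (sym (*-identityˡ _)) (^≤1 n 0≤p p≤1))

p^n≤p : ∀ n .{{_ : ℕ.NonZero n}} {p} → 0ℚ ≤ p → p ≤ 1ℚ → p ^ n ≤ p
p^n≤p (suc n) {p} 0≤p p≤1 = subst (p * p ^ n ≤_) (*-identityʳ p)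
  (*-monoˡ-≤-0≤ 0≤p (^≤1 n 0≤p p≤1))

fromℕ : ℕ → ℚ
fromℕ n = + n / 1

-- Real numbers: located Dedekind cuts, given by their lower halves.
-- Below x q  means  q < x,  and  ¬ Below x q  means  x ≤ q.

record ℝ : Set₁ where
  field
    Below     : ℚ → Set
    inhabited : ∃[ q ] Below q
    bounded   : ∃[ q ] ¬ Below q
    downward  : ∀ {p q} → p < q → Below q → Below p
    rounded   : ∀ {p} → Below p → ∃[ q ] p < q × Below q
    located   : ∀ {p q} → p < q → Below p ⊎ ¬ Below q

open ℝ public using (Below)

infix 4 _≤ᴿ_ _<ᴿ_

_≤ᴿ_ : ℝ → ℝ → Set
x ≤ᴿ y = ∀ q → Below x q → Below y q

_<ᴿ_ : ℝ → ℝ → Set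
x <ᴿ y = ∃[ q ] (¬ Below x q) × Below y q

downward-≤ : ∀ x {p q} → p ≤ q → Below x q → Below x p
downward-≤ x {p} {q} p≤q bq with <-cmp p q
... | tri< p<q _ _ = ℝ.downward x p<q bq
... | tri≈ _ p≡q _ = subst (Below x) (sym p≡q) bq
... | tri> _ _ q<p = ⊥-elim (<-irrefl refl (<-≤-trans q<p p≤q))

below<above : ∀ x {p q} → Below x p → ¬ Below x q → p < q
below<above x {p} {q} bp ¬bq = ≰⇒> (λ q≤p → ¬bq (downward-≤ x q≤p bp))

ι : ℚ → ℝ
ι r = record
  { Below     = _< r
  ; inhabited = r - 1ℚ , p-1<p r
  ; bounded   = r , <-irrefl refl
  ; downward  = <-trans
  ; rounded   = <-dense
  ; located   = located
  }
  where
  located : ∀ {p q} → p < q → p < r ⊎ ¬ (q < r)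
  located {p} {q} p<q with p <? r
  ... | yes p<r = inj₁ p<r
  ... | no  p≮r = inj₂ (λ q<r → p≮r (<-trans p<q q<r))

0ᴿ 1ᴿ : ℝ
0ᴿ = ι 0ℚ
1ᴿ = ι 1ℚ

infixl 6 _⊔ᴿ_
infixl 7 _⊓ᴿ_ _*ᴿ_
infix  7 _÷ᴿ_⟨_⟩

_⊔ᴿ_ : ℝ → ℝ → ℝ
x ⊔ᴿ y = record
  { Below     = λ q → Below x q ⊎ Below y q
  ; inhabited = let (q , bq) = ℝ.inhabited x in q , inj₁ bq
  ; bounded   = let (p , ¬bp) = ℝ.bounded x
                    (q , ¬bq) = ℝ.bounded y
                in p ⊔ q , λ where
                     (inj₁ b) → ¬bp (downward-≤ x (p≤p⊔q p q) b)
                     (inj₂ b) → ¬bq (downward-≤ y (p≤q⊔p p q) b)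
  ; downward  = λ where
      p<q (inj₁ b) → inj₁ (ℝ.downward x p<q b)
      p<q (inj₂ b) → inj₂ (ℝ.downward y p<q b)
  ; rounded   = λ where
      (inj₁ b) → let (q , p<q , bq) = ℝ.rounded x b in q , p<q , inj₁ bq
      (inj₂ b) → let (q , p<q , bq) = ℝ.rounded y b in q , p<q , inj₂ bq
  ; located   = located
  }
  where
  located : ∀ {p q} → p < q → (Below x p ⊎ Below y p) ⊎ ¬ (Below x q ⊎ Below y q)
  located p<q with ℝ.located x p<q | ℝ.located y p<q
  ... | inj₁ b  | _       = inj₁ (inj₁ b)
  ... | inj₂ _  | inj₁ b  = inj₁ (inj₂ b)
  ... | inj₂ ¬b | inj₂ ¬c = inj₂ [ ¬b , ¬c ]′

_⊓ᴿ_ : ℝ → ℝ → ℝ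
x ⊓ᴿ y = record
  { Below     = λ q → Below x q × Below y q
  ; inhabited = let (p , bp) = ℝ.inhabited x
                    (q , bq) = ℝ.inhabited y
                in p ⊓ q , downward-≤ x (p⊓q≤p p q) bp , downward-≤ y (p⊓q≤q p q) bq
  ; bounded   = let (p , ¬bp) = ℝ.bounded x in p , ¬bp ∘ proj₁
  ; downward  = λ where
      p<q (b , c) → ℝ.downward x p<q b , ℝ.downward y p<q c
  ; rounded   = rounded
  ; located   = located
  }
  where
  rounded : ∀ {p} → Below x p × Below y p → ∃[ q ] p < q × Below x q × Below y q
  rounded (b , c) with ℝ.rounded x b | ℝ.rounded y c
  ... | r , p<r , br | s , p<s , cs with min₄ p<r p<r p<s p<s
  ...   | q , p<q , q<r , _ , q<s , _ =
    q , p<q , ℝ.downward x q<r br , ℝ.downward y q<s cs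
  located : ∀ {p q} → p < q → (Below x p × Below y p) ⊎ ¬ (Below x q × Below y q)
  located p<q with ℝ.located x p<q | ℝ.located y p<q
  ... | inj₁ b  | inj₁ c  = inj₁ (b , c)
  ... | inj₂ ¬b | _       = inj₂ (¬b ∘ proj₁)
  ... | inj₁ _  | inj₂ ¬c = inj₂ (¬c ∘ proj₂)

-- Multiplication by interval arithmetic: q < x y  iff  q lies below all four
-- corner products of some rational rectangle [a , b] × [c , d] ∋ (x , y).

_bracketed-by_,_ : ℝ → ℚ → ℚ → Set
x bracketed-by a , b = Below x a × ¬ Below x b

BelowCorners : (q a b c d : ℚ) → Set
BelowCorners q a b c d = q < a * c × q < a * d × q < b * c × q < b * d

Below* : ℝ → ℝ → ℚ → Set
Below* x y q = ∃[ a ] ∃[ b ] ∃[ c ] ∃[ d ]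
  (x bracketed-by a , b) × (y bracketed-by c , d) × BelowCorners q a b c d

between : ∀ {q a b s} k → a ≤ s → s ≤ b → q < a * k → q < b * k → q < s * k
between k a≤s s≤b q<ak q<bk with ≤-total 0ℚ k
... | inj₁ 0≤k = <-≤-trans q<ak (*-monoʳ-≤-0≤ 0≤k a≤s)
... | inj₂ k≤0 = <-≤-trans q<bk (*-monoʳ-≥-≤0 k≤0 s≤b)

corners⇒below : ∀ {q a b c d s t} → a ≤ s → s ≤ b → c ≤ t → t ≤ d →
                BelowCorners q a b c d → q < s * t
corners⇒below {q} {a} {b} {c} {d} {s} {t} a≤s s≤b c≤t t≤d (ac , ad , bc , bd) =
  subst (q <_) (*-comm t s)
    (between s c≤t t≤d
      (subst (q <_) (*-comm s c) (between c a≤s s≤b ac bc))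
      (subst (q <_) (*-comm s d) (between d a≤s s≤b ad bd)))

-- Two brackets of the same real have a common point.
commonPoint : ∀ x {a b a' b'} → x bracketed-by a , b → x bracketed-by a' , b' →
              ∃[ s ] (a ≤ s × s ≤ b) × (a' ≤ s × s ≤ b')
commonPoint x {a} {b} {a'} {b'} (ba , ¬bb) (ba' , ¬bb') =
  a ⊔ a'
  , (p≤p⊔q a a' , ⊔-lub (<⇒≤ (below<above x ba ¬bb)) (<⇒≤ (below<above x ba' ¬bb)))
  , (p≤q⊔p a a' , ⊔-lub (<⇒≤ (below<above x ba ¬bb')) (<⇒≤ (below<above x ba' ¬bb')))

archimedean : ∀ r → ∃[ n ] r ≤ fromℕ n
archimedean r@(mkℚ z d-1 _) = ℤ.∣ z ∣ , toℚᵘ-cancel-≤ (goal z)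
  where
  import Data.Rational.Unnormalised.Base as ℚᵘ
  import Data.Rational.Unnormalised.Properties as ℚᵘₚ
  goal : ∀ z → ℚᵘ.mkℚᵘ z d-1 ℚᵘ.≤ toℚᵘ (fromℕ ℤ.∣ z ∣)
  goal z = ℚᵘₚ.≤-respʳ-≃ (ℚᵘₚ.≃-sym (toℚᵘ-fromℚᵘ (ℚᵘ.mkℚᵘ (+ ℤ.∣ z ∣) 0)))
    (ℚᵘ.*≤* (ineq z))
    where
    ineq : ∀ z → z ℤ.* + 1 ℤ.≤ + ℤ.∣ z ∣ ℤ.* + suc d-1
    ineq (+ n) rewrite ℤₚ.*-identityʳ (+ n) | sym (ℤₚ.pos-* n (suc d-1)) =
      ℤ.+≤+ (ℕₚ.m≤m*n n (suc d-1))
    ineq (-[1+ n ]) = ℤ.-≤+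

fromℕ-suc : ∀ n → fromℕ (suc n) ≡ 1ℚ + fromℕ n
fromℕ-suc n = toℚᵘ-injective (begin
    toℚᵘ (fromℕ (suc n))               ≈⟨ toℚᵘ-fromℚᵘ (ℚᵘ.mkℚᵘ (+ suc n) 0) ⟩
    ℚᵘ.mkℚᵘ (+ suc n) 0                ≈⟨ ℚᵘ.*≡* eq ⟩
    ℚᵘ.1ℚᵘ ℚᵘ.+ ℚᵘ.mkℚᵘ (+ n) 0        ≈⟨ ℚᵘₚ.+-congʳ ℚᵘ.1ℚᵘ (toℚᵘ-fromℚᵘ (ℚᵘ.mkℚᵘ (+ n) 0)) ⟨
    toℚᵘ 1ℚ ℚᵘ.+ toℚᵘ (fromℕ n)        ≈⟨ toℚᵘ-homo-+ 1ℚ (fromℕ n) ⟨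
    toℚᵘ (1ℚ + fromℕ n)                ∎)
  where
  import Data.Rational.Unnormalised.Base as ℚᵘ
  import Data.Rational.Unnormalised.Properties as ℚᵘₚ
  open ℚᵘₚ.≃-Reasoning
  eq : + suc n ℤ.* + 1 ≡ (+ 1 ℤ.* + 1 ℤ.+ + n ℤ.* + 1) ℤ.* + 1
  eq rewrite ℤₚ.*-identityʳ (+ n) = refl

-- Brackets of arbitrarily small width exist.
narrow : ∀ x {δ} → 0ℚ < δ → ∃[ a ] x bracketed-by a , (a + δ)
narrow x {δ} 0<δ with ℝ.inhabited x | ℝ.bounded x | recip {½ * δ} (0<* (positive⁻¹ ½) 0<δ)
... | a₀ , ba₀ | b₀ , ¬bb₀ | r , 0<r , hr≡1 with archimedean ((b₀ - a₀) * r)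
...   | N , le = search N a₀ ba₀ (λ b → ¬bb₀ (downward-≤ x bound b))
  where
  h : ℚ
  h = ½ * δ
  0<h : 0ℚ < h
  0<h = 0<* (positive⁻¹ ½) 0<δ
  bound : b₀ ≤ a₀ + fromℕ N * h
  bound = subst (_≤ a₀ + fromℕ N * h)
    (trans (solve 4 (λ a b r h → a :+ ((b :- a) :* r) :* h := a :+ (b :- a) :* (h :* r)) refl a₀ b₀ r h)
      (trans (cong (λ z → a₀ + (b₀ - a₀) * z) hr≡1)
        (solve 2 (λ a b → a :+ (b :- a) :* con 1ℚ := b) refl a₀ b₀)))
    (+-monoʳ-≤ a₀ (*-monoʳ-≤-0≤ (<⇒≤ 0<h) le))
  h+h : ∀ a → (a + h) + h ≡ a + δ
  h+h a = trans (+-assoc a h h) (cong (_+_ a)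
    (trans (sym (*-distribʳ-+ δ ½ ½)) (*-identityˡ δ)))
  search : ∀ n a → Below x a → ¬ Below x (a + fromℕ n * h) → ∃[ a ] x bracketed-by a , (a + δ)
  search zero    a ba ¬b = ⊥-elim (¬b (subst (Below x)
    (solve 2 (λ a h → a := a :+ con 0ℚ :* h) refl a h) ba))
  search (suc n) a ba ¬b with ℝ.located x (p<p+q (a + h) 0<h)
  ... | inj₂ ¬c = a , ba , subst (λ z → ¬ Below x z) (h+h a) ¬c
  ... | inj₁ c  = search n (a + h) c (subst (λ z → ¬ Below x z)
    (trans (cong (λ z → a + z * h) (fromℕ-suc n))
      (solve 3 (λ a h n → a :+ (con 1ℚ :+ n) :* h := (a :+ h) :+ n :* h) refl a h (fromℕ n))) ¬b)

*-close : ∀ {s t s' t' M δ} → 0ℚ ≤ δ → 0ℚ ≤ M → ∣ s ∣ ≤ M → ∣ t' ∣ ≤ M →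
          ∣ s - s' ∣ ≤ δ → ∣ t - t' ∣ ≤ δ → s * t ≤ s' * t' + (M + M) * δ
*-close {s} {t} {s'} {t'} {M} {δ} 0≤δ 0≤M s≤ t'≤ ds dt = begin
  s * t                                                ≡⟨ eq₁ ⟩
  s' * t' + (s * (t - t') + (s - s') * t')             ≤⟨ +-monoʳ-≤ (s' * t') (+-mono-≤ (bd s≤ dt 0≤M) bd') ⟩
  s' * t' + (M * δ + M * δ)                            ≡⟨ cong (_+_ (s' * t')) (*-distribʳ-+ δ M M) ⟨
  s' * t' + (M + M) * δ                                ∎
  where
  open ≤-Reasoning
  eq₁ = solve 4 (λ s t s' t' → s :* t := s' :* t' :+ (s :* (t :- t') :+ (s :- s') :* t')) refl s t s' t'
  bd : ∀ {u v m e} → ∣ u ∣ ≤ m → ∣ v ∣ ≤ e → 0ℚ ≤ m → u * v ≤ m * e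
  bd {u} {v} {m} {e} hu hv 0≤m = ≤-trans (p≤∣p∣ (u * v))
    (≤-trans (≤-reflexive (∣p*q∣≡∣p∣*∣q∣ u v))
      (≤-trans (*-monoʳ-≤-0≤ (0≤∣p∣ v) hu) (*-monoˡ-≤-0≤ 0≤m hv)))
  bd' : (s - s') * t' ≤ M * δ
  bd' = subst ((s - s') * t' ≤_) (*-comm δ M) (bd ds t'≤ 0≤δ)

∣-∣≤width : ∀ {a δ s s'} → a ≤ s → s ≤ a + δ → a ≤ s' → s' ≤ a + δ → ∣ s - s' ∣ ≤ δ
∣-∣≤width {a} {δ} {s} {s'} a≤s s≤b a≤s' s'≤b = ∣p∣≤
  (p-q≤r (≤-trans s≤b (+-monoˡ-≤ δ a≤s')))
  (subst (_≤ δ) (sym (p-q-neg s s')) (p-q≤r (≤-trans s'≤b (+-monoˡ-≤ δ a≤s))))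

bracket-bound : ∀ x → ∃[ M ] 0ℚ ≤ M ×
  (∀ {a δ s} → δ ≤ 1ℚ → x bracketed-by a , (a + δ) → a ≤ s → s ≤ a + δ → ∣ s ∣ ≤ M)
bracket-bound x with ℝ.inhabited x | ℝ.bounded x
... | a₀ , ba₀ | b₀ , ¬bb₀ = M , 0≤M , bnd
  where
  M : ℚ
  M = (∣ a₀ ∣ + ∣ b₀ ∣) + 1ℚ
  0≤A : 0ℚ ≤ ∣ a₀ ∣ + ∣ b₀ ∣
  0≤A = +-mono-≤ (0≤∣p∣ a₀) (0≤∣p∣ b₀)
  0≤M : 0ℚ ≤ M
  0≤M = +-mono-≤ 0≤A (<⇒≤ 0<1ℚ)
  bnd : ∀ {a δ s} → δ ≤ 1ℚ → x bracketed-by a , (a + δ) → a ≤ s → s ≤ a + δ → ∣ s ∣ ≤ M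
  bnd {a} {δ} {s} δ≤1 (ba , ¬bb) a≤s s≤b = ∣p∣≤ up lo
    where
    open ≤-Reasoning
    up : s ≤ M
    up = begin
      s            ≤⟨ s≤b ⟩
      a + δ        ≤⟨ +-mono-≤ (<⇒≤ (below<above x ba ¬bb₀)) δ≤1 ⟩
      b₀ + 1ℚ      ≤⟨ +-monoˡ-≤ 1ℚ (p≤∣p∣ b₀) ⟩
      ∣ b₀ ∣ + 1ℚ  ≡⟨ cong (_+ 1ℚ) (+-identityˡ ∣ b₀ ∣) ⟨
      (0ℚ + ∣ b₀ ∣) + 1ℚ ≤⟨ +-monoˡ-≤ 1ℚ (+-monoˡ-≤ ∣ b₀ ∣ (0≤∣p∣ a₀)) ⟩
      M            ∎
    lo : - s ≤ M
    lo = begin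
      - s          ≤⟨ neg-antimono-≤ a≤s ⟩
      - a          ≡⟨ solve 2 (λ a d → :- a := :- (a :+ d) :+ d) refl a δ ⟩
      - (a + δ) + δ ≤⟨ +-mono-≤ (neg-antimono-≤ (<⇒≤ (below<above x ba₀ ¬bb))) δ≤1 ⟩
      - a₀ + 1ℚ    ≤⟨ +-monoˡ-≤ 1ℚ (p≤∣p∣ (- a₀)) ⟩
      ∣ - a₀ ∣ + 1ℚ ≡⟨ cong (_+ 1ℚ) (∣-p∣≡∣p∣ a₀) ⟩
      ∣ a₀ ∣ + 1ℚ  ≡⟨ cong (_+ 1ℚ) (+-identityʳ ∣ a₀ ∣) ⟨
      (∣ a₀ ∣ + 0ℚ) + 1ℚ ≤⟨ +-monoˡ-≤ 1ℚ (+-monoʳ-≤ ∣ a₀ ∣ (0≤∣p∣ b₀)) ⟩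
      M            ∎

smallWidth : ∀ {K ε} → 0ℚ < K → 0ℚ < ε → ∃[ δ ] 0ℚ < δ × δ ≤ 1ℚ × K * δ ≤ ε
smallWidth {K} {ε} 0<K 0<ε with recip 0<K
... | r , 0<r , Kr≡1 with <-dense (<-⊓ (0<* 0<ε 0<r) 0<1ℚ)
...   | δ , 0<δ , δ<m = δ , 0<δ , ≤-trans (<⇒≤ δ<m) (p⊓q≤q (ε * r) 1ℚ) , (begin
  K * δ        ≤⟨ *-monoˡ-≤-0≤ (<⇒≤ 0<K) (≤-trans (<⇒≤ δ<m) (p⊓q≤p (ε * r) 1ℚ)) ⟩
  K * (ε * r)  ≡⟨ solve 3 (λ k e r → k :* (e :* r) := e :* (k :* r)) refl K ε r ⟩
  ε * (K * r)  ≡⟨ cong (ε *_) Kr≡1 ⟩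
  ε * 1ℚ       ≡⟨ *-identityʳ ε ⟩
  ε            ∎)
  where open ≤-Reasoning

commonBound : ∀ M₁ M₂ → 0ℚ ≤ M₁ → 0ℚ ≤ M₂ → ∃[ M ] 0ℚ < M × M₁ ≤ M × M₂ ≤ M
commonBound M₁ M₂ 0≤M₁ 0≤M₂ = (M₁ ⊔ M₂) + 1ℚ
  , ≤-<-trans 0≤M₁ (≤-<-trans (p≤p⊔q M₁ M₂) lt)
  , ≤-trans (p≤p⊔q M₁ M₂) (<⇒≤ lt)
  , ≤-trans (p≤q⊔p M₁ M₂) (<⇒≤ lt)
  where
  lt : M₁ ⊔ M₂ < (M₁ ⊔ M₂) + 1ℚ
  lt = p<p+q (M₁ ⊔ M₂) 0<1ℚ

module _ (x y : ℝ) {p q M δ : ℚ} (0<M : 0ℚ < M) (0<δ : 0ℚ < δ)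
  (2Mδ≤ : (M + M) * δ ≤ q - p)
  (bndˣ : ∀ {a s} → x bracketed-by a , (a + δ) → a ≤ s → s ≤ a + δ → ∣ s ∣ ≤ M)
  (bndʸ : ∀ {a s} → y bracketed-by a , (a + δ) → a ≤ s → s ≤ a + δ → ∣ s ∣ ≤ M)
  where

  -- If some point of the small rectangle has product ≤ p, then x y ≤ q.
  refute : ∀ {a c s' t'} → x bracketed-by a , (a + δ) → y bracketed-by c , (c + δ) →
           a ≤ s' → s' ≤ a + δ → c ≤ t' → t' ≤ c + δ → ¬ (p < s' * t') → ¬ Below* x y q
  refute {a} {c} {s'} {t'} bx by as' sb' ct' td' p≮ (_ , _ , _ , _ , bx' , by' , corners)
    with commonPoint x bx bx' | commonPoint y by by'
  ... | s , (as , sb) , (a's , sb'') | t , (ct , td) , (c't , td'') =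
    <-irrefl refl (<-≤-trans (corners⇒below a's sb'' c't td'' corners) (begin
      s * t                    ≤⟨ *-close (<⇒≤ 0<δ) (<⇒≤ 0<M)
                                    (bndˣ bx as sb)
                                    (bndʸ by ct' td')
                                    (∣-∣≤width as sb as' sb') (∣-∣≤width ct td ct' td') ⟩
      s' * t' + (M + M) * δ    ≤⟨ +-mono-≤ (≮⇒≥ p≮) 2Mδ≤ ⟩
      p + (q - p)              ≡⟨ solve 2 (λ p q → p :+ (q :- p) := q) refl p q ⟩
      q                        ∎))
    where open ≤-Reasoning

  decide : ∃[ a ] x bracketed-by a , (a + δ) → ∃[ c ] y bracketed-by c , (c + δ) →
           Below* x y p ⊎ ¬ Below* x y q
  decide (a , bx) (c , by)
    with p <? a * c | p <? a * (c + δ) | p <? (a + δ) * c | p <? (a + δ) * (c + δ)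
  ... | yes h₁ | yes h₂ | yes h₃ | yes h₄ =
          inj₁ (a , a + δ , c , c + δ , bx , by , h₁ , h₂ , h₃ , h₄)
  ... | no h | _ | _ | _ = inj₂ (refute bx by ≤-refl (<⇒≤ (p<p+q a 0<δ)) ≤-refl (<⇒≤ (p<p+q c 0<δ)) h)
  ... | yes _ | no h | _ | _ = inj₂ (refute bx by ≤-refl (<⇒≤ (p<p+q a 0<δ)) (<⇒≤ (p<p+q c 0<δ)) ≤-refl h)
  ... | yes _ | yes _ | no h | _ = inj₂ (refute bx by (<⇒≤ (p<p+q a 0<δ)) ≤-refl ≤-refl (<⇒≤ (p<p+q c 0<δ)) h)
  ... | yes _ | yes _ | yes _ | no h = inj₂ (refute bx by (<⇒≤ (p<p+q a 0<δ)) ≤-refl (<⇒≤ (p<p+q c 0<δ)) ≤-refl h)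

*-located : ∀ x y {p q} → p < q → Below* x y p ⊎ ¬ Below* x y q
*-located x y {p} {q} p<q =
  let (M₁ , 0≤M₁ , bnd₁)      = bracket-bound x
      (M₂ , 0≤M₂ , bnd₂)      = bracket-bound y
      (M , 0<M , M₁≤M , M₂≤M) = commonBound M₁ M₂ 0≤M₁ 0≤M₂
  in choose M 0<M
       (λ δ≤1 bx as sb → ≤-trans (bnd₁ δ≤1 bx as sb) M₁≤M)
       (λ δ≤1 by ct td → ≤-trans (bnd₂ δ≤1 by ct td) M₂≤M)
       (smallWidth {M + M} {q - p} (0<M+M 0<M) (0<q-p p<q))
  where
  Bounds : ℝ → ℚ → Set
  Bounds z M = ∀ {a δ s} → δ ≤ 1ℚ → z bracketed-by a , (a + δ) → a ≤ s → s ≤ a + δ → ∣ s ∣ ≤ M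
  choose : ∀ M → 0ℚ < M → Bounds x M → Bounds y M →
           ∃[ δ ] 0ℚ < δ × δ ≤ 1ℚ × (M + M) * δ ≤ q - p →
           Below* x y p ⊎ ¬ Below* x y q
  choose M 0<M bndˣ bndʸ (δ , 0<δ , δ≤1 , 2Mδ≤) =
    decide x y {p} {q} {M} {δ} 0<M 0<δ 2Mδ≤ (bndˣ δ≤1) (bndʸ δ≤1) (narrow x 0<δ) (narrow y 0<δ)

_*ᴿ_ : ℝ → ℝ → ℝ
x *ᴿ y = record
  { Below     = Below* x y
  ; inhabited = inhabited
  ; bounded   = bounded
  ; downward  = λ where
      p<q (a , b , c , d , bx , by , h₁ , h₂ , h₃ , h₄) →
        a , b , c , d , bx , by , <-trans p<q h₁ , <-trans p<q h₂ , <-trans p<q h₃ , <-trans p<q h₄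
  ; rounded   = λ where
      (a , b , c , d , bx , by , h₁ , h₂ , h₃ , h₄) →
        let (q , p<q , hs) = min₄ h₁ h₂ h₃ h₄ in
        q , p<q , a , b , c , d , bx , by , hs
  ; located   = *-located x y
  }
  where
  a = proj₁ (ℝ.inhabited x)
  b = proj₁ (ℝ.bounded x)
  c = proj₁ (ℝ.inhabited y)
  d = proj₁ (ℝ.bounded y)
  bx : x bracketed-by a , b
  bx = proj₂ (ℝ.inhabited x) , proj₂ (ℝ.bounded x)
  by : y bracketed-by c , d
  by = proj₂ (ℝ.inhabited y) , proj₂ (ℝ.bounded y)
  inhabited : ∃[ q ] Below* x y q
  inhabited = (k ⊓ l) - 1ℚ , a , b , c , d , bx , by
    , <-≤-trans lt (≤-trans (p⊓q≤p k l) (p⊓q≤p (a * c) (a * d)))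
    , <-≤-trans lt (≤-trans (p⊓q≤p k l) (p⊓q≤q (a * c) (a * d)))
    , <-≤-trans lt (≤-trans (p⊓q≤q k l) (p⊓q≤p (b * c) (b * d)))
    , <-≤-trans lt (≤-trans (p⊓q≤q k l) (p⊓q≤q (b * c) (b * d)))
    where
    k l : ℚ
    k = (a * c) ⊓ (a * d)
    l = (b * c) ⊓ (b * d)
    lt : (k ⊓ l) - 1ℚ < k ⊓ l
    lt = p-1<p (k ⊓ l)
  bounded : ∃[ q ] ¬ Below* x y q
  bounded = K , ¬below
    where
    K : ℚ
    K = (∣ a ∣ + ∣ b ∣) * (∣ c ∣ + ∣ d ∣)
    0≤+ : ∀ u v → 0ℚ ≤ ∣ u ∣ + ∣ v ∣
    0≤+ u v = +-mono-≤ (0≤∣p∣ u) (0≤∣p∣ v)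
    size : ∀ {u v s} → u ≤ s → s ≤ v → ∣ s ∣ ≤ ∣ u ∣ + ∣ v ∣
    size {u} {v} {s} u≤s s≤v = ∣p∣≤
      (≤-trans s≤v (≤-trans (p≤∣p∣ v) (subst (_≤ ∣ u ∣ + ∣ v ∣) (+-identityˡ ∣ v ∣)
        (+-monoˡ-≤ ∣ v ∣ (0≤∣p∣ u)))))
      (≤-trans (neg-antimono-≤ u≤s) (≤-trans (p≤∣p∣ (- u)) (subst₂ _≤_
        (trans (+-identityʳ ∣ u ∣) (sym (∣-p∣≡∣p∣ u))) refl (+-monoʳ-≤ ∣ u ∣ (0≤∣p∣ v)))))
    ¬below : ¬ Below* x y K
    ¬below (a' , b' , c' , d' , bx' , by' , corners)
      with commonPoint x bx bx' | commonPoint y by by'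
    ... | s , (as , sb) , (a's , sb') | t , (ct , td) , (c't , td') =
      <-irrefl refl (<-≤-trans (corners⇒below a's sb' c't td' corners) (begin
        s * t          ≤⟨ p≤∣p∣ (s * t) ⟩
        ∣ s * t ∣      ≡⟨ ∣p*q∣≡∣p∣*∣q∣ s t ⟩
        ∣ s ∣ * ∣ t ∣  ≤⟨ *-monoʳ-≤-0≤ (0≤∣p∣ t) (size as sb) ⟩
        (∣ a ∣ + ∣ b ∣) * ∣ t ∣ ≤⟨ *-monoˡ-≤-0≤ (0≤+ a b) (size ct td) ⟩
        K              ∎))
      where open ≤-Reasoning

positiveBelow : ∀ x → 0ᴿ <ᴿ x → ∃[ t ] 0ℚ < t × Below x t
positiveBelow x (q , q≮0 , bq) with ℝ.rounded x bq
... | t , q<t , bt = t , ≤-<-trans (≮⇒≥ q≮0) q<t , bt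

*ᴿ-positive : ∀ x y → 0ᴿ <ᴿ x → 0ᴿ <ᴿ y → 0ᴿ <ᴿ x *ᴿ y
*ᴿ-positive x y 0<x 0<y with positiveBelow x 0<x | positiveBelow y 0<y | ℝ.bounded x | ℝ.bounded y
... | a , 0<a , ba | c , 0<c , bc | b , ¬bb | d , ¬bd =
  0ℚ , <-irrefl refl , a , b , c , d , (ba , ¬bb) , (bc , ¬bd)
  , 0<* 0<a 0<c , 0<* 0<a 0<d , 0<* 0<b 0<c , 0<* 0<b 0<d
  where
  0<b = <-trans 0<a (below<above x ba ¬bb)
  0<d = <-trans 0<c (below<above y bc ¬bd)

-- For x > 0:  q < 1/x  iff  q s < 1 for some rational s ≥ x.
inv : (x : ℝ) → 0ᴿ <ᴿ x → ℝ
inv x 0<x = record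
  { Below     = Below⁻¹
  ; inhabited = 0ℚ , u , 0<u , ¬bu , subst (_< 1ℚ) (sym (*-zeroˡ u)) 0<1ℚ
  ; bounded   = bounded
  ; downward  = λ where
      p<q (s , 0<s , ¬bs , qs<1) → s , 0<s , ¬bs , <-trans (*-monoʳ-<-0< 0<s p<q) qs<1
  ; rounded   = rounded
  ; located   = located
  }
  where
  Below⁻¹ : ℚ → Set
  Below⁻¹ q = ∃[ s ] 0ℚ < s × ¬ Below x s × q * s < 1ℚ
  t = proj₁ (positiveBelow x 0<x)
  0<t = proj₁ (proj₂ (positiveBelow x 0<x))
  bt = proj₂ (proj₂ (positiveBelow x 0<x))
  u = proj₁ (ℝ.bounded x)
  ¬bu = proj₂ (ℝ.bounded x)
  0<u : 0ℚ < u
  0<u = <-trans 0<t (below<above x bt ¬bu)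
  bounded : ∃[ q ] ¬ Below⁻¹ q
  bounded with recip 0<t
  ... | r , 0<r , tr≡1 = r , λ where
    (s , 0<s , ¬bs , rs<1) → <-asym rs<1
      (subst₂ _<_ tr≡1 (*-comm s r) (*-monoʳ-<-0< 0<r (below<above x bt ¬bs)))
  rounded : ∀ {p} → Below⁻¹ p → ∃[ q ] p < q × Below⁻¹ q
  rounded {p} (s , 0<s , ¬bs , ps<1) with recip 0<s
  ... | r , 0<r , sr≡1 with <-dense {p} {r} (*-cancelʳ-<-0< 0<s (subst (p * s <_) (trans (sym sr≡1) (*-comm s r)) ps<1))
  ...   | q , p<q , q<r = q , p<q , s , 0<s , ¬bs
    , subst (q * s <_) (trans (*-comm r s) sr≡1) (*-monoʳ-<-0< 0<s q<r)
  located : ∀ {p q} → p < q → Below⁻¹ p ⊎ ¬ Below⁻¹ q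
  located {p} {q} p<q with ≤-total p 0ℚ
  ... | inj₁ p≤0 = inj₁ (u , 0<u , ¬bu
        , ≤-<-trans (subst (p * u ≤_) (*-zeroˡ u) (*-monoʳ-≤-0≤ (<⇒≤ 0<u) p≤0)) 0<1ℚ)
  ... | inj₂ 0≤p with <-dense p<q
  ...   | m , p<m , m<q with recip (≤-<-trans 0≤p p<m) | recip (≤-<-trans 0≤p p<q)
  ...     | v , 0<v , mv≡1 | w , 0<w , qw≡1 with ℝ.located x w<v
    where
    w<v : w < v
    w<v = *-cancelʳ-<-0< (≤-<-trans 0≤p p<m) (subst₂ _<_ (*-comm m w)
      (trans qw≡1 (trans (sym mv≡1) (*-comm m v))) (*-monoʳ-<-0< 0<w m<q))
  ...       | inj₂ ¬bv = inj₁ (v , 0<v , ¬bv , subst (p * v <_) mv≡1 (*-monoʳ-<-0< 0<v p<m))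
  ...       | inj₁ bw = inj₂ λ where
    (s , 0<s , ¬bs , qs<1) → <-asym qs<1
      (subst (_< q * s) qw≡1 (*-monoˡ-<-0< (≤-<-trans 0≤p p<q) (below<above x bw ¬bs)))

_÷ᴿ_⟨_⟩ : ℝ → (y : ℝ) → 0ᴿ <ᴿ y → ℝ
x ÷ᴿ y ⟨ 0<y ⟩ = x *ᴿ inv y 0<y

-- The n-th root x^(1/n) of x ≥ 0 (with value 0 for x < 0).
root : (n : ℕ) .{{_ : ℕ.NonZero n}} → ℝ → ℝ
root n x = record
  { Below     = Belowʳ
  ; inhabited = 0ℚ - 1ℚ , inj₁ (p-1<p 0ℚ)
  ; bounded   = bounded
  ; downward  = λ where
      p<q (inj₁ q<0)                  → inj₁ (<-trans p<q q<0)
      p<q (inj₂ (r , 0≤r , q<r , br)) → inj₂ (r , 0≤r , <-trans p<q q<r , br)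
  ; rounded   = λ where
      (inj₁ p<0) → let (q , p<q , q<0) = <-dense p<0 in q , p<q , inj₁ q<0
      (inj₂ (r , 0≤r , p<r , br)) →
        let (q , p<q , q<r) = <-dense p<r in q , p<q , inj₂ (r , 0≤r , q<r , br)
  ; located   = located
  }
  where
  Belowʳ : ℚ → Set
  Belowʳ q = q < 0ℚ ⊎ (∃[ r ] 0ℚ ≤ r × q < r × Below x (r ^ n))
  bounded : ∃[ q ] ¬ Belowʳ q
  bounded with ℝ.bounded x
  ... | b , ¬bb = b ⊔ 1ℚ , λ where
    (inj₁ h) → <-asym h (<-≤-trans 0<1ℚ (p≤q⊔p b 1ℚ))
    (inj₂ (r , 0≤r , q<r , br)) → ¬bb (downward-≤ x
      (≤-trans (p≤p⊔q b 1ℚ) (≤-trans (<⇒≤ q<r)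
        (p≤p^n n (≤-trans (p≤q⊔p b 1ℚ) (<⇒≤ q<r))))) br)
  located : ∀ {p q} → p < q → Belowʳ p ⊎ ¬ Belowʳ q
  located {p} {q} p<q with p <? 0ℚ
  ... | yes p<0 = inj₁ (inj₁ p<0)
  ... | no  p≮0 with <-dense p<q
  ...   | m , p<m , m<q with ℝ.located x (^-mono-< n (≤-trans (≮⇒≥ p≮0) (<⇒≤ p<m)) m<q)
  ...     | inj₁ b  = inj₁ (inj₂ (m , ≤-trans (≮⇒≥ p≮0) (<⇒≤ p<m) , p<m , b))
  ...     | inj₂ ¬b = inj₂ λ where
    (inj₁ q<0) → p≮0 (<-trans p<q q<0)
    (inj₂ (r , 0≤r , q<r , br)) → ¬b (downward-≤ x
      (^-mono-≤ n (≤-trans (≮⇒≥ p≮0) (<⇒≤ p<q)) (<⇒≤ q<r)) br)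

root-positive : ∀ n .{{_ : ℕ.NonZero n}} x → 0ᴿ <ᴿ x → 0ᴿ <ᴿ root n x
root-positive n x 0<x with positiveBelow x 0<x
... | t , 0<t , bt = 0ℚ , <-irrefl refl , inj₂ (r , <⇒≤ 0<r , 0<r
      , downward-≤ x (≤-trans (p^n≤p n (<⇒≤ 0<r) (p⊓q≤q t 1ℚ)) (p⊓q≤p t 1ℚ)) bt)
  where
  r : ℚ
  r = t ⊓ 1ℚ
  0<r : 0ℚ < r
  0<r = <-⊓ 0<t 0<1ℚ

ι-positive : ∀ {q} → 0ℚ < q → 0ᴿ <ᴿ ι q
ι-positive 0<q = 0ℚ , <-irrefl refl , 0<q

1≤⇒positive : ∀ x → 1ᴿ ≤ᴿ x → 0ᴿ <ᴿ x
1≤⇒positive x 1≤x = 0ℚ , <-irrefl refl , 1≤x 0ℚ 0<1ℚ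

ιℤ : ℤ → ℝ
ιℤ k = ι (k / 1)

-- IsFloor x k  means  k = ⌊ x ⌋.  A relation rather than a function, because
-- the order on ℝ is not decidable.
IsFloor : ℝ → ℤ → Set
IsFloor x k = ιℤ k ≤ᴿ x × x <ᴿ ιℤ (ℤ.suc k)

-- For n ≠ 0 and p ≥ 2 the exponent k of p in n satisfies k ≤ n, so searching
-- downwards from n finds it.
ordℕ : (p n : ℕ) → ℕ
ordℕ p n = go n
  where
  go : ℕ → ℕ
  go zero    = zero
  go (suc k) = if does (p ℕ.^ suc k ℕ∣.∣? n) then suc k else go k

ordℤ : (p : ℕ) → ℤ → ℕ
ordℤ p k = ordℕ p ℤ.∣ k ∣

ord : (p : ℕ) → ℚ → ℤ
ord p q = + ordℤ p (↥ q) ℤ.- + ordℕ p (↧ₙ q)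

αₚ : (p : ℕ) → ℚ → ℤ
αₚ p a = exponent (ord p a)
  where
  exponent : ℤ → ℤ
  exponent o@(+ _)    = ceiling (o / 2)
  exponent o@(-[1+ _ ]) = ceiling (o / 3)

_^ℤ_ : (p : ℕ) .{{_ : ℕ.NonZero p}} → ℤ → ℚ
p ^ℤ (+ k)      = + (p ℕ.^ k) / 1
p ^ℤ (-[1+ k ]) = (+ 1 / (p ℕ.^ suc k)) {{ℕₚ.m^n≢0 p (suc k)}}

-- ∏_{p ≤ n, p prime} p ^ e p
primeProduct : (ℕ → ℤ) → ℕ → ℚ
primeProduct e zero    = 1ℚ
primeProduct e (suc n) with prime? (suc n)
... | yes _ = (suc n ^ℤ e (suc n)) * primeProduct e n
... | no  _ = primeProduct e n

-- A prime p with αₚ p a ≠ 0 divides the numerator or the denominator of a,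
-- so for a ≠ 0 no prime beyond their maximum contributes to ∏_p p ^ αₚ p a.
N : ℚ → ℚ
N a = primeProduct (λ p → αₚ p a) (ℤ.∣ ↥ a ∣ ℕ.⊔ ↧ₙ a)

^ℤ-positive : ∀ p .{{_ : ℕ.NonZero p}} k → 0ℚ < p ^ℤ k
^ℤ-positive p (+ k)      = positive⁻¹ _ {{normalize-pos (p ℕ.^ k) 1 {{_}} {{ℕₚ.m^n≢0 p k}}}}
^ℤ-positive p (-[1+ k ]) = positive⁻¹ _
  {{normalize-pos 1 (p ℕ.^ suc k) {{ℕₚ.m^n≢0 p (suc k)}}}}

primeProduct-positive : ∀ e n → 0ℚ < primeProduct e n
primeProduct-positive e zero    = 0<1ℚ
primeProduct-positive e (suc n) with prime? (suc n)
... | yes _ = 0<* (^ℤ-positive (suc n) (e (suc n))) (primeProduct-positive e n)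
... | no  _ = primeProduct-positive e n

N-positive : ∀ a → 0ℚ < N a
N-positive a = primeProduct-positive (λ p → αₚ p a) (ℤ.∣ ↥ a ∣ ℕ.⊔ ↧ₙ a)

Curve : Set
Curve = ℤ × ℤ

4A³+27B² : Curve → ℤ
4A³+27B² (A , B) = + 4 ℤ.* A ℤ.^ 3 ℤ.+ + 27 ℤ.* B ℤ.^ 2

Δ : Curve → ℤ
Δ E = ℤ.- (+ 16) ℤ.* 4A³+27B² E

Ẽ : Pred Curve 0ℓ
Ẽ E = Δ E ≢ + 0

ℰ : Pred Curve 0ℓ
ℰ E@(A , B) = Ẽ E × ¬ (∃[ p ] Prime p × (+ (p ℕ.^ 4)) ℤ∣.∣ A × (+ (p ℕ.^ 6)) ℤ∣.∣ B)

/1-≢0 : ∀ {k} → k ≢ + 0 → k / 1 ≢ 0ℚ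
/1-≢0 {k} k≢0 k/1≡0 = k≢0 (trans (sym (↥-/ k 1))
  (trans (cong (ℤ._* gcd k (+ 1)) (p≡0⇒↥p≡0 (k / 1) k/1≡0)) (ℤₚ.*-zeroˡ (gcd k (+ 1)))))

Ẽ⇒nonZero : ∀ E → Ẽ E → NonZero (4A³+27B² E / 1)
Ẽ⇒nonZero E ΔE≢0 = ≢-nonZero (/1-≢0 (λ eq →
  ΔE≢0 (trans (cong (ℤ.- (+ 16) ℤ.*_) eq) refl)))

j-invariant : (E : Curve) → Ẽ E → ℚ
j-invariant E@(A , B) E∈Ẽ =
  (+ 1728 / 1) * (((+ 4 ℤ.* A ℤ.^ 3) / 1) ÷ (4A³+27B² E / 1)) {{Ẽ⇒nonZero E E∈Ẽ}}

Ẽⱼ : ℚ → Pred Curve 0ℓ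
Ẽⱼ j E = Σ[ E∈Ẽ ∈ Ẽ E ] j-invariant E E∈Ẽ ≡ j

ℰⱼ : ℚ → Pred Curve 0ℓ
ℰⱼ j E = Σ[ E∈ℰ ∈ ℰ E ] j-invariant E (proj₁ E∈ℰ) ≡ j

H : (α β : ℝ) → Curve → ℝ
H α β (A , B) = (α *ᴿ ιℤ (+ (ℤ.∣ A ∣ ℕ.^ 3))) ⊔ᴿ (β *ᴿ ιℤ (B ℤ.^ 2))

infix 5 _⟨_⨾_⟩

_⟨_⨾_⟩ : Pred Curve 0ℓ → ℝ → (Curve → ℝ) → Pred Curve 0ℓ
(F ⟨ X ⨾ h ⟩) E = F E × h E ≤ᴿ X

1728ℚ : ℚ
1728ℚ = + 1728 / 1

*-≢0 : ∀ p q → p ≢ 0ℚ → q ≢ 0ℚ → p * q ≢ 0ℚ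
*-≢0 p q p≢0 q≢0 pq≡0 = p≢0 (begin
  p              ≡⟨ *-identityʳ p ⟨
  p * 1ℚ         ≡⟨ cong (p *_) (*-inverseʳ q) ⟨
  p * (q * 1/ q) ≡⟨ *-assoc p q (1/ q) ⟨
  (p * q) * 1/ q ≡⟨ cong (_* 1/ q) pq≡0 ⟩
  0ℚ * 1/ q      ≡⟨ *-zeroˡ (1/ q) ⟩
  0ℚ             ∎)
  where
  open ≡-Reasoning
  instance
    q-nonZero : NonZero q
    q-nonZero = ≢-nonZero q≢0

module Parametrisation (j : ℚ) (j≢0 : j ≢ 0ℚ) (j≢1728 : j ≢ 1728ℚ) where

  1728-j≢0 : 1728ℚ - j ≢ 0ℚ
  1728-j≢0 eq = j≢1728 (trans (solve 2 (λ j k → j := k :- (k :- j)) refl j 1728ℚ)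
    (trans (cong (_-_ 1728ℚ) eq) (+-identityʳ 1728ℚ)))

  instance
    27j-nonZero : NonZero ((+ 27 / 1) * j)
    27j-nonZero = ≢-nonZero (*-≢0 (+ 27 / 1) j (λ ()) j≢0)

  a : ℚ
  a = ((+ 4 / 1) * (1728ℚ - j)) ÷ ((+ 27 / 1) * j)

  instance
    a-nonZero : NonZero a
    a-nonZero = ≢-nonZero (*-≢0 ((+ 4 / 1) * (1728ℚ - j)) (1/ ((+ 27 / 1) * j))
      (*-≢0 (+ 4 / 1) (1728ℚ - j) (λ ()) 1728-j≢0)
      (λ eq → 1≢0 (trans (sym (*-inverseʳ ((+ 27 / 1) * j)))
        (trans (cong (((+ 27 / 1) * j) *_) eq) (*-zeroʳ ((+ 27 / 1) * j))))))

  A-formula B-formula : ℤ → ℚ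
  A-formula m = (N a ^ 2 * (m / 1) ^ 2) ÷ a
  B-formula m = (N a ^ 3 * (m / 1) ^ 3) ÷ a

  -- These are the integers A(j,m), B(j,m) provided that the rational numbers
  -- A-formula m, B-formula m are integral.
  A B : ℤ → ℤ
  A m = ↥ A-formula m
  B m = ↥ B-formula m

  E : ℤ → Curve
  E m = A m , B m

  denominator-positive : ∀ x → 1ᴿ ≤ᴿ x → 0ᴿ <ᴿ ι (N a) *ᴿ root 6 x
  denominator-positive x 1≤x = *ᴿ-positive (ι (N a)) (root 6 x)
    (ι-positive (N-positive a)) (root-positive 6 x (1≤⇒positive x 1≤x))

  c : (α β : ℝ) → 1ᴿ ≤ᴿ α → 1ᴿ ≤ᴿ β → ℝ
  c α β 1≤α 1≤β =
      (root 2 (ι ∣ a ∣) ÷ᴿ ι (N a) *ᴿ root 6 α ⟨ denominator-positive α 1≤α ⟩)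
    ⊓ᴿ (root 3 (ι ∣ a ∣) ÷ᴿ ι (N a) *ᴿ root 6 β ⟨ denominator-positive β 1≤β ⟩)

SquareFree : ℤ → Set
SquareFree m = ∀ d → (+ (d ℕ.* d)) ℤ∣.∣ m → d ≡ 1

HasCardinality : {S : Set} → Pred S 0ℓ → ℕ → Set
HasCardinality {S} P n = Σ[ xs ∈ List S ]
  Unique xs × (∀ x → x ∈ xs ⇔ P x) × length xs ≡ n

module Submission where

-- Put b = 1/a. The equation j(E) = j says B² = a A³ with A ≠ 0, so t = B/A satisfies
-- A = t² b and B = t³ b, and the curves correspond to the rationals t ≠ 0 for which t² b
-- and t³ b are integers. Comparing valuations at every prime, and using that the exponent
-- of p in N a is the least k with 2k ≥ ord a and 3k ≥ ord a, these are the t = N a · m with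
-- m ∈ ℤ. The same valuations bound ord A(j,m) and ord B(j,m) and decide minimality.
-- Finally |A|³ |a|³ = (N a |m|)⁶ = B² |a|², and both height conditions become upper bounds
-- for |m|. As reals are lower cuts, the latter is an argument with rational approximations
-- up to a factor r > 1, where r is chosen with a power below a given constant > 1.

-- The height step in real terms: the bound on k = |m| is g^(1/n) X^(1/6) / (ν α^(1/6)). Since n e =
-- 6, its sixth power is g^e X / (ν^6 α), so k stays within it exactly when α (ν k)^6 ≤ g^e X, and
-- by v g^e = (ν k)^6 this says α v ≤ X. These roots need not be rational, and a hypothesis `x ≤ᴿ y`
-- speaks only of rationals strictly below `x`. Each approximation of a root and each use of such a
-- hypothesis therefore costs a factor slightly above 1, and the total cost must fit into the gap
-- left by a strict inequality. Undecidability of the order on `ℝ` also shapes the count: a floor of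
-- the bound is obtained only up to double negation, while the cardinality is computed from any
-- given floor.

open import Algebra.Bundles using (module CommutativeRing)
open import Data.Bool.Base using (if_then_else_)
open import Data.Empty using (⊥-elim)
open import Data.Integer as ℤ using (ℤ; +_; -[1+_])
import Data.Integer.DivMod as ℤ/
import Data.Integer.Divisibility as ℤ∣
import Data.Integer.Properties as ℤₚ
import Data.Integer.Solver as ℤ-Solver
open import Data.List.Base using (List; []; _∷_; length; map)
open import Data.List.Membership.Propositional using (_∈_)
open import Data.List.Membership.Propositional.Properties using (∈-map⁺; ∈-map⁻)
open import Data.List.Properties using (length-map)
open import Data.List.Relation.Unary.All using (All; []; _∷_; tabulate)
open import Data.List.Relation.Unary.AllPairs using ([]; _∷_)
open import Data.List.Relation.Unary.Any using (here; there)
open import Data.List.Relation.Unary.Unique.Propositional using (Unique)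
import Data.List.Relation.Unary.Unique.Propositional.Properties as Unique
open import Data.Nat as ℕ using (ℕ; zero; suc; z≤n; s≤s)
import Data.Nat.Coprimality as Coprimality
import Data.Nat.Divisibility as ℕ∣
open import Data.Nat.Primality
  using (Prime; prime?; euclidsLemma; prime⇒nonZero; prime⇒nonTrivial; prime⇒irreducible; prime[2])
open import Data.Nat.Primality.Factorisation using (factorise)
import Data.Nat.Properties as ℕₚ
open import Data.Product using (∃-syntax; _×_; _,_; proj₁; proj₂)
open import Data.Rational.Base
open import Data.Rational.Properties
open import Data.Rational.Solver using (module +-*-Solver)
import Data.Rational.Unnormalised.Base as ℚᵘ
import Data.Rational.Unnormalised.Properties as ℚᵘₚ
open import Data.Sum using (_⊎_; inj₁; inj₂; [_,_]′)
open import Function.Base using (_∘_; case_of_)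
open import Function.Bundles using (_⇔_; mk⇔; Equivalence)
open import Relation.Binary.PropositionalEquality
  using (_≡_; _≢_; refl; sym; trans; cong; cong₂; subst; subst₂; module ≡-Reasoning)
open import Relation.Nullary using (¬_; yes; no; does; contradiction)
open import Relation.Unary using (_≐_)
open import Defs

open import Algebra.Definitions.RawSemiring +-*-rawSemiring using (_^_)
open import Algebra.Properties.CommutativeSemiring.Exp
  (CommutativeRing.commutativeSemiring +-*-commutativeRing) using (^-distrib-*; ^-assocʳ)
open +-*-Solver using (solve; _:+_; _:*_; _:-_; :-_; _:^_; _:=_; con)
open ℤ-Solver.+-*-Solver using () renaming
  (solve to ℤsolve; _:+_ to _⊕_; _:-_ to _⊖_; :-_ to ⊝_; _:*_ to _⊗_; _:=_ to _⊜_; con to conℤ)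

-- Exponents of primes

-- The search loop of ordℕ is local to its definition, hence out of scope here.
-- Checking ordℕ-suc solves the metavariable with it; abstracting suc n by "with"
-- separates the number from the loop counter, which makes the unification problem a pattern.
mutual
  ordSearch : (p n k : ℕ) → ℕ
  ordSearch = _

  ordℕ-suc : ∀ p n → ordℕ p (suc n) ≡
    (if does (p ℕ.^ suc n ℕ∣.∣? suc n) then suc n else ordSearch p (suc n) n)
  ordℕ-suc p n with suc n
  ... | w = refl

ordSearch-∣ : ∀ p n k → p ℕ.^ ordSearch p n k ℕ∣.∣ n
ordSearch-∣ p n zero    = ℕ∣.1∣ n
ordSearch-∣ p n (suc k) with p ℕ.^ suc k ℕ∣.∣? n
... | yes d = d
... | no  _ = ordSearch-∣ p n k

ordSearch-max : ∀ p n k {i} → i ℕ.≤ k → p ℕ.^ i ℕ∣.∣ n → i ℕ.≤ ordSearch p n k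
ordSearch-max p n zero    i≤0 _ = i≤0
ordSearch-max p n (suc k) i≤k d with p ℕ.^ suc k ℕ∣.∣? n
... | yes _ = i≤k
... | no ¬d with ℕₚ.m≤n⇒m<n∨m≡n i≤k
...   | inj₁ (s≤s i≤k′) = ordSearch-max p n k i≤k′ d
...   | inj₂ refl       = contradiction d ¬d

ordℕ-∣ : ∀ p n → p ℕ.^ ordℕ p n ℕ∣.∣ n
ordℕ-∣ p n = ordSearch-∣ p n n

n<p^n : ∀ {p} → 1 ℕ.< p → ∀ n → n ℕ.< p ℕ.^ n
n<p^n 1<p zero = s≤s z≤n
n<p^n {p} 1<p (suc n) = begin-strict
  suc n          ≤⟨ n<p^n 1<p n ⟩
  p ℕ.^ n        <⟨ ℕₚ.m<m*n (p ℕ.^ n) p {{ℕ.>-nonZero (ℕₚ.≤-<-trans z≤n (n<p^n 1<p n))}} 1<p ⟩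
  p ℕ.^ n ℕ.* p  ≡⟨ ℕₚ.*-comm (p ℕ.^ n) p ⟩
  p ℕ.^ suc n    ∎
  where open ℕₚ.≤-Reasoning

^-monoʳ-∣ : ∀ m {i k} → i ℕ.≤ k → m ℕ.^ i ℕ∣.∣ m ℕ.^ k
^-monoʳ-∣ m {i} {k} i≤k = subst (λ l → m ℕ.^ i ℕ∣.∣ m ℕ.^ l) (ℕₚ.m+[n∸m]≡n i≤k)
  (subst (m ℕ.^ i ℕ∣.∣_) (sym (ℕₚ.^-distribˡ-+-* m i (k ℕ.∸ i))) (ℕ∣.m∣m*n (m ℕ.^ (k ℕ.∸ i))))

prime>1 : ∀ {p} → Prime p → 1 ℕ.< p
prime>1 pr = ℕ.nonTrivial⇒n>1 _ {{prime⇒nonTrivial pr}}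

-- From `p ^ k ∣ n` follows `k < p ^ k ≤ n`, so a search starting at `n` passes every exponent that
-- divides. For `n ≡ 0` there would be no largest one.
ordℕ-max : ∀ {p n k} → Prime p → n ≢ 0 → p ℕ.^ k ℕ∣.∣ n → k ℕ.≤ ordℕ p n
ordℕ-max {p} {n} {k} pr n≢0 d = ordSearch-max p n n k≤n d
  where
  k≤n : k ℕ.≤ n
  k≤n = ℕₚ.≤-trans (ℕₚ.<⇒≤ (n<p^n (prime>1 pr) k)) (ℕ∣.∣⇒≤ {{ℕ.≢-nonZero n≢0}} d)

ordℕ-unique : ∀ {p} → Prime p → ∀ k {u} → u ≢ 0 → ¬ p ℕ∣.∣ u → ordℕ p (p ℕ.^ k ℕ.* u) ≡ k
ordℕ-unique {p} pr k {u} u≢0 p∤u = ℕₚ.≤-antisym (ℕₚ.≮⇒≥ upper)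
  (ordℕ-max pr n≢0 (ℕ∣.m∣m*n u))
  where
  instance
    p^k≢0 : ℕ.NonZero (p ℕ.^ k)
    p^k≢0 = ℕₚ.m^n≢0 p k {{prime⇒nonZero pr}}
  n≢0 : p ℕ.^ k ℕ.* u ≢ 0
  n≢0 eq = u≢0 (ℕₚ.*-cancelˡ-≡ u 0 (p ℕ.^ k) (trans eq (sym (ℕₚ.*-zeroʳ (p ℕ.^ k)))))
  upper : ¬ k ℕ.< ordℕ p (p ℕ.^ k ℕ.* u)
  upper k< = p∤u (ℕ∣.*-cancelˡ-∣ (p ℕ.^ k) (subst (ℕ∣._∣ p ℕ.^ k ℕ.* u) (ℕₚ.*-comm p (p ℕ.^ k))
    (ℕ∣.∣-trans (^-monoʳ-∣ p k<) (ordℕ-∣ p _))))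

ordℕ-split : ∀ {p n} → Prime p → n ≢ 0 →
  ∃[ u ] n ≡ p ℕ.^ ordℕ p n ℕ.* u × u ≢ 0 × ¬ p ℕ∣.∣ u
ordℕ-split {p} {n} pr n≢0 with ordℕ-∣ p n
... | ℕ∣.divides u eq = u , n≡ , u≢0 , p∤u
  where
  n≡ : n ≡ p ℕ.^ ordℕ p n ℕ.* u
  n≡ = trans eq (ℕₚ.*-comm u _)
  u≢0 : u ≢ 0
  u≢0 u≡0 = n≢0 (trans eq (cong (ℕ._* p ℕ.^ ordℕ p n) u≡0))
  p∤u : ¬ p ℕ∣.∣ u
  p∤u p∣u = ℕₚ.<-irrefl refl (ordℕ-max {k = suc (ordℕ p n)} pr n≢0
    (subst (p ℕ.^ suc (ordℕ p n) ℕ∣.∣_) (sym eq) (ℕ∣.*-monoˡ-∣ (p ℕ.^ ordℕ p n) p∣u)))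

-- Euclid's lemma keeps the product of the two `p`-free parts `p`-free; `ordℕ-unique` then reads off
-- the exponent.
ordℕ-* : ∀ {p m n} → Prime p → m ≢ 0 → n ≢ 0 → ordℕ p (m ℕ.* n) ≡ ordℕ p m ℕ.+ ordℕ p n
ordℕ-* {p} {m} {n} pr m≢0 n≢0 with ordℕ-split pr m≢0 | ordℕ-split pr n≢0
... | u , m≡ , u≢0 , p∤u | v , n≡ , v≢0 , p∤v = trans (cong (ordℕ p) mn≡)
  (ordℕ-unique pr (ordℕ p m ℕ.+ ordℕ p n)
    ([ u≢0 , v≢0 ]′ ∘ ℕₚ.m*n≡0⇒m≡0∨n≡0 u)
    ([ p∤u , p∤v ]′ ∘ euclidsLemma u v pr))
  where
  mn≡ : m ℕ.* n ≡ p ℕ.^ (ordℕ p m ℕ.+ ordℕ p n) ℕ.* (u ℕ.* v)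
  mn≡ = trans (cong₂ ℕ._*_ m≡ n≡) (trans (ℕₚ.[m*n]*[o*p]≡[m*o]*[n*p] (p ℕ.^ ordℕ p m) u _ v)
    (cong (ℕ._* (u ℕ.* v)) (sym (ℕₚ.^-distribˡ-+-* p (ordℕ p m) (ordℕ p n)))))

ordℕ-∤ : ∀ {p n} → Prime p → n ≢ 0 → ¬ p ℕ∣.∣ n → ordℕ p n ≡ 0
ordℕ-∤ {p} {n} pr n≢0 p∤n = trans (cong (ordℕ p) (sym (ℕₚ.*-identityˡ n))) (ordℕ-unique pr 0 n≢0 p∤n)

ordℕ-p^k : ∀ {p} → Prime p → ∀ k → ordℕ p (p ℕ.^ k) ≡ k
ordℕ-p^k {p} pr k = trans (cong (ordℕ p) (sym (ℕₚ.*-identityʳ (p ℕ.^ k))))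
  (ordℕ-unique pr k (λ ()) (λ p∣1 → ℕₚ.<-irrefl (sym (ℕ∣.∣1⇒≡1 p∣1)) (prime>1 pr)))

prime∣^⇒∣ : ∀ {p q} → Prime p → ∀ k → p ℕ∣.∣ q ℕ.^ k → p ℕ∣.∣ q
prime∣^⇒∣ pr zero    p∣1 = contradiction (ℕ∣.∣1⇒≡1 p∣1) (ℕₚ.>⇒≢ (prime>1 pr))
prime∣^⇒∣ {p} {q} pr (suc k) d = [ (λ x → x) , prime∣^⇒∣ pr k ]′ (euclidsLemma q (q ℕ.^ k) pr d)

-- Integers inside `ℚ` and valuations of rational numbers

toℚᵘ-/ : ∀ i n .{{_ : ℕ.NonZero n}} → toℚᵘ (i / n) ℚᵘ.≃ i ℚᵘ./ n
toℚᵘ-/ i (suc n) = toℚᵘ-fromℚᵘ (ℚᵘ.mkℚᵘ i n)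

-- For a variable `i` the normalisation in `i / 1` is stuck; this form exposes numerator and
-- denominator.
/1≡mkℚ : ∀ i → i / 1 ≡ mkℚ i 0 (Coprimality.sym (Coprimality.1-coprimeTo ℤ.∣ i ∣))
/1≡mkℚ i = fromℚᵘ-toℚᵘ (mkℚ i 0 _)

↥-/1 : ∀ i → ↥ (i / 1) ≡ i
↥-/1 i = cong ↥_ (/1≡mkℚ i)

/1-injective : ∀ {i k} → i / 1 ≡ k / 1 → i ≡ k
/1-injective {i} {k} eq = trans (sym (↥-/1 i)) (trans (cong ↥_ eq) (↥-/1 k))

/1-* : ∀ i k → (i ℤ.* k) / 1 ≡ (i / 1) * (k / 1)
/1-* i k = toℚᵘ-injective (begin
  toℚᵘ ((i ℤ.* k) / 1)              ≈⟨ toℚᵘ-/ (i ℤ.* k) 1 ⟩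
  (i ℚᵘ./ 1) ℚᵘ.* (k ℚᵘ./ 1)        ≈⟨ ℚᵘₚ.*-cong (toℚᵘ-/ i 1) (toℚᵘ-/ k 1) ⟨
  toℚᵘ (i / 1) ℚᵘ.* toℚᵘ (k / 1)    ≈⟨ toℚᵘ-homo-* (i / 1) (k / 1) ⟨
  toℚᵘ ((i / 1) * (k / 1))          ∎)
  where open ℚᵘₚ.≃-Reasoning

/1-+ : ∀ i k → (i ℤ.+ k) / 1 ≡ i / 1 + k / 1
/1-+ i k = toℚᵘ-injective (begin
  toℚᵘ ((i ℤ.+ k) / 1)              ≈⟨ toℚᵘ-/ (i ℤ.+ k) 1 ⟩
  (i ℤ.+ k) ℚᵘ./ 1                  ≈⟨ ℚᵘ.*≡* (cong (ℤ._* + 1) (cong₂ ℤ._+_ (sym (ℤₚ.*-identityʳ i)) (sym (ℤₚ.*-identityʳ k)))) ⟩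
  (i ℚᵘ./ 1) ℚᵘ.+ (k ℚᵘ./ 1)        ≈⟨ ℚᵘₚ.+-cong (toℚᵘ-/ i 1) (toℚᵘ-/ k 1) ⟨
  toℚᵘ (i / 1) ℚᵘ.+ toℚᵘ (k / 1)    ≈⟨ toℚᵘ-homo-+ (i / 1) (k / 1) ⟨
  toℚᵘ (i / 1 + k / 1)              ∎)
  where open ℚᵘₚ.≃-Reasoning

/1-^ : ∀ i n → (i ℤ.^ n) / 1 ≡ (i / 1) ^ n
/1-^ i zero    = refl
/1-^ i (suc n) = trans (/1-* i (i ℤ.^ n)) (cong ((i / 1) *_) (/1-^ i n))

/1-mono-≤ : ∀ {i k} → i ℤ.≤ k → i / 1 ≤ k / 1
/1-mono-≤ {i} {k} i≤k = subst₂ _≤_ (sym (/1≡mkℚ i)) (sym (/1≡mkℚ k))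
  (*≤* (subst₂ ℤ._≤_ (sym (ℤₚ.*-identityʳ i)) (sym (ℤₚ.*-identityʳ k)) i≤k))

∣/1∣ : ∀ i → ∣ i / 1 ∣ ≡ + ℤ.∣ i ∣ / 1
∣/1∣ i = trans (cong ∣_∣ (/1≡mkℚ i)) (sym (/1≡mkℚ (+ ℤ.∣ i ∣)))

i/n*n≡i : ∀ i n .{{_ : ℕ.NonZero n}} → (i / n) * (+ n / 1) ≡ i / 1
i/n*n≡i i n@(suc _) = toℚᵘ-injective (begin
  toℚᵘ ((i / n) * (+ n / 1))          ≈⟨ toℚᵘ-homo-* (i / n) (+ n / 1) ⟩
  toℚᵘ (i / n) ℚᵘ.* toℚᵘ (+ n / 1)    ≈⟨ ℚᵘₚ.*-cong (toℚᵘ-/ i n) (toℚᵘ-/ (+ n) 1) ⟩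
  (i ℚᵘ./ n) ℚᵘ.* (+ n ℚᵘ./ 1)        ≈⟨ ℚᵘ.*≡* (trans (ℤₚ.*-identityʳ (i ℤ.* + n)) (cong (i ℤ.*_) (cong +_ (sym (ℕₚ.*-identityʳ n))))) ⟩
  i ℚᵘ./ 1                            ≈⟨ toℚᵘ-/ i 1 ⟨
  toℚᵘ (i / 1)                        ∎)
  where open ℚᵘₚ.≃-Reasoning

q*↧q≡↥q : ∀ q → q * (↧ q / 1) ≡ ↥ q / 1
q*↧q≡↥q q = trans (cong (_* (↧ q / 1)) (sym (↥p/↧p≡p q))) (i/n*n≡i (↥ q) (↧ₙ q))

fraction⇒cross : ∀ q {x y} → q * (y / 1) ≡ x / 1 → ↥ q ℤ.* y ≡ x ℤ.* ↧ q
fraction⇒cross q {x} {y} eq = /1-injective (begin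
  (↥ q ℤ.* y) / 1              ≡⟨ /1-* (↥ q) y ⟩
  (↥ q / 1) * (y / 1)          ≡⟨ cong (_* (y / 1)) (q*↧q≡↥q q) ⟨
  (q * (↧ q / 1)) * (y / 1)    ≡⟨ solve 3 (λ q d y → (q :* d) :* y := (q :* y) :* d) refl q (↧ q / 1) (y / 1) ⟩
  (q * (y / 1)) * (↧ q / 1)    ≡⟨ cong (_* (↧ q / 1)) eq ⟩
  (x / 1) * (↧ q / 1)          ≡⟨ /1-* x (↧ q) ⟨
  (x ℤ.* ↧ q) / 1              ∎)
  where open ≡-Reasoning

^-≢0 : ∀ {q} → q ≢ 0ℚ → ∀ n → q ^ n ≢ 0ℚ
^-≢0 q≢0 zero    = λ ()
^-≢0 q≢0 (suc n) = *-≢0 _ _ q≢0 (^-≢0 q≢0 n)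

≢0⇒↥≢0 : ∀ {q} → q ≢ 0ℚ → ↥ q ≢ + 0
≢0⇒↥≢0 {q} q≢0 eq = q≢0 (↥p≡0⇒p≡0 q eq)

≢0⇒∣↥∣≢0 : ∀ {q} → q ≢ 0ℚ → ℤ.∣ ↥ q ∣ ≢ 0
≢0⇒∣↥∣≢0 {q} q≢0 eq = ≢0⇒↥≢0 q≢0 (ℤₚ.∣i∣≡0⇒i≡0 eq)

module _ {p} (pr : Prime p) where

  ordℤ-* : ∀ {i k} → i ≢ + 0 → k ≢ + 0 → ordℤ p (i ℤ.* k) ≡ ordℤ p i ℕ.+ ordℤ p k
  ordℤ-* {i} {k} i≢0 k≢0 = trans (cong (ordℕ p) (ℤₚ.abs-* i k))
    (ordℕ-* pr (i≢0 ∘ ℤₚ.∣i∣≡0⇒i≡0) (k≢0 ∘ ℤₚ.∣i∣≡0⇒i≡0))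

  -- `ord` is defined through lowest terms, but `x` and `y` may have common factors.
  -- Cross-multiplication gives an equation between integers, where valuations add.
  ord-fraction : ∀ {q x y} → x ≢ + 0 → y ≢ + 0 → q * (y / 1) ≡ x / 1 →
                 ord p q ≡ + ordℤ p x ℤ.- + ordℤ p y
  ord-fraction {q} {x} {y} x≢0 y≢0 eq = difference (ordℤ p (↥ q)) (ordℤ p (↧ q)) (ordℤ p x) (ordℤ p y) (trans
    (sym (ordℤ-* (≢0⇒↥≢0 q≢0) y≢0))
    (trans (cong (ordℤ p) (fraction⇒cross q {x} {y} eq)) (ordℤ-* {x} {↧ q} x≢0 (λ ()))))
    where
    q≢0 : q ≢ 0ℚ
    q≢0 refl = x≢0 (/1-injective (trans (sym eq) (*-zeroˡ (y / 1))))
    difference : ∀ k l m n → k ℕ.+ n ≡ m ℕ.+ l → + k ℤ.- + l ≡ + m ℤ.- + n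
    difference k l m n e = begin
      + k ℤ.- + l                     ≡⟨ ℤsolve 3 (λ k l n → k ⊖ l ⊜ (k ⊕ n) ⊖ (l ⊕ n)) refl (+ k) (+ l) (+ n) ⟩
      + (k ℕ.+ n) ℤ.- (+ l ℤ.+ + n)   ≡⟨ cong (λ z → + z ℤ.- (+ l ℤ.+ + n)) e ⟩
      + (m ℕ.+ l) ℤ.- (+ l ℤ.+ + n)   ≡⟨ ℤsolve 3 (λ m l n → (m ⊕ l) ⊖ (l ⊕ n) ⊜ m ⊖ n) refl (+ m) (+ l) (+ n) ⟩
      + m ℤ.- + n                     ∎
      where
      open ≡-Reasoning

  ordℕ-1 : ordℕ p 1 ≡ 0
  ordℕ-1 = ordℕ-p^k pr 0

  ord-/1 : ∀ {i} → i ≢ + 0 → ord p (i / 1) ≡ + ordℤ p i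
  ord-/1 {i} i≢0 = trans (ord-fraction {i / 1} {i} {+ 1} i≢0 (λ ()) (*-identityʳ (i / 1)))
    (trans (cong (λ z → + ordℤ p i ℤ.- + z) ordℕ-1) (ℤₚ.+-identityʳ (+ ordℤ p i)))

  ord-* : ∀ {q r} → q ≢ 0ℚ → r ≢ 0ℚ → ord p (q * r) ≡ ord p q ℤ.+ ord p r
  ord-* {q} {r} q≢0 r≢0 = trans
    (ord-fraction {q * r} {↥ q ℤ.* ↥ r} {↧ q ℤ.* ↧ r}
      ([ ≢0⇒↥≢0 q≢0 , ≢0⇒↥≢0 r≢0 ]′ ∘ ℤₚ.i*j≡0⇒i≡0∨j≡0 (↥ q)) (λ ()) eq)
    (trans (cong₂ (λ k l → + k ℤ.- + l)
        (ordℤ-* (≢0⇒↥≢0 q≢0) (≢0⇒↥≢0 r≢0)) (ordℤ-* {↧ q} {↧ r} (λ ()) (λ ())))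
      (ℤsolve 4 (λ a b c d → (a ⊕ b) ⊖ (c ⊕ d) ⊜ (a ⊖ c) ⊕ (b ⊖ d)) refl
        (+ ordℤ p (↥ q)) (+ ordℤ p (↥ r)) (+ ordℤ p (↧ q)) (+ ordℤ p (↧ r))))
    where
    open ≡-Reasoning
    eq : (q * r) * ((↧ q ℤ.* ↧ r) / 1) ≡ (↥ q ℤ.* ↥ r) / 1
    eq = begin
      (q * r) * ((↧ q ℤ.* ↧ r) / 1)         ≡⟨ cong ((q * r) *_) (/1-* (↧ q) (↧ r)) ⟩
      (q * r) * ((↧ q / 1) * (↧ r / 1))     ≡⟨ solve 4 (λ q r c d → (q :* r) :* (c :* d) := (q :* c) :* (r :* d)) refl q r (↧ q / 1) (↧ r / 1) ⟩
      (q * (↧ q / 1)) * (r * (↧ r / 1))     ≡⟨ cong₂ _*_ (q*↧q≡↥q q) (q*↧q≡↥q r) ⟩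
      (↥ q / 1) * (↥ r / 1)                 ≡⟨ /1-* (↥ q) (↥ r) ⟨
      (↥ q ℤ.* ↥ r) / 1                     ∎

  ord-1 : ord p 1ℚ ≡ + 0
  ord-1 = trans (ord-/1 {+ 1} (λ ())) (cong +_ ordℕ-1)

  ord-^ : ∀ {q} → q ≢ 0ℚ → ∀ n → ord p (q ^ n) ≡ + n ℤ.* ord p q
  ord-^ q≢0 zero = ord-1
  ord-^ {q} q≢0 (suc n) = trans (ord-* q≢0 (^-≢0 q≢0 n))
    (trans (cong (λ z → ord p q ℤ.+ z) (ord-^ q≢0 n)) (sym (ℤₚ.suc-* (+ n) (ord p q))))

  ord-inverse : ∀ {q r} → q ≢ 0ℚ → r ≢ 0ℚ → q * r ≡ 1ℚ → ord p r ≡ ℤ.- ord p q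
  ord-inverse {q} {r} q≢0 r≢0 qr≡1 = sym (inverseʳ-unique (ord p q) (ord p r)
    (trans (sym (ord-* q≢0 r≢0)) (trans (cong (ord p) qr≡1) ord-1)))
    where
    inverseʳ-unique : ∀ i k → i ℤ.+ k ≡ + 0 → ℤ.- i ≡ k
    inverseʳ-unique i k eq = trans (sym (ℤₚ.+-identityʳ (ℤ.- i))) (trans (cong (λ z → ℤ.- i ℤ.+ z) (sym eq))
      (trans (sym (ℤₚ.+-assoc (ℤ.- i) i k)) (trans (cong (ℤ._+ k) (ℤₚ.+-inverseˡ i)) (ℤₚ.+-identityˡ k))))

-- Ceilings and the exponents of primes in `N a`

ceiling≡ : ∀ q → ceiling q ≡ ℤ.- ((ℤ.- ↥ q) ℤ./ℕ ↧ₙ q)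
ceiling≡ q = trans (unfold q) (cong ℤ.-_ (ℤ/.div-pos-is-/ℕ (ℤ.- ↥ q) (↧ₙ q)))
  where
  -- Negation on `ℚ` matches on the numerator, hence the three cases.
  unfold : ∀ q → ceiling q ≡ ℤ.- ((ℤ.- ↥ q) ℤ./ ↧ q)
  unfold (mkℚ -[1+ _ ] _ _) = refl
  unfold (mkℚ (+ zero) _ _) = refl
  unfold (mkℚ (+ suc _) _ _) = refl

ceiling-bounds : ∀ q → ↥ q ℤ.≤ ceiling q ℤ.* ↧ q × ceiling q ℤ.* ↧ q ℤ.< ↥ q ℤ.+ ↧ q
ceiling-bounds q = subst (λ c → ↥ q ℤ.≤ c ℤ.* ↧ q × c ℤ.* ↧ q ℤ.< ↥ q ℤ.+ ↧ q)
  (sym (ceiling≡ q)) (lower , upper)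
  where
  open ℤₚ.≤-Reasoning
  f : ℤ
  f = (ℤ.- ↥ q) ℤ./ℕ ↧ₙ q
  lower : ↥ q ℤ.≤ ℤ.- f ℤ.* ↧ q
  lower = begin
    ↥ q                ≡⟨ ℤₚ.neg-involutive (↥ q) ⟨
    ℤ.- (ℤ.- ↥ q)      ≤⟨ ℤₚ.neg-mono-≤ (ℤ/.[n/ℕd]*d≤n (ℤ.- ↥ q) (↧ₙ q)) ⟩
    ℤ.- (f ℤ.* ↧ q)    ≡⟨ ℤₚ.neg-distribˡ-* f (↧ q) ⟩
    ℤ.- f ℤ.* ↧ q      ∎
  upper : ℤ.- f ℤ.* ↧ q ℤ.< ↥ q ℤ.+ ↧ q
  upper = begin-strict
    ℤ.- f ℤ.* ↧ q                              ≡⟨ ℤsolve 2 (λ f d → (⊝ f) ⊗ d ⊜ (⊝ ((conℤ (+ 1) ⊕ f) ⊗ d)) ⊕ d) refl f (↧ q) ⟩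
    ℤ.- (ℤ.suc f ℤ.* ↧ q) ℤ.+ ↧ q              <⟨ ℤₚ.+-monoˡ-< (↧ q) (ℤₚ.neg-mono-< (ℤ/.n<s[n/ℕd]*d (ℤ.- ↥ q) (↧ₙ q))) ⟩
    ℤ.- (ℤ.- ↥ q) ℤ.+ ↧ q                      ≡⟨ cong (ℤ._+ ↧ q) (ℤₚ.neg-involutive (↥ q)) ⟩
    ↥ q ℤ.+ ↧ q                                ∎

-- `z / d` is reduced to lowest terms, so the bounds for its own numerator and denominator are
-- carried over to `z` and `d` by `cross`.
ceiling-/ : ∀ z d .{{_ : ℕ.NonZero d}} →
  z ℤ.≤ ceiling (z / d) ℤ.* + d × ceiling (z / d) ℤ.* + d ℤ.< z ℤ.+ + d
ceiling-/ z d = lower , upper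
  where
  q = z / d
  c = ceiling q
  cross : ↥ q ℤ.* + d ≡ z ℤ.* ↧ q
  cross = fraction⇒cross q {z} {+ d} (i/n*n≡i z d)
  instance
    d-pos : ℤ.Positive (+ d)
    d-pos = ℤ.positive (ℤ.+<+ (ℕ.>-nonZero⁻¹ d))
  lower : z ℤ.≤ c ℤ.* + d
  lower = ℤₚ.*-cancelʳ-≤-pos z (c ℤ.* + d) (↧ q) (begin
    z ℤ.* ↧ q            ≡⟨ cross ⟨
    ↥ q ℤ.* + d          ≤⟨ ℤₚ.*-monoʳ-≤-nonNeg (+ d) (proj₁ (ceiling-bounds q)) ⟩
    (c ℤ.* ↧ q) ℤ.* + d  ≡⟨ ℤsolve 3 (λ c e d → (c ⊗ e) ⊗ d ⊜ (c ⊗ d) ⊗ e) refl c (↧ q) (+ d) ⟩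
    (c ℤ.* + d) ℤ.* ↧ q  ∎)
    where open ℤₚ.≤-Reasoning
  upper : c ℤ.* + d ℤ.< z ℤ.+ + d
  upper = ℤₚ.*-cancelʳ-<-nonNeg (↧ q) (begin-strict
    (c ℤ.* + d) ℤ.* ↧ q            ≡⟨ ℤsolve 3 (λ c e d → (c ⊗ d) ⊗ e ⊜ (c ⊗ e) ⊗ d) refl c (↧ q) (+ d) ⟩
    (c ℤ.* ↧ q) ℤ.* + d            <⟨ ℤₚ.*-monoʳ-<-pos (+ d) (proj₂ (ceiling-bounds q)) ⟩
    (↥ q ℤ.+ ↧ q) ℤ.* + d          ≡⟨ ℤₚ.*-distribʳ-+ (+ d) (↥ q) (↧ q) ⟩
    ↥ q ℤ.* + d ℤ.+ ↧ q ℤ.* + d    ≡⟨ cong₂ ℤ._+_ cross (ℤₚ.*-comm (↧ q) (+ d)) ⟩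
    z ℤ.* ↧ q ℤ.+ + d ℤ.* ↧ q      ≡⟨ ℤₚ.*-distribʳ-+ (↧ q) z (+ d) ⟨
    (z ℤ.+ + d) ℤ.* ↧ q            ∎)
    where open ℤₚ.≤-Reasoning

αₚ-ord≥0 : ∀ p a n → ord p a ≡ + n → αₚ p a ≡ ceiling (+ n / 2)
αₚ-ord≥0 p a n eq rewrite eq = refl

αₚ-bounds : ∀ p a → let o = ord p a; k = αₚ p a in
  (+ 0 ℤ.≤ o × o ℤ.≤ k ℤ.* + 2 × k ℤ.* + 2 ℤ.< o ℤ.+ + 2) ⊎
  (o ℤ.< + 0 × o ℤ.≤ k ℤ.* + 3 × k ℤ.* + 3 ℤ.< o ℤ.+ + 3)
αₚ-bounds p a with ord p a in eq
... | + n      = inj₁ (ℤ.+≤+ z≤n , ceiling-/ (+ n) 2)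
... | -[1+ n ] = inj₂ (ℤ.-<+ , ceiling-/ -[1+ n ] 3)

<⇒≢0 : ∀ {q} → 0ℚ < q → q ≢ 0ℚ
<⇒≢0 0<q refl = <-irrefl refl 0<q

prime∤^ : ∀ {p q} → Prime p → Prime q → p ≢ q → ∀ k → ¬ p ℕ∣.∣ q ℕ.^ k
prime∤^ pr qr p≢q k p∣q^k with prime⇒irreducible qr (prime∣^⇒∣ pr k p∣q^k)
... | inj₁ p≡1 = ℕₚ.>⇒≢ (prime>1 pr) p≡1
... | inj₂ p≡q = p≢q p≡q

-- The function `f` treats both uses at once: the identity when `q` is `p`, and zero when `q` is
-- another prime.
ord-^ℤ : ∀ {p q} .{{_ : ℕ.NonZero q}} → Prime p → ∀ (f : ℕ → ℕ) → (∀ k → ordℕ p (q ℕ.^ k) ≡ f k) →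
  ∀ k → ord p (q ^ℤ k) ≡ ℤ.sign k ℤ.◃ f ℤ.∣ k ∣
ord-^ℤ {p} {q} pr f ordq (+ k) = trans (ord-/1 pr {+ (q ℕ.^ k)} (λ eq → ℕ.≢-nonZero⁻¹ (q ℕ.^ k) {{ℕₚ.m^n≢0 q k}} (ℤₚ.+-injective eq)))
  (trans (cong +_ (ordq k)) (sym (ℤₚ.+◃n≡+n (f k))))
ord-^ℤ {p} {q} pr f ordq -[1+ k ] = trans
  (ord-fraction pr {q ^ℤ -[1+ k ]} {+ 1} {+ (q ℕ.^ suc k)} (λ ())
    (λ eq → ℕ.≢-nonZero⁻¹ (q ℕ.^ suc k) {{nz}} (ℤₚ.+-injective eq)) (i/n*n≡i (+ 1) (q ℕ.^ suc k) {{nz}}))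
  (trans (cong₂ (λ i l → + i ℤ.- + l) (ordℕ-1 pr) (ordq (suc k)))
    (trans (ℤₚ.+-identityˡ _) (sym (ℤₚ.-◃n≡-n (f (suc k))))))
  where
  nz : ℕ.NonZero (q ℕ.^ suc k)
  nz = ℕₚ.m^n≢0 q (suc k)

ord-^ℤ-self : ∀ {p} .{{_ : ℕ.NonZero p}} → Prime p → ∀ k → ord p (p ^ℤ k) ≡ k
ord-^ℤ-self pr k = trans (ord-^ℤ pr (λ i → i) (ordℕ-p^k pr) k) (ℤₚ.signᵢ◃∣i∣≡i k)

ord-^ℤ-other : ∀ {p q} .{{_ : ℕ.NonZero q}} → Prime p → Prime q → p ≢ q → ∀ k → ord p (q ^ℤ k) ≡ + 0
ord-^ℤ-other {p} {q} pr qr p≢q k = ord-^ℤ pr (λ _ → 0)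
  (λ i → ordℕ-∤ pr (ℕ.≢-nonZero⁻¹ (q ℕ.^ i) {{ℕₚ.m^n≢0 q i}}) (prime∤^ pr qr p≢q i)) k

module _ {p} (pr : Prime p) (e : ℕ → ℤ) where

  private
    ord-primeProduct-suc : ∀ n → Prime (suc n) → ord p ((suc n ^ℤ e (suc n)) * primeProduct e n)
      ≡ ord p (suc n ^ℤ e (suc n)) ℤ.+ ord p (primeProduct e n)
    ord-primeProduct-suc n _ = ord-* pr (<⇒≢0 (^ℤ-positive (suc n) (e (suc n))))
      (<⇒≢0 (primeProduct-positive e n))

  ord-primeProduct-> : ∀ n → n ℕ.< p → ord p (primeProduct e n) ≡ + 0
  ord-primeProduct-> zero    _   = ord-1 pr
  ord-primeProduct-> (suc n) n<p with prime? (suc n)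
  ... | no  _  = ord-primeProduct-> n (ℕₚ.<-trans (ℕₚ.n<1+n n) n<p)
  ... | yes qr = trans (ord-primeProduct-suc n qr) (cong₂ ℤ._+_
    (ord-^ℤ-other pr qr (ℕₚ.>⇒≢ n<p) (e (suc n)))
    (ord-primeProduct-> n (ℕₚ.<-trans (ℕₚ.n<1+n n) n<p)))

  ord-primeProduct-≤ : ∀ n → p ℕ.≤ n → ord p (primeProduct e n) ≡ e p
  ord-primeProduct-≤ zero    p≤0 = contradiction (ℕₚ.<-≤-trans (prime>1 pr) p≤0) (λ ())
  ord-primeProduct-≤ (suc n) p≤n with prime? (suc n) | ℕₚ.m≤n⇒m<n∨m≡n p≤n
  ... | yes qr | inj₁ (s≤s p≤n′) = trans (ord-primeProduct-suc n qr) (trans (cong₂ ℤ._+_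
    (ord-^ℤ-other pr qr (ℕₚ.<⇒≢ (s≤s p≤n′)) (e (suc n)))
    (ord-primeProduct-≤ n p≤n′)) (ℤₚ.+-identityˡ (e p)))
  ... | no  _  | inj₁ (s≤s p≤n′) = ord-primeProduct-≤ n p≤n′
  ... | yes qr | inj₂ refl = trans (ord-primeProduct-suc n qr) (trans (cong₂ ℤ._+_
    (ord-^ℤ-self pr (e (suc n)))
    (ord-primeProduct-> n ℕₚ.≤-refl)) (ℤₚ.+-identityʳ (e p)))
  ... | no ¬pr | inj₂ refl = contradiction pr ¬pr

-- Beyond the cutoff of the product both sides vanish: `p` exceeds numerator and denominator of `a`,
-- so it divides neither and `ord p a` is 0.
ord-N : ∀ {p a} → Prime p → a ≢ 0ℚ → ord p (N a) ≡ αₚ p a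
ord-N {p} {a} pr a≢0 with p ℕ.≤? ℤ.∣ ↥ a ∣ ℕ.⊔ ↧ₙ a
... | yes p≤ = ord-primeProduct-≤ pr (λ q → αₚ q a) _ p≤
... | no  p≰ = trans (ord-primeProduct-> pr (λ q → αₚ q a) _ p>) (sym (αₚ-ord≥0 p a 0 ord≡0))
  where
  p> : ℤ.∣ ↥ a ∣ ℕ.⊔ ↧ₙ a ℕ.< p
  p> = ℕₚ.≰⇒> p≰
  small : ∀ {n} → n ≢ 0 → n ℕ.< p → ordℕ p n ≡ 0
  small n≢0 n<p = ordℕ-∤ pr n≢0 (ℕ∣.>⇒∤ {{ℕ.≢-nonZero n≢0}} n<p)
  ord≡0 : ord p a ≡ + 0
  ord≡0 = cong₂ (λ k l → + k ℤ.- + l)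
    (small (≢0⇒∣↥∣≢0 a≢0) (ℕₚ.≤-<-trans (ℕₚ.m≤m⊔n _ _) p>))
    (small {↧ₙ a} (λ ()) (ℕₚ.≤-<-trans (ℕₚ.m≤n⊔m _ (↧ₙ a)) p>))

-- Integrality from valuations

primeDivisor : ∀ n → n ≢ 1 → ∃[ p ] Prime p × p ℕ∣.∣ n
primeDivisor zero      _   = 2 , prime[2] , 2 ℕ∣.∣0
primeDivisor n@(suc _) n≢1 with factorise n
... | record { factors = []     ; isFactorisation = eq } = contradiction eq n≢1
... | record { factors = p ∷ ps ; isFactorisation = eq ; factorsPrime = pr ∷ _ } =
  p , pr , subst (p ℕ∣.∣_) (sym eq) (ℕ∣.m∣m*n _)

-- A prime in the denominator cannot divide the numerator as well, so it would make the valuation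
-- negative.
ord≥0⇒integral : ∀ q → q ≢ 0ℚ → (∀ p → Prime p → + 0 ℤ.≤ ord p q) → q ≡ ↥ q / 1
ord≥0⇒integral q q≢0 ord≥0 with ↧ₙ q ℕ.≟ 1
... | yes ↧≡1 = trans (sym (*-identityʳ q))
  (trans (cong (λ d → q * (+ d / 1)) (sym ↧≡1)) (q*↧q≡↥q q))
... | no  ↧≢1 with primeDivisor (↧ₙ q) ↧≢1
...   | p , pr , p∣↧ = contradiction (ord≥0 p pr) (ℤₚ.<⇒≱ ord<0)
  where
  p∤↥ : ¬ p ℕ∣.∣ ℤ.∣ ↥ q ∣
  p∤↥ p∣↥ = ℕₚ.>⇒≢ (prime>1 pr) (coprime q (p∣↥ , p∣↧))
    where
    -- The coprimality field of `mkℚ` is irrelevant and has to be recomputed before use.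
    coprime : ∀ q → Coprimality.Coprime ℤ.∣ ↥ q ∣ (↧ₙ q)
    coprime (mkℚ _ _ c) = Coprimality.recompute c
  ord<0 : ord p q ℤ.< + 0
  ord<0 = subst (ℤ._< + 0)
    (sym (trans (cong (λ k → + k ℤ.- + ordℕ p (↧ₙ q)) (ordℕ-∤ pr (≢0⇒∣↥∣≢0 q≢0) p∤↥)) (ℤₚ.+-identityˡ _)))
    (ℤₚ.neg-mono-< (ℤ.+<+ (ordℕ-max {k = 1} pr (λ ()) (subst (ℕ∣._∣ ↧ₙ q) (sym (ℕₚ.*-identityʳ p)) p∣↧))))

*-cancelˡ-≢0 : ∀ {r p q} → r ≢ 0ℚ → r * p ≡ r * q → p ≡ q
*-cancelˡ-≢0 {r} {p} {q} r≢0 eq = trans (sym (undo p)) (trans (cong ((1/ r) *_) eq) (undo q))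
  where
  instance
    r-nonZero : NonZero r
    r-nonZero = ≢-nonZero r≢0
  undo : ∀ s → (1/ r) * (r * s) ≡ s
  undo s = trans (sym (*-assoc (1/ r) r s)) (trans (cong (_* s) (*-inverseˡ r)) (*-identityˡ s))

inverse≢0 : ∀ {q r} → q * r ≡ 1ℚ → r ≢ 0ℚ
inverse≢0 {q} qr≡1 refl = case trans (sym qr≡1) (*-zeroʳ q) of λ ()

integral-^ : ∀ {q i} → q ≡ i / 1 → ∀ k m → q * (m / 1) ^ k ≡ (i ℤ.* m ℤ.^ k) / 1
integral-^ {q} {i} q≡i k m = trans (cong₂ _*_ q≡i (sym (/1-^ m k))) (sym (/1-* i (m ℤ.^ k)))

ordℤ-^ : ∀ {p m} → Prime p → m ≢ + 0 → ∀ k → ordℤ p (m ℤ.^ k) ≡ k ℕ.* ordℤ p m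
ordℤ-^ {p} pr m≢0 zero    = ordℕ-1 pr
ordℤ-^ {p} {m} pr m≢0 (suc k) = trans (ordℤ-* pr m≢0 (λ eq → m≢0 (ℤₚ.i^n≡0⇒i≡0 m k eq)))
  (cong (ordℤ p m ℕ.+_) (ordℤ-^ pr m≢0 k))

-- The scale N a makes N a² / a and N a³ / a integral, and it is minimal for this property.
module Scale {a b : ℚ} (a≢0 : a ≢ 0ℚ) (ab≡1 : a * b ≡ 1ℚ) where

  b≢0 : b ≢ 0ℚ
  b≢0 = inverse≢0 {a} ab≡1

  N≢0 : N a ≢ 0ℚ
  N≢0 = <⇒≢0 (N-positive a)

  Aq Bq : ℚ
  Aq = N a ^ 2 * b
  Bq = N a ^ 3 * b

  Aq≢0 : Aq ≢ 0ℚ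
  Aq≢0 = *-≢0 (N a ^ 2) b (^-≢0 N≢0 2) b≢0

  Bq≢0 : Bq ≢ 0ℚ
  Bq≢0 = *-≢0 (N a ^ 3) b (^-≢0 N≢0 3) b≢0

  ord-N^k*b : ∀ {p} → Prime p → ∀ k → ord p (N a ^ k * b) ≡ αₚ p a ℤ.* + k ℤ.- ord p a
  ord-N^k*b {p} pr k = trans (ord-* pr (^-≢0 N≢0 k) b≢0) (cong₂ ℤ._+_
    (trans (ord-^ pr N≢0 k) (trans (cong (+ k ℤ.*_) (ord-N pr a≢0)) (ℤₚ.*-comm (+ k) (αₚ p a))))
    (ord-inverse pr a≢0 b≢0 ab≡1))

  -- The definition of `αₚ` picks the stronger of the two inequalities: `ord p a ≥ 0` forces
  -- `αₚ p a ≥ 0`, where doubling gives less than tripling, and `ord p a < 0` forces `αₚ p a ≤ 0`,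
  -- where the order is reversed.
  α≥ : ∀ p → ord p a ℤ.≤ αₚ p a ℤ.* + 2 × ord p a ℤ.≤ αₚ p a ℤ.* + 3
  α≥ p with αₚ-bounds p a
  ... | inj₁ (0≤o , o≤2k , _) = o≤2k , ℤₚ.≤-trans o≤2k 2k≤3k
    where
    k = αₚ p a
    0≤k : + 0 ℤ.≤ k
    0≤k = ℤₚ.*-cancelʳ-≤-pos (+ 0) k (+ 2) (ℤₚ.≤-trans 0≤o o≤2k)
    2k≤3k : k ℤ.* + 2 ℤ.≤ k ℤ.* + 3
    2k≤3k = ℤₚ.*-monoˡ-≤-nonNeg k {{ℤ.nonNegative 0≤k}} (ℤ.+≤+ (s≤s (s≤s z≤n)))
  ... | inj₂ (o<0 , o≤3k , 3k<o+3) = ℤₚ.≤-trans o≤3k 3k≤2k , o≤3k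
    where
    k = αₚ p a
    k≤0 : k ℤ.≤ + 0
    k≤0 = ℤₚ.≮⇒≥ λ 0<k → ℤₚ.<-irrefl refl (ℤₚ.<-≤-trans
      (ℤₚ.<-≤-trans 3k<o+3 (ℤₚ.+-monoˡ-≤ (+ 3) (ℤₚ.<⇒≤ o<0)))
      (ℤₚ.*-monoʳ-≤-nonNeg (+ 3) (ℤₚ.i<j⇒suc[i]≤j 0<k)))
    3k≤2k : k ℤ.* + 3 ℤ.≤ k ℤ.* + 2
    3k≤2k = ℤₚ.*-monoˡ-≤-nonPos k {{ℤ.nonPositive k≤0}} (ℤ.+≤+ (s≤s (s≤s z≤n)))

  -- With d = 2 or 3 as in the case at hand and k = `αₚ p a`, an integer t < k would give (t + 1) d
  -- ≤ k d < `ord p a` + d ≤ t d + d.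
  α-minimal : ∀ p t → ord p a ℤ.≤ t ℤ.* + 2 → ord p a ℤ.≤ t ℤ.* + 3 → αₚ p a ℤ.≤ t
  α-minimal p t o≤2t o≤3t with αₚ-bounds p a
  ... | inj₁ (_ , _ , 2k<o+2) = ℤₚ.≮⇒≥ λ t<k → ℤₚ.<-irrefl refl (ℤₚ.<-≤-trans
    (ℤₚ.<-≤-trans 2k<o+2 (ℤₚ.+-monoˡ-≤ (+ 2) o≤2t))
    (ℤₚ.≤-trans (ℤₚ.≤-reflexive (ℤsolve 1 (λ t → t ⊗ conℤ (+ 2) ⊕ conℤ (+ 2) ⊜ (conℤ (+ 1) ⊕ t) ⊗ conℤ (+ 2)) refl t))
      (ℤₚ.*-monoʳ-≤-nonNeg (+ 2) (ℤₚ.i<j⇒suc[i]≤j t<k))))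
  ... | inj₂ (_ , _ , 3k<o+3) = ℤₚ.≮⇒≥ λ t<k → ℤₚ.<-irrefl refl (ℤₚ.<-≤-trans
    (ℤₚ.<-≤-trans 3k<o+3 (ℤₚ.+-monoˡ-≤ (+ 3) o≤3t))
    (ℤₚ.≤-trans (ℤₚ.≤-reflexive (ℤsolve 1 (λ t → t ⊗ conℤ (+ 3) ⊕ conℤ (+ 3) ⊜ (conℤ (+ 1) ⊕ t) ⊗ conℤ (+ 3)) refl t))
      (ℤₚ.*-monoʳ-≤-nonNeg (+ 3) (ℤₚ.i<j⇒suc[i]≤j t<k))))

  A₁ B₁ : ℤ
  A₁ = ↥ Aq
  B₁ = ↥ Bq

  Aq-integral : Aq ≡ A₁ / 1
  Aq-integral = ord≥0⇒integral Aq Aq≢0 λ p pr →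
    subst (+ 0 ℤ.≤_) (sym (ord-N^k*b pr 2)) (ℤₚ.i≤j⇒0≤j-i (proj₁ (α≥ p)))

  Bq-integral : Bq ≡ B₁ / 1
  Bq-integral = ord≥0⇒integral Bq Bq≢0 λ p pr →
    subst (+ 0 ℤ.≤_) (sym (ord-N^k*b pr 3)) (ℤₚ.i≤j⇒0≤j-i (proj₂ (α≥ p)))

  A₁≢0 : A₁ ≢ + 0
  A₁≢0 = ≢0⇒↥≢0 Aq≢0

  B₁≢0 : B₁ ≢ + 0
  B₁≢0 = ≢0⇒↥≢0 Bq≢0

  private
    gap≤ : ∀ {x y d} → y ℤ.< x ℤ.+ + suc d → y ℤ.- x ℤ.≤ + d
    gap≤ {x} {y} {d} y<x+d = ℤₚ.≮⇒≥ λ d<y-x → ℤₚ.<-irrefl refl (ℤₚ.<-≤-trans y<x+d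
      (subst (x ℤ.+ + suc d ℤ.≤_) (ℤsolve 2 (λ x y → x ⊕ (y ⊖ x) ⊜ y) refl x y)
        (ℤₚ.+-monoʳ-≤ x (ℤₚ.i<j⇒suc[i]≤j d<y-x))))

    ord↥ : ∀ {p q i} → Prime p → i ≢ + 0 → q ≡ i / 1 → ∀ {k d} → ord p q ≡ k → k ℤ.≤ + d → ordℤ p i ℕ.≤ d
    ord↥ {p} pr i≢0 q≡i ord≡k k≤d = ℤₚ.drop‿+≤+ (subst (ℤ._≤ _)
      (trans (sym ord≡k) (trans (cong (ord p) q≡i) (ord-/1 pr i≢0))) k≤d)

  -- The valuation of `A₁` is `αₚ p a * 2 - ord p a`, the rounding excess of a ceiling with divisor
  -- 2, hence less than 2. In `ordB₁≤2` the divisor is 3. These excesses are the constants 1 and 2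
  -- in the valuation bounds of the theorem.
  ordA₁≤1 : ∀ {p} → Prime p → + 0 ℤ.≤ ord p a → ordℤ p A₁ ℕ.≤ 1
  ordA₁≤1 {p} pr 0≤o with αₚ-bounds p a
  ... | inj₁ (_ , _ , 2k<o+2) = ord↥ pr A₁≢0 Aq-integral (ord-N^k*b pr 2) (gap≤ {ord p a} 2k<o+2)
  ... | inj₂ (o<0 , _ , _)    = contradiction 0≤o (ℤₚ.<⇒≱ o<0)

  ordB₁≤2 : ∀ {p} → Prime p → ord p a ℤ.< + 0 → ordℤ p B₁ ℕ.≤ 2
  ordB₁≤2 {p} pr o<0 with αₚ-bounds p a
  ... | inj₁ (0≤o , _ , _)    = contradiction 0≤o (ℤₚ.<⇒≱ o<0)
  ... | inj₂ (_ , _ , 3k<o+3) = ord↥ pr B₁≢0 Bq-integral (ord-N^k*b pr 3) (gap≤ {ord p a} 3k<o+3)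

  -- t = B / A has t² = a A and t³ = a B, so minimality of the scale makes t / N a integral.
  ratio-integral : ∀ {t x y} → t ≢ 0ℚ → x ≢ + 0 → y ≢ + 0 →
    t ^ 2 ≡ a * (x / 1) → t ^ 3 ≡ a * (y / 1) → ∃[ m ] t ≡ N a * (m / 1)
  ratio-integral {t} {x} {y} t≢0 x≢0 y≢0 t²≡ t³≡ = ↥ s , trans t≡Ns (cong (N a *_) s-integral)
    where
    instance
      N-nonZero : NonZero (N a)
      N-nonZero = ≢-nonZero N≢0
    s : ℚ
    s = t * 1/ N a
    t≡Ns : t ≡ N a * s
    t≡Ns = sym (trans (solve 3 (λ n t r → n :* (t :* r) := t :* (n :* r)) refl (N a) t (1/ N a))
      (trans (cong (t *_) (*-inverseʳ (N a))) (*-identityʳ t)))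
    s≢0 : s ≢ 0ℚ
    s≢0 s≡0 = t≢0 (trans t≡Ns (trans (cong (N a *_) s≡0) (*-zeroʳ (N a))))
    -- Integrality of `i` enters as `ord p i ≥ 0`: dropping this term leaves the inequality that
    -- `α-minimal` asks for.
    ord-t^ : ∀ {p k i} → Prime p → i ≢ + 0 → t ^ k ≡ a * (i / 1) → ord p a ℤ.≤ ord p t ℤ.* + k
    ord-t^ {p} {k} {i} pr i≢0 eq = begin
      ord p a                        ≤⟨ ℤₚ.i≤i+j (ord p a) (+ ordℤ p i) ⟩
      ord p a ℤ.+ + ordℤ p i         ≡⟨ cong (λ z → ord p a ℤ.+ z) (ord-/1 pr i≢0) ⟨
      ord p a ℤ.+ ord p (i / 1)      ≡⟨ ord-* pr a≢0 (/1-≢0 i≢0) ⟨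
      ord p (a * (i / 1))            ≡⟨ cong (ord p) eq ⟨
      ord p (t ^ k)                  ≡⟨ ord-^ pr t≢0 k ⟩
      + k ℤ.* ord p t                ≡⟨ ℤₚ.*-comm (+ k) (ord p t) ⟩
      ord p t ℤ.* + k                ∎
      where open ℤₚ.≤-Reasoning
    s-integral : s ≡ ↥ s / 1
    s-integral = ord≥0⇒integral s s≢0 λ p pr →
      subst (+ 0 ℤ.≤_) (ord-t-α pr) (ℤₚ.i≤j⇒0≤j-i (α-minimal p (ord p t)
        (ord-t^ {k = 2} pr x≢0 t²≡) (ord-t^ {k = 3} pr y≢0 t³≡)))
      where
      ord-t-α : ∀ {p} → Prime p → ord p t ℤ.- αₚ p a ≡ ord p s
      ord-t-α {p} pr = begin
        ord p t ℤ.- αₚ p a                      ≡⟨ cong (λ z → ord p z ℤ.- αₚ p a) t≡Ns ⟩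
        ord p (N a * s) ℤ.- αₚ p a              ≡⟨ cong (ℤ._- αₚ p a) (ord-* pr N≢0 s≢0) ⟩
        ord p (N a) ℤ.+ ord p s ℤ.- αₚ p a      ≡⟨ cong (λ z → z ℤ.+ ord p s ℤ.- αₚ p a) (ord-N pr a≢0) ⟩
        αₚ p a ℤ.+ ord p s ℤ.- αₚ p a           ≡⟨ ℤsolve 2 (λ k o → (k ⊕ o) ⊖ k ⊜ o) refl (αₚ p a) (ord p s) ⟩
        ord p s                                 ∎
        where open ≡-Reasoning

-- Absolute values, powers and square-freeness

∣^∣ : ∀ q n → ∣ q ^ n ∣ ≡ ∣ q ∣ ^ n
∣^∣ q zero    = refl
∣^∣ q (suc n) = trans (∣p*q∣≡∣p∣*∣q∣ q (q ^ n)) (cong (∣ q ∣ *_) (∣^∣ q n))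

∣p∣^2≡p^2 : ∀ p → ∣ p ∣ ^ 2 ≡ p ^ 2
∣p∣^2≡p^2 p with ∣p∣≡p∨∣p∣≡-p p
... | inj₁ eq = cong (_^ 2) eq
... | inj₂ eq = trans (cong (_^ 2) eq) (solve 1 (λ p → (:- p) :^ 2 := p :^ 2) refl p)

pos-^ : ∀ n k → + (n ℕ.^ k) ≡ (+ n) ℤ.^ k
pos-^ n zero    = refl
pos-^ n (suc k) = trans (ℤₚ.pos-* n (n ℕ.^ k)) (cong (+ n ℤ.*_) (pos-^ n k))

abs-^ : ∀ i k → ℤ.∣ i ℤ.^ k ∣ ≡ ℤ.∣ i ∣ ℕ.^ k
abs-^ i zero    = refl
abs-^ i (suc k) = trans (ℤₚ.abs-* i (i ℤ.^ k)) (cong (ℤ.∣ i ∣ ℕ.*_) (abs-^ i k))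

ℤ^-≢0 : ∀ {i} → i ≢ + 0 → ∀ k → i ℤ.^ k ≢ + 0
ℤ^-≢0 {i} i≢0 k eq = i≢0 (ℤₚ.i^n≡0⇒i≡0 i k eq)

^-mono-∣ : ∀ {m n} k → m ℕ∣.∣ n → m ℕ.^ k ℕ∣.∣ n ℕ.^ k
^-mono-∣ zero    _   = ℕ∣.∣-refl
^-mono-∣ (suc k) m∣n = ℕ∣.*-pres-∣ m∣n (^-mono-∣ k m∣n)

0≤⊎<0 : ∀ i → + 0 ℤ.≤ i ⊎ i ℤ.< + 0
0≤⊎<0 (+ _)    = inj₁ (ℤ.+≤+ z≤n)
0≤⊎<0 -[1+ _ ] = inj₂ ℤ.-<+

squareFree : ∀ {m} → (∀ p → Prime p → ¬ p ℕ.* p ℕ∣.∣ ℤ.∣ m ∣) → SquareFree m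
squareFree h d d²∣m with d ℕ.≟ 1
... | yes d≡1 = d≡1
... | no  d≢1 with primeDivisor d d≢1
...   | p , pr , p∣d = contradiction (ℕ∣.∣-trans (ℕ∣.*-pres-∣ p∣d p∣d) d²∣m) (h p pr)

power-of-product : ∀ x y k l → (x ^ k * y ^ k) ^ l ≡ (x * y) ^ (k ℕ.* l)
power-of-product x y k l = trans (cong (_^ l) (sym (^-distrib-* x y k))) (^-assocʳ (x * y) k l)

cube-scale : ∀ i ν k g → (+ ℤ.∣ i ∣ / 1) * g ≡ ν ^ 2 * k ^ 2 →
  (+ (ℤ.∣ i ∣ ℕ.^ 3) / 1) * g ^ 3 ≡ (ν * k) ^ 6
cube-scale i ν k g eq = begin
  (+ (ℤ.∣ i ∣ ℕ.^ 3) / 1) * g ^ 3   ≡⟨ cong (_* g ^ 3) (trans (cong (_/ 1) (pos-^ ℤ.∣ i ∣ 3)) (/1-^ (+ ℤ.∣ i ∣) 3)) ⟩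
  (+ ℤ.∣ i ∣ / 1) ^ 3 * g ^ 3       ≡⟨ ^-distrib-* (+ ℤ.∣ i ∣ / 1) g 3 ⟨
  ((+ ℤ.∣ i ∣ / 1) * g) ^ 3         ≡⟨ cong (_^ 3) eq ⟩
  (ν ^ 2 * k ^ 2) ^ 3               ≡⟨ power-of-product ν k 2 3 ⟩
  (ν * k) ^ 6                       ∎
  where open ≡-Reasoning

square-scale : ∀ i ν k g → (+ ℤ.∣ i ∣ / 1) * g ≡ ν ^ 3 * k ^ 3 →
  ((i ℤ.^ 2) / 1) * g ^ 2 ≡ (ν * k) ^ 6
square-scale i ν k g eq = begin
  ((i ℤ.^ 2) / 1) * g ^ 2           ≡⟨ cong (_* g ^ 2) (trans (/1-^ i 2) (trans (sym (∣p∣^2≡p^2 (i / 1))) (cong (_^ 2) (∣/1∣ i)))) ⟩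
  (+ ℤ.∣ i ∣ / 1) ^ 2 * g ^ 2       ≡⟨ ^-distrib-* (+ ℤ.∣ i ∣ / 1) g 2 ⟨
  ((+ ℤ.∣ i ∣ / 1) * g) ^ 2         ≡⟨ cong (_^ 2) eq ⟩
  (ν ^ 3 * k ^ 3) ^ 2               ≡⟨ power-of-product ν k 3 2 ⟩
  (ν * k) ^ 6                       ∎
  where open ≡-Reasoning

ℰⱼ⇔ : ∀ j E → ℰⱼ j E ⇔
  (Ẽⱼ j E × ¬ (∃[ p ] Prime p × (+ (p ℕ.^ 4)) ℤ∣.∣ proj₁ E × (+ (p ℕ.^ 6)) ℤ∣.∣ proj₂ E))
ℰⱼ⇔ j E = mk⇔
  (λ ((E∈Ẽ , minimal) , j≡) → (E∈Ẽ , j≡) , minimal)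
  (λ ((E∈Ẽ , j≡) , minimal) → (E∈Ẽ , minimal) , j≡)

ℤ*-≢0 : ∀ {i k} → i ≢ + 0 → k ≢ + 0 → i ℤ.* k ≢ + 0
ℤ*-≢0 {i} i≢0 k≢0 = [ i≢0 , k≢0 ]′ ∘ ℤₚ.i*j≡0⇒i≡0∨j≡0 i

-- Real numbers

*-cancelʳ-≤-0< : ∀ {r p q} → 0ℚ < r → p * r ≤ q * r → p ≤ q
*-cancelʳ-≤-0< {r} 0<r = *-cancelʳ-≤-pos r {{positive 0<r}}

*-mono-≤-0≤ : ∀ {p q r s} → 0ℚ ≤ p → 0ℚ ≤ s → p ≤ q → r ≤ s → p * r ≤ q * s
*-mono-≤-0≤ 0≤p 0≤s p≤q r≤s = ≤-trans (*-monoˡ-≤-0≤ 0≤p r≤s) (*-monoʳ-≤-0≤ 0≤s p≤q)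

^-cancel-≤ : ∀ n .{{_ : ℕ.NonZero n}} {p q} → 0ℚ ≤ q → p ^ n ≤ q ^ n → p ≤ q
^-cancel-≤ n 0≤q pⁿ≤qⁿ = ≮⇒≥ λ q<p → <-irrefl refl (<-≤-trans (^-mono-< n 0≤q q<p) pⁿ≤qⁿ)

divide : ∀ {p q} → 0ℚ < p → 0ℚ < q → ∃[ r ] 0ℚ < r × q * r ≡ p
divide {p} {q} 0<p 0<q = case recip 0<q of λ where
  (s , 0<s , qs≡1) → p * s , 0<* 0<p 0<s ,
    trans (solve 3 (λ p q s → q :* (p :* s) := p :* (q :* s)) refl p q s) (trans (cong (p *_) qs≡1) (*-identityʳ p))

1<⇒0< : ∀ {p} → 1ℚ < p → 0ℚ < p
1<⇒0< = <-trans 0<1ℚ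

1<quotient : ∀ {p q r} → 0ℚ < q → q < p → q * r ≡ p → 1ℚ < r
1<quotient {p} {q} {r} 0<q q<p qr≡p = *-cancelʳ-<-0< 0<q
  (subst₂ _<_ (sym (*-identityˡ q)) (trans (sym qr≡p) (*-comm q r)) q<p)

-- A rational substitute for the `n`-th root of `c`. Write `c = d * e` with both factors above 1;
-- one factor `r` of the power is paid by `d` and the other `n` by `e`, so the minimum of the two
-- candidates works.
root-above-1 : ∀ n {c} → 1ℚ < c → ∃[ r ] 1ℚ < r × r ^ n ≤ c
root-above-1 zero    {c} 1<c = c , 1<c , <⇒≤ 1<c
root-above-1 (suc n) {c} 1<c =
  case <-dense 1<c of λ where
    (d , 1<d , d<c) → case divide (1<⇒0< 1<c) (1<⇒0< 1<d) of λ where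
      (e , 0<e , de≡c) → case root-above-1 n (1<quotient (1<⇒0< 1<d) d<c de≡c) of λ where
        (r , 1<r , rⁿ≤e) → let 0≤m = <⇒≤ (1<⇒0< (<-⊓ 1<r 1<d)) in
          r ⊓ d , <-⊓ 1<r 1<d , subst ((r ⊓ d) * (r ⊓ d) ^ n ≤_) de≡c
            (*-mono-≤-0≤ 0≤m (<⇒≤ 0<e) (p⊓q≤q r d) (≤-trans (^-mono-≤ n 0≤m (p⊓q≤p r d)) rⁿ≤e))

below-≤0 : ∀ x {q} → 0ᴿ <ᴿ x → q ≤ 0ℚ → Below x q
below-≤0 x 0<x q≤0 = case positiveBelow x 0<x of λ where
  (t , 0<t , bt) → downward-≤ x (≤-trans q≤0 (<⇒≤ 0<t)) bt

⊔-below : ∀ x {p q} → Below x p → Below x q → Below x (p ⊔ q)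
⊔-below x {p} {q} bp bq = [ (λ p≤q → subst (Below x) (sym (p≤q⇒p⊔q≡q p≤q)) bq)
                          , (λ q≤p → subst (Below x) (sym (p≥q⇒p⊔q≡p q≤p)) bp) ]′ (≤-total p q)

-- The lower ends `a` and `c` of the rectangle may be negative. Joining them with positive lower
-- points stays inside both brackets, and every point of the rectangle has product above `q`.
*ᴿ-below⁻ : ∀ x y {q} → 0ᴿ <ᴿ x → 0ᴿ <ᴿ y → Below (x *ᴿ y) q →
  ∃[ s ] ∃[ t ] (0ℚ < s × Below x s) × (0ℚ < t × Below y t) × q < s * t
*ᴿ-below⁻ x y 0<x 0<y (a , b , c , d , (ba , ¬bb) , (bc , ¬bd) , corners) =
  case positiveBelow x 0<x of λ where
    (s , 0<s , bs) → case positiveBelow y 0<y of λ where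
      (t , 0<t , bt) → s ⊔ a , t ⊔ c
        , (<-≤-trans 0<s (p≤p⊔q s a) , ⊔-below x bs ba)
        , (<-≤-trans 0<t (p≤p⊔q t c) , ⊔-below y bt bc)
        , corners⇒below (p≤q⊔p s a) (<⇒≤ (below<above x (⊔-below x bs ba) ¬bb))
                        (p≤q⊔p t c) (<⇒≤ (below<above y (⊔-below y bt bc) ¬bd)) corners

*ᴿ-below : ∀ x y {s t} → 0ℚ < s → Below x s → 0ℚ < t → Below y t → Below (x *ᴿ y) (s * t)
*ᴿ-below x y {s} {t} 0<s bs 0<t bt =
  -- The corners must exceed `s * t` strictly; raising the lower end of the first bracket to `s′`
  -- achieves this for all four.
  case ℝ.rounded x bs of λ where
    (s′ , s<s′ , bs′) → case ℝ.bounded x of λ where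
      (b , ¬bb) → case ℝ.bounded y of λ where
        (d , ¬bd) →
          let 0<s′ = <-trans 0<s s<s′
              s′≤b = <⇒≤ (below<above x bs′ ¬bb)
              t≤d  = <⇒≤ (below<above y bt ¬bd)
              s′t  = *-monoʳ-<-0< 0<t s<s′
          in s′ , b , t , d , (bs′ , ¬bb) , (bt , ¬bd)
             , s′t
             , <-≤-trans s′t (*-monoˡ-≤-0≤ (<⇒≤ 0<s′) t≤d)
             , <-≤-trans s′t (*-monoʳ-≤-0≤ (<⇒≤ 0<t) s′≤b)
             , <-≤-trans s′t (*-mono-≤-0≤ (<⇒≤ 0<s′) (≤-trans (<⇒≤ 0<t) t≤d) s′≤b t≤d)

root-below⁻ : ∀ n .{{_ : ℕ.NonZero n}} x {q} → 0ℚ ≤ q → Below (root n x) q → Below x (q ^ n)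
root-below⁻ n x 0≤q (inj₁ q<0)                 = ⊥-elim (<-irrefl refl (<-≤-trans q<0 0≤q))
root-below⁻ n x 0≤q (inj₂ (r , _ , q<r , br)) = downward-≤ x (^-mono-≤ n 0≤q (<⇒≤ q<r)) br

-- A point below the root needs a strictly larger witness. Roundedness leaves room between `q ^ n`
-- and some `u`, and `root-above-1` turns that room into a factor `r` with `(q * r) ^ n ≤ u`.
root-below : ∀ n .{{_ : ℕ.NonZero n}} x {q} → 0ℚ < q → Below x (q ^ n) → Below (root n x) q
root-below n x {q} 0<q bqⁿ =
  case ℝ.rounded x bqⁿ of λ where
    (u , qⁿ<u , bu) → case divide (<-trans 0<qⁿ qⁿ<u) 0<qⁿ of λ where
      (c , _ , qⁿc≡u) → case root-above-1 n (1<quotient 0<qⁿ qⁿ<u qⁿc≡u) of λ where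
        (r , 1<r , rⁿ≤c) → inj₂ (q * r , <⇒≤ (0<* 0<q (1<⇒0< 1<r))
          , subst (_< q * r) (*-identityʳ q) (*-monoˡ-<-0< 0<q 1<r)
          , downward-≤ x (subst₂ _≤_ (sym (^-distrib-* q r n)) qⁿc≡u (*-monoˡ-≤-0≤ (<⇒≤ 0<qⁿ) rⁿ≤c)) bu)
  where
  0<qⁿ : 0ℚ < q ^ n
  0<qⁿ = ^-0< n 0<q

-- Multiplicative form of `narrow`: the width `(r - 1ℚ) * t`, with `t` a positive point below `x`,
-- is at most `(r - 1ℚ) * s` for the lower end `s = a ⊔ t`.
narrow-* : ∀ x {r} → 0ᴿ <ᴿ x → 1ℚ < r → ∃[ s ] 0ℚ < s × Below x s × ¬ Below x (r * s)
narrow-* x {r} 0<x 1<r =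
  case positiveBelow x 0<x of λ where
    (t , 0<t , bt) → case narrow x (0<* (0<q-p 1<r) 0<t) of λ where
      (a , ba , ¬ba+δ) → a ⊔ t , <-≤-trans 0<t (p≤q⊔p a t) , ⊔-below x ba bt , λ b → ¬ba+δ (downward-≤ x
        (subst (a + (r - 1ℚ) * t ≤_)
          (solve 2 (λ s r → s :+ (r :- con 1ℚ) :* s := r :* s) refl (a ⊔ t) r)
          (+-mono-≤ (p≤p⊔q a t) (*-monoˡ-≤-0≤ (<⇒≤ (0<q-p 1<r)) (p≤q⊔p a t)))) b)

⊓ᴿ-positive : ∀ x y → 0ᴿ <ᴿ x → 0ᴿ <ᴿ y → 0ᴿ <ᴿ x ⊓ᴿ y
⊓ᴿ-positive x y 0<x 0<y = 0ℚ , <-irrefl refl , below-≤0 x 0<x ≤-refl , below-≤0 y 0<y ≤-refl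

inv-positive : ∀ x (0<x : 0ᴿ <ᴿ x) → 0ᴿ <ᴿ inv x 0<x
inv-positive x 0<x =
  case positiveBelow x 0<x of λ where
    (t , 0<t , bt) → case ℝ.bounded x of λ where
      (u , ¬bu) → 0ℚ , <-irrefl refl , u , <-trans 0<t (below<above x bt ¬bu) , ¬bu
        , subst (_< 1ℚ) (sym (*-zeroˡ u)) 0<1ℚ

÷ᴿ-positive : ∀ x y → 0ᴿ <ᴿ x → (0<y : 0ᴿ <ᴿ y) → 0ᴿ <ᴿ x ÷ᴿ y ⟨ 0<y ⟩
÷ᴿ-positive x y 0<x 0<y = *ᴿ-positive x (inv y 0<y) 0<x (inv-positive y 0<y)

⊓ᴿ-*ᴿ-below⁻ : ∀ x y z {q} → 0ᴿ <ᴿ x → 0ᴿ <ᴿ y → 0ᴿ <ᴿ z →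
  Below ((x ⊓ᴿ y) *ᴿ z) q → Below (x *ᴿ z) q × Below (y *ᴿ z) q
⊓ᴿ-*ᴿ-below⁻ x y z 0<x 0<y 0<z b =
  case *ᴿ-below⁻ (x ⊓ᴿ y) z (⊓ᴿ-positive x y 0<x 0<y) 0<z b of λ where
    (s , t , (0<s , bx , by) , (0<t , bz) , q<st) →
      ℝ.downward (x *ᴿ z) q<st (*ᴿ-below x z 0<s bx 0<t bz) ,
      ℝ.downward (y *ᴿ z) q<st (*ᴿ-below y z 0<s by 0<t bz)

-- Of the two first factors the smaller lies below both `x` and `y`; it is kept together with its
-- own partner below `z`.
⊓ᴿ-*ᴿ-below : ∀ x y z {q} → 0ᴿ <ᴿ x → 0ᴿ <ᴿ y → 0ᴿ <ᴿ z →
  Below (x *ᴿ z) q → Below (y *ᴿ z) q → Below ((x ⊓ᴿ y) *ᴿ z) q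
⊓ᴿ-*ᴿ-below x y z {q} 0<x 0<y 0<z b b′ =
  case *ᴿ-below⁻ x z 0<x 0<z b of λ where
    (s , t , (0<s , bs) , (0<t , bt) , q<st) → case *ᴿ-below⁻ y z 0<y 0<z b′ of λ where
      (s′ , t′ , (0<s′ , bs′) , (0<t′ , bt′) , q<s′t′) →
        [ (λ s≤s′ → conclude 0<s bs (downward-≤ y s≤s′ bs′) 0<t bt q<st)
        , (λ s′≤s → conclude 0<s′ (downward-≤ x s′≤s bs) bs′ 0<t′ bt′ q<s′t′) ]′ (≤-total s s′)
  where
  conclude : ∀ {s t} → 0ℚ < s → Below x s → Below y s → 0ℚ < t → Below z t → q < s * t → Below ((x ⊓ᴿ y) *ᴿ z) q
  conclude 0<s bx by 0<t bt q<st = ℝ.downward ((x ⊓ᴿ y) *ᴿ z) q<st (*ᴿ-below (x ⊓ᴿ y) z 0<s (bx , by) 0<t bt)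

-- The two height conditions are the cases (n, e, v) = (2, 3, |A|³) and (3, 2, B²),
-- with g = |a|, ν = N a and k = |m|.
module HeightBound (α X : ℝ) (0<α : 0ᴿ <ᴿ α) (0<X : 0ᴿ <ᴿ X) {g ν k v : ℚ}
  (0<g : 0ℚ < g) (0<ν : 0ℚ < ν) (0<k : 0ℚ < k) (0<v : 0ℚ < v)
  (n e : ℕ) .{{_ : ℕ.NonZero n}} (n*e≡6 : n ℕ.* e ≡ 6) (v*gᵉ : v * g ^ e ≡ (ν * k) ^ 6)
  (0<w : 0ᴿ <ᴿ ι ν *ᴿ root 6 α)
  where

  private
    x y z w u : ℝ
    x = root n (ι g)
    y = root 6 α
    z = root 6 X
    w = ι ν *ᴿ y
    u = x ÷ᴿ w ⟨ 0<w ⟩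

    0<x : 0ᴿ <ᴿ x
    0<x = root-positive n (ι g) (ι-positive 0<g)
    0<y : 0ᴿ <ᴿ y
    0<y = root-positive 6 α 0<α
    0<z : 0ᴿ <ᴿ z
    0<z = root-positive 6 X 0<X
    0<u : 0ᴿ <ᴿ u
    0<u = *ᴿ-positive x (inv w 0<w) 0<x (inv-positive w 0<w)

    0<gᵉ : 0ℚ < g ^ e
    0<gᵉ = ^-0< e 0<g

    ^n^e : ∀ s → (s ^ n) ^ e ≡ s ^ 6
    ^n^e s = trans (^-assocʳ s n e) (cong (s ^_) n*e≡6)

    below-w : ∀ {q r} → 0ℚ < q → 0ℚ < r → Below y r → q < ν * r → Below w q
    below-w {q} {r} 0<q 0<r br q<νr = case divide 0<q 0<r of λ where
      (s , 0<s , rs≡q) → let sr≡q = trans (*-comm s r) rs≡q in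
        subst (Below w) sr≡q (*ᴿ-below (ι ν) y 0<s
          (*-cancelʳ-<-0< 0<r (subst (_< ν * r) (sym sr≡q) q<νr)) 0<r br)

    -- Otherwise `r = q / ν` has sixth power at most `s` and lies below `y`. By roundedness so does
    -- some `r′ > r`, and `q < ν * r′` would put `q` below `w`.
    above-w : ∀ {q s} → 0ℚ < q → ¬ Below w q → 0ℚ < s → Below α s → ν ^ 6 * s ≤ q ^ 6
    above-w {q} {s} 0<q ¬bq 0<s bs = case divide 0<q 0<ν of λ where
      (r , 0<r , νr≡q) → ≮⇒≥ λ q⁶<ν⁶s → case ℝ.rounded y (root-below 6 α 0<r (downward-≤ α
          (*-cancelˡ-≤-pos (ν ^ 6) {{positive (^-0< 6 0<ν)}}
            (<⇒≤ (subst (_< ν ^ 6 * s) (trans (cong (_^ 6) (sym νr≡q)) (^-distrib-* ν r 6)) q⁶<ν⁶s))) bs)) of λ where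
        (r′ , r<r′ , br′) → ¬bq (below-w 0<q (<-trans 0<r r<r′) br′
          (subst (_< ν * r′) νr≡q (*-monoˡ-<-0< 0<ν r<r′)))

    ¬below-w : ∀ {q} → 0ℚ < q → ¬ Below y q → ¬ Below w (ν * q)
    ¬below-w {q} 0<q ¬bq bνq = case *ᴿ-below⁻ (ι ν) y (ι-positive 0<ν) 0<y bνq of λ where
      (a , b , (0<a , a<ν) , (0<b , bb) , νq<ab) → <-irrefl refl (<-≤-trans νq<ab
        (*-mono-≤-0≤ (<⇒≤ 0<a) (<⇒≤ 0<q) (<⇒≤ a<ν) (<⇒≤ (below<above y bb ¬bq))))

    below-x : ∀ {s} → 0ℚ < s → Below x s → s ^ 6 ≤ g ^ e
    below-x {s} 0<s bs = subst (_≤ g ^ e) (^n^e s)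
      (^-mono-≤ e (^-0≤ n (<⇒≤ 0<s)) (<⇒≤ (root-below⁻ n (ι g) (<⇒≤ 0<s) bs)))

    above-x : ∀ {s} → 0ℚ < s → ¬ Below x s → g ^ e ≤ s ^ 6
    above-x {s} 0<s ¬bs = subst (g ^ e ≤_) (^n^e s)
      (^-mono-≤ e (<⇒≤ 0<g) (≮⇒≥ (¬bs ∘ root-below n (ι g) 0<s)))

    -- The rational core of `bound⇒height`. Here `s₁`, `s₂`, `s₃` lie below `x`, `1 / w`, `z`, and
    -- `d` is at least `w`. The hypothesis on `k` is only usable at a smaller `k′ = k / r`; the gap
    -- between `s` and `s′` pays for the lost `r ^ 6`.
    height-estimate : ∀ {s s′ c r k′ d s₁ s₂ s₃} →
      0ℚ < s → 0ℚ < s′ → 0ℚ < k′ → 0ℚ < d → 0ℚ < s₂ → 0ℚ < s₃ →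
      s * c ≡ s′ → r ^ 6 ≤ c → r * k′ ≡ k → k′ ≤ s₁ * s₂ * s₃ →
      s₁ ^ 6 ≤ g ^ e → ν ^ 6 * s′ ≤ d ^ 6 → s₂ * d < 1ℚ → s * v ≤ s₃ ^ 6
    height-estimate {s} {s′} {c} {r} {k′} {d} {s₁} {s₂} {s₃}
      0<s 0<s′ 0<k′ 0<d 0<s₂ 0<s₃ sc≡s′ r⁶≤c rk′≡k k′≤s₁s₂s₃ s₁⁶≤gᵉ ν⁶s′≤d⁶ s₂d<1 = *-cancelʳ-≤-0< 0<gᵉ (begin
      s * v * g ^ e                                  ≡⟨ trans (*-assoc s v (g ^ e)) (cong (s *_) v*gᵉ) ⟩
      s * (ν * k) ^ 6                                ≡⟨ cong (s *_) (trans (^-distrib-* ν k 6) (cong (ν ^ 6 *_) (trans (cong (_^ 6) (sym rk′≡k)) (^-distrib-* r k′ 6)))) ⟩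
      s * (ν ^ 6 * (r ^ 6 * k′ ^ 6))                 ≡⟨ solve 4 (λ s a b c → s :* (a :* (b :* c)) := (a :* c) :* (s :* b)) refl s (ν ^ 6) (r ^ 6) (k′ ^ 6) ⟩
      (ν ^ 6 * k′ ^ 6) * (s * r ^ 6)                 ≤⟨ *-monoˡ-≤-0≤ (0≤* (^-0≤ 6 (<⇒≤ 0<ν)) (^-0≤ 6 (<⇒≤ 0<k′))) (*-monoˡ-≤-0≤ (<⇒≤ 0<s) r⁶≤c) ⟩
      (ν ^ 6 * k′ ^ 6) * (s * c)                     ≡⟨ trans (cong ((ν ^ 6 * k′ ^ 6) *_) sc≡s′) (solve 3 (λ a b c → (a :* b) :* c := (a :* c) :* b) refl (ν ^ 6) (k′ ^ 6) s′) ⟩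
      (ν ^ 6 * s′) * k′ ^ 6                          ≤⟨ *-mono-≤-0≤ (0≤* (^-0≤ 6 (<⇒≤ 0<ν)) (<⇒≤ 0<s′)) (^-0≤ 6 (≤-trans (<⇒≤ 0<k′) k′≤s₁s₂s₃)) ν⁶s′≤d⁶ (^-mono-≤ 6 (<⇒≤ 0<k′) k′≤s₁s₂s₃) ⟩
      d ^ 6 * (s₁ * s₂ * s₃) ^ 6                     ≡⟨ cong (d ^ 6 *_) (trans (^-distrib-* (s₁ * s₂) s₃ 6) (cong (_* s₃ ^ 6) (^-distrib-* s₁ s₂ 6))) ⟩
      d ^ 6 * (s₁ ^ 6 * s₂ ^ 6 * s₃ ^ 6)             ≡⟨ solve 4 (λ a b c d → a :* (b :* c :* d) := (c :* a) :* (d :* b)) refl (d ^ 6) (s₁ ^ 6) (s₂ ^ 6) (s₃ ^ 6) ⟩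
      (s₂ ^ 6 * d ^ 6) * (s₃ ^ 6 * s₁ ^ 6)           ≡⟨ cong (_* (s₃ ^ 6 * s₁ ^ 6)) (^-distrib-* s₂ d 6) ⟨
      (s₂ * d) ^ 6 * (s₃ ^ 6 * s₁ ^ 6)               ≤⟨ *-mono-≤-0≤ (^-0≤ 6 (<⇒≤ (0<* 0<s₂ 0<d))) (0≤* (^-0≤ 6 (<⇒≤ 0<s₃)) (<⇒≤ 0<gᵉ)) (^≤1 6 (<⇒≤ (0<* 0<s₂ 0<d)) (<⇒≤ s₂d<1)) (*-monoˡ-≤-0≤ (^-0≤ 6 (<⇒≤ 0<s₃)) s₁⁶≤gᵉ) ⟩
      1ℚ * (s₃ ^ 6 * g ^ e)                          ≡⟨ *-identityˡ _ ⟩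
      s₃ ^ 6 * g ^ e                                 ∎)
      where open ≤-Reasoning

    -- The rational core of `height⇒bound`. The exponent 5 counts the losses: one `r` each for
    -- approximating `x`, `y` and `z`, one for the strict inequality that defines `inv`, and one for
    -- using `α *ᴿ ι v ≤ᴿ X` only below `v`. The gap between `q` and `k` pays for all five.
    bound-estimate : ∀ {q c r t s₁ s₂ s₃} →
      0ℚ < q → 0ℚ < r → 0ℚ < t → 0ℚ < s₁ → 0ℚ < s₂ → 0ℚ < s₃ →
      q * c ≡ k → r ^ 5 ≤ c → r * (ν * (r * t)) * s₂ ≡ 1ℚ →
      t ^ 6 * v ≤ r ^ 6 * (r * s₃) ^ 6 → g ^ e ≤ (r * s₁) ^ 6 → q ≤ s₁ * s₂ * s₃
    bound-estimate {q} {c} {r} {t} {s₁} {s₂} {s₃} 0<q 0<r 0<t 0<s₁ 0<s₂ 0<s₃ qc≡k r⁵≤c s₂-inverse t⁶v≤ gᵉ≤ =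
      *-cancelʳ-≤-0< (^-0< 5 0<r) (begin
      q  * r ^ 5                                   ≤⟨ *-monoˡ-≤-0≤ (<⇒≤ 0<q) r⁵≤c ⟩
      q  * c                                       ≡⟨ qc≡k ⟩
      k                                            ≡⟨ trans (cong (k *_) s₂-inverse) (*-identityʳ k) ⟨
      k * (r * (ν * (r * t)) * s₂)                 ≡⟨ solve 5 (λ k r n t s → k :* (r :* (n :* (r :* t)) :* s) := (t :* (n :* k)) :* (r :* r :* s)) refl k r ν t s₂ ⟩
      t * (ν * k) * (r * r * s₂)                   ≤⟨ *-monoʳ-≤-0≤ (<⇒≤ (0<* (0<* 0<r 0<r) 0<s₂)) tνk≤ ⟩
      r * (r * s₃) * (r * s₁) * (r * r * s₂)       ≡⟨ solve 4 (λ r a b c → r :* (r :* c) :* (r :* a) :* (r :* r :* b) := a :* b :* c :* r :^ 5) refl r s₁ s₂ s₃ ⟩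
      s₁ * s₂ * s₃ * r ^ 5                         ∎)
      where
      open ≤-Reasoning
      tνk≤ : t * (ν * k) ≤ r * (r * s₃) * (r * s₁)
      tνk≤ = ^-cancel-≤ 6 (<⇒≤ (0<* (0<* 0<r (0<* 0<r 0<s₃)) (0<* 0<r 0<s₁))) (begin
        (t * (ν * k)) ^ 6                          ≡⟨ ^-distrib-* t (ν * k) 6 ⟩
        t ^ 6 * (ν * k) ^ 6                        ≡⟨ trans (cong (t ^ 6 *_) (sym v*gᵉ)) (sym (*-assoc (t ^ 6) v (g ^ e))) ⟩
        t ^ 6 * v * g ^ e                          ≤⟨ *-mono-≤-0≤ (<⇒≤ (0<* (^-0< 6 0<t) 0<v)) (^-0≤ 6 (<⇒≤ (0<* 0<r 0<s₁))) t⁶v≤ gᵉ≤ ⟩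
        r ^ 6 * (r * s₃) ^ 6 * (r * s₁) ^ 6        ≡⟨ trans (^-distrib-* (r * (r * s₃)) (r * s₁) 6) (cong (_* (r * s₁) ^ 6) (^-distrib-* r (r * s₃) 6)) ⟨
        (r * (r * s₃) * (r * s₁)) ^ 6              ∎)

  bound⇒height : ι k ≤ᴿ u *ᴿ z → α *ᴿ ι v ≤ᴿ X
  bound⇒height k≤uz q bq =
    case *ᴿ-below⁻ α (ι v) 0<α (ι-positive 0<v) bq of λ where
      (s , t , (0<s , bs) , (0<t , t<v) , q<st) → case ℝ.rounded α bs of λ where
        (s′ , s<s′ , bs′) → case divide (<-trans 0<s s<s′) 0<s of λ where
          (c , 0<c , sc≡s′) → case root-above-1 6 (1<quotient 0<s s<s′ sc≡s′) of λ where
            (r , 1<r , r⁶≤c) → case divide 0<k (1<⇒0< 1<r) of λ where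
              (k′ , 0<k′ , rk′≡k) → case *ᴿ-below⁻ u z 0<u 0<z (k≤uz k′
                  (subst₂ _<_ (*-identityˡ k′) rk′≡k (*-monoʳ-<-0< 0<k′ 1<r))) of λ where
                (s₁₂ , s₃ , (0<s₁₂ , bs₁₂) , (0<s₃ , bs₃) , k′<s₁₂s₃) →
                  case *ᴿ-below⁻ x (inv w 0<w) 0<x (inv-positive w 0<w) bs₁₂ of λ where
                    (s₁ , s₂ , (0<s₁ , bs₁) , (0<s₂ , d , 0<d , ¬bd , s₂d<1) , s₁₂<s₁s₂) →
                      downward-≤ X
                        (≤-trans (<⇒≤ q<st) (≤-trans (*-monoˡ-≤-0≤ (<⇒≤ 0<s) (<⇒≤ t<v))
                          (height-estimate {r = r} {s₁ = s₁} {s₂} {s₃} 0<s (<-trans 0<s s<s′) 0<k′ 0<d 0<s₂ 0<s₃ sc≡s′ r⁶≤c rk′≡k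
                            (<⇒≤ (<-trans k′<s₁₂s₃ (*-monoʳ-<-0< 0<s₃ s₁₂<s₁s₂)))
                            (below-x 0<s₁ bs₁) (above-w 0<d ¬bd (<-trans 0<s s<s′) bs′) s₂d<1)))
                        (root-below⁻ 6 X (<⇒≤ 0<s₃) bs₃)

  height⇒bound : α *ᴿ ι v ≤ᴿ X → ι k ≤ᴿ u *ᴿ z
  height⇒bound αv≤X q q<k = case q <? 0ℚ of λ where
      (yes q<0) → below-≤0 (u *ᴿ z) (*ᴿ-positive u z 0<u 0<z) (<⇒≤ q<0)
      -- The quotient `k / q` is needed, and `q` may be 0, so a larger `q′` still below `k` takes
      -- its place.
      (no  q≮0) → case <-dense q<k of λ where
        (q′ , q<q′ , q′<k) → downward-≤ (u *ᴿ z) (<⇒≤ q<q′) (positive-case (≤-<-trans (≮⇒≥ q≮0) q<q′) q′<k)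
    where
    -- The height hypothesis applies at `v′ = v / r`, which is strictly below `v`. The lost `r` is
    -- enlarged to `r ^ 6` so that `bound-estimate` can take a sixth root of the whole right side.
    t⁶v≤ : ∀ {r t s₃} → 1ℚ < r → 0ℚ < t → 0ℚ < s₃ → Below y t → ¬ Below z (r * s₃) →
      t ^ 6 * v ≤ r ^ 6 * (r * s₃) ^ 6
    t⁶v≤ {r} {t} {s₃} 1<r 0<t 0<s₃ bt ¬brs₃ = case divide 0<v 0<r of λ where
        (v′ , 0<v′ , rv′≡v) → begin
          t ^ 6 * v                  ≡⟨ cong (t ^ 6 *_) rv′≡v ⟨
          t ^ 6 * (r * v′)           ≡⟨ solve 3 (λ t r v → t :* (r :* v) := r :* (t :* v)) refl (t ^ 6) r v′ ⟩
          r * (t ^ 6 * v′)           ≤⟨ *-mono-≤-0≤ (<⇒≤ 0<r) (^-0≤ 6 (<⇒≤ (0<* 0<r 0<s₃))) (p≤p^n 6 (<⇒≤ 1<r))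
                                          (<⇒≤ (below<above X (αv≤X _ (*ᴿ-below α (ι v) (^-0< 6 0<t)
                                            (root-below⁻ 6 α (<⇒≤ 0<t) bt) 0<v′
                                            (subst₂ _<_ (*-identityˡ v′) rv′≡v (*-monoʳ-<-0< 0<v′ 1<r))))
                                            (¬brs₃ ∘ root-below 6 X (0<* 0<r 0<s₃)))) ⟩
          r ^ 6 * (r * s₃) ^ 6       ∎
      where
      open ≤-Reasoning
      0<r : 0ℚ < r
      0<r = 1<⇒0< 1<r
    below-inv-w : ∀ {r t s₂} → 1ℚ < r → 0ℚ < t → 0ℚ < s₂ → ¬ Below y (r * t) →
      r * (ν * (r * t)) * s₂ ≡ 1ℚ → Below (inv w 0<w) s₂
    below-inv-w {r} {t} {s₂} 1<r 0<t 0<s₂ ¬brt eq = d , 0<d , ¬below-w (0<* (1<⇒0< 1<r) 0<t) ¬brt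
      , subst₂ _<_ (*-identityˡ (s₂ * d))
          (trans (solve 3 (λ r s d → r :* (s :* d) := (r :* d) :* s) refl r s₂ d) eq)
          (*-monoʳ-<-0< (0<* 0<s₂ 0<d) 1<r)
      where
      d : ℚ
      d = ν * (r * t)
      0<d : 0ℚ < d
      0<d = 0<* 0<ν (0<* (1<⇒0< 1<r) 0<t)
    positive-case : ∀ {q} → 0ℚ < q → q < k → Below (u *ᴿ z) q
    positive-case {q} 0<q q<k =
      case divide 0<k 0<q of λ where
        (c , 0<c , qc≡k) → case root-above-1 5 (1<quotient 0<q q<k qc≡k) of λ where
          (r , 1<r , r⁵≤c) → case narrow-* x 0<x 1<r of λ where
            (s₁ , 0<s₁ , bs₁ , ¬brs₁) → case narrow-* y 0<y 1<r of λ where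
              (t , 0<t , bt , ¬brt) → case narrow-* z 0<z 1<r of λ where
                (s₃ , 0<s₃ , bs₃ , ¬brs₃) →
                  let 0<r = 1<⇒0< 1<r in
                  case recip (0<* 0<r (0<* 0<ν (0<* 0<r 0<t))) of λ where
                    (s₂ , 0<s₂ , s₂-inverse) → downward-≤ (u *ᴿ z)
                      (bound-estimate {r = r} {t} {s₁} {s₂} {s₃} 0<q 0<r 0<t 0<s₁ 0<s₂ 0<s₃ qc≡k r⁵≤c s₂-inverse
                        (t⁶v≤ 1<r 0<t 0<s₃ bt ¬brs₃) (above-x (0<* 0<r 0<s₁) ¬brs₁))
                      (*ᴿ-below u z (0<* 0<s₁ 0<s₂)
                        (*ᴿ-below x (inv w 0<w) 0<s₁ bs₁ 0<s₂ (below-inv-w 1<r 0<t 0<s₂ ¬brt s₂-inverse))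
                        0<s₃ bs₃)

-- Floors of positive reals and the nonzero integers up to a bound

/1-mono-< : ∀ {i k} → i ℤ.< k → i / 1 < k / 1
/1-mono-< {i} {k} i<k = subst₂ _<_ (sym (/1≡mkℚ i)) (sym (/1≡mkℚ k))
  (*<* (subst₂ ℤ._<_ (sym (ℤₚ.*-identityʳ i)) (sym (ℤₚ.*-identityʳ k)) i<k))

positive-factor : ∀ {p q} → 0ℚ < q → 0ℚ < p * q → 0ℚ < p
positive-factor {p} {q} 0<q 0<pq = *-cancelʳ-<-0< 0<q (subst (_< p * q) (sym (*-zeroˡ q)) 0<pq)

∣∣-positive : ∀ {q} → q ≢ 0ℚ → 0ℚ < ∣ q ∣
∣∣-positive {q} q≢0 = ≰⇒> λ ∣q∣≤0 → q≢0 (∣p∣≡0⇒p≡0 q (≤-antisym ∣q∣≤0 (0≤∣p∣ q)))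

ι-mono-≤ : ∀ {p q} → p ≤ q → ι p ≤ᴿ ι q
ι-mono-≤ p≤q r r<p = <-≤-trans r<p p≤q

≤ᴿ-trans : ∀ x y z → x ≤ᴿ y → y ≤ᴿ z → x ≤ᴿ z
≤ᴿ-trans x y z x≤y y≤z q bq = y≤z q (x≤y q bq)

-- Locatedness makes the negation usable: with `q < p < r`, either `q` is below `x`, or `p` is not,
-- and then `p` witnesses `x <ᴿ ι r`.
≮ᴿ⇒≥ᴿ : ∀ x {r} → ¬ x <ᴿ ι r → ι r ≤ᴿ x
≮ᴿ⇒≥ᴿ x x≮r q q<r = case <-dense q<r of λ where
  (p , q<p , p<r) → [ (λ b → b) , (λ ¬b → ⊥-elim (x≮r (p , ¬b , p<r))) ]′ (ℝ.located x q<p)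

-- Descent from an integer above `x`. Given `x < suc M` and no floor, `x < M` is refuted one stage
-- lower, so `M ≤ x` and `M` is a floor after all. The double negation takes the place of a decision
-- of `x < M`.
floor-¬¬exists : ∀ x → 0ᴿ <ᴿ x → ¬ ¬ (∃[ n ] IsFloor x (+ n))
floor-¬¬exists x 0<x = case ℝ.bounded x of λ where
    (b , ¬bb) → case archimedean b of λ where
      (M , b≤M) → search (suc M) (b , ¬bb , ≤-<-trans b≤M (/1-mono-< (ℤ.+<+ (ℕₚ.n<1+n M))))
  where
  search : ∀ M → x <ᴿ ιℤ (+ M) → ¬ ¬ (∃[ n ] IsFloor x (+ n))
  search zero    (q , ¬bq , q<0) _ = ¬bq (below-≤0 x 0<x (<⇒≤ q<0))
  search (suc M) x<sM ¬floor = ¬floor (M , ≮ᴿ⇒≥ᴿ x (λ x<M → search M x<M ¬floor) , x<sM)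

floor-greatest : ∀ x {k n} → IsFloor x (+ n) → ιℤ (+ k) ≤ᴿ x → k ℕ.≤ n
floor-greatest x {k} {n} (_ , q , ¬bq , q<sn) k≤x = ℕₚ.≮⇒≥ λ n<k →
  ¬bq (k≤x q (<-≤-trans q<sn (/1-mono-≤ (ℤ.+≤+ n<k))))

nonZeroUpTo : ℕ → List ℤ
nonZeroUpTo zero    = []
nonZeroUpTo (suc n) = + suc n ∷ -[1+ n ] ∷ nonZeroUpTo n

length-nonZeroUpTo : ∀ n → length (nonZeroUpTo n) ≡ 2 ℕ.* n
length-nonZeroUpTo zero    = refl
length-nonZeroUpTo (suc n) = trans (cong (2 ℕ.+_) (length-nonZeroUpTo n)) (sym (ℕₚ.*-suc 2 n))

∈-nonZeroUpTo⁻ : ∀ n {m} → m ∈ nonZeroUpTo n → m ≢ + 0 × ℤ.∣ m ∣ ℕ.≤ n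
∈-nonZeroUpTo⁻ (suc n) (here refl)         = (λ ()) , ℕₚ.≤-refl
∈-nonZeroUpTo⁻ (suc n) (there (here refl)) = (λ ()) , ℕₚ.≤-refl
∈-nonZeroUpTo⁻ (suc n) (there (there m∈))  = case ∈-nonZeroUpTo⁻ n m∈ of λ where
  (m≢0 , m≤n) → m≢0 , ℕₚ.m≤n⇒m≤1+n m≤n

∈-nonZeroUpTo : ∀ n {m} → m ≢ + 0 → ℤ.∣ m ∣ ℕ.≤ n → m ∈ nonZeroUpTo n
∈-nonZeroUpTo zero    m≢0 m≤0 = contradiction (ℤₚ.∣i∣≡0⇒i≡0 (ℕₚ.n≤0⇒n≡0 m≤0)) m≢0
∈-nonZeroUpTo (suc n) {m} m≢0 m≤n with ℕₚ.m≤n⇒m<n∨m≡n m≤n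
... | inj₁ (s≤s m≤n′) = there (there (∈-nonZeroUpTo n m≢0 m≤n′))
∈-nonZeroUpTo (suc n) {+ _}       m≢0 m≤n | inj₂ refl = here refl
∈-nonZeroUpTo (suc n) { -[1+ _ ]} m≢0 m≤n | inj₂ refl = there (here refl)

nonZeroUpTo-unique : ∀ n → Unique (nonZeroUpTo n)
nonZeroUpTo-unique zero    = []
nonZeroUpTo-unique (suc n) = ((λ ()) ∷ new (+ suc n) refl) ∷ new -[1+ n ] refl ∷ nonZeroUpTo-unique n
  where
  new : ∀ m → ℤ.∣ m ∣ ≡ suc n → All (m ≢_) (nonZeroUpTo n)
  new m ∣m∣≡ = tabulate λ k∈ m≡k → ℕₚ.<-irrefl (trans (cong ℤ.∣_∣ (sym m≡k)) ∣m∣≡)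
    (s≤s (proj₂ (∈-nonZeroUpTo⁻ n k∈)))

-- Curves with a given j-invariant

module CurvesWithInvariant (j : ℚ) (j≢0 : j ≢ 0ℚ) (j≢1728 : j ≢ 1728ℚ) where

  open Parametrisation j j≢0 j≢1728 public

  c4 c27 : ℚ
  c4  = + 4 / 1
  c27 = + 27 / 1

  27j≢0 : c27 * j ≢ 0ℚ
  27j≢0 = *-≢0 c27 j (λ ()) j≢0

  a≢0 : a ≢ 0ℚ
  a≢0 = *-≢0 (c4 * (1728ℚ - j)) (1/ (c27 * j)) (*-≢0 c4 (1728ℚ - j) (λ ()) 1728-j≢0)
    (inverse≢0 {c27 * j} (*-inverseʳ (c27 * j)))

  open Scale {a} {1/ a} a≢0 (*-inverseʳ a) public

  a*27j : a * (c27 * j) ≡ c4 * (1728ℚ - j)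
  a*27j = trans (*-assoc (c4 * (1728ℚ - j)) (1/ (c27 * j)) (c27 * j))
    (trans (cong ((c4 * (1728ℚ - j)) *_) (*-inverseˡ (c27 * j))) (*-identityʳ (c4 * (1728ℚ - j))))

  discriminant/1 : ∀ x y → 4A³+27B² (x , y) / 1 ≡ c4 * (x / 1) ^ 3 + c27 * (y / 1) ^ 2
  discriminant/1 x y = trans (/1-+ (+ 4 ℤ.* x ℤ.^ 3) (+ 27 ℤ.* y ℤ.^ 2)) (cong₂ _+_
    (trans (/1-* (+ 4) (x ℤ.^ 3)) (cong (c4 *_) (/1-^ x 3)))
    (trans (/1-* (+ 27) (y ℤ.^ 2)) (cong (c27 *_) (/1-^ y 2))))

  Ẽ⇒discriminant≢0 : ∀ E → Ẽ E → 4A³+27B² E / 1 ≢ 0ℚ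
  Ẽ⇒discriminant≢0 E E∈Ẽ = /1-≢0 λ eq → E∈Ẽ (cong (ℤ.- (+ 16) ℤ.*_) eq)

  private
    -- Amounts to 27 j (B² - a A³) = j D - 1728 · 4 A³, so each of the two equations implies the
    -- other; this direction needs 27 j ≠ 0 to cancel.
    expand : ∀ x y → let d = c4 * x ^ 3 + c27 * y ^ 2 in
      (c27 * j) * y ^ 2 ≡ (j * d - 1728ℚ * (c4 * x ^ 3)) + (c27 * j) * (a * x ^ 3)
    expand x y = begin
      (c27 * j) * y ^ 2
        ≡⟨ solve 6 (λ f s k t X Y → (s :* t) :* Y :=
             (t :* (f :* X :+ s :* Y) :- k :* (f :* X)) :+ (f :* (k :- t)) :* X) refl c4 c27 1728ℚ j (x ^ 3) (y ^ 2) ⟩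
      (j * (c4 * x ^ 3 + c27 * y ^ 2) - 1728ℚ * (c4 * x ^ 3)) + (c4 * (1728ℚ - j)) * x ^ 3
        ≡⟨ cong (λ z → (j * (c4 * x ^ 3 + c27 * y ^ 2) - 1728ℚ * (c4 * x ^ 3)) + z * x ^ 3) (sym a*27j) ⟩
      (j * (c4 * x ^ 3 + c27 * y ^ 2) - 1728ℚ * (c4 * x ^ 3)) + (a * (c27 * j)) * x ^ 3
        ≡⟨ cong (_+_ (j * (c4 * x ^ 3 + c27 * y ^ 2) - 1728ℚ * (c4 * x ^ 3)))
             (solve 3 (λ a r X → (a :* r) :* X := r :* (a :* X)) refl a (c27 * j) (x ^ 3)) ⟩
      (j * (c4 * x ^ 3 + c27 * y ^ 2) - 1728ℚ * (c4 * x ^ 3)) + (c27 * j) * (a * x ^ 3)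
        ∎
      where open ≡-Reasoning

  -- With D = 4 A³ + 27 B², the equation j D = 1728 · 4 A³ is B² = a A³.
  j*D⇒B²≡aA³ : ∀ x y → j * (c4 * x ^ 3 + c27 * y ^ 2) ≡ 1728ℚ * (c4 * x ^ 3) → y ^ 2 ≡ a * x ^ 3
  j*D⇒B²≡aA³ x y eq = *-cancelˡ-≢0 27j≢0 (trans (expand x y)
    (trans (cong (λ z → (z - 1728ℚ * (c4 * x ^ 3)) + (c27 * j) * (a * x ^ 3)) eq)
      (solve 2 (λ u v → (u :- u) :+ v := v) refl (1728ℚ * (c4 * x ^ 3)) ((c27 * j) * (a * x ^ 3)))))

  B²≡aA³⇒j*D : ∀ x y → y ^ 2 ≡ a * x ^ 3 → j * (c4 * x ^ 3 + c27 * y ^ 2) ≡ 1728ℚ * (c4 * x ^ 3)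
  B²≡aA³⇒j*D x y eq = begin
    jD                                            ≡⟨ solve 3 (λ u v w → u := ((u :- v) :+ w) :- w :+ v) refl jD X ((c27 * j) * (a * x ^ 3)) ⟩
    ((jD - X) + (c27 * j) * (a * x ^ 3)) - (c27 * j) * (a * x ^ 3) + X
                                                  ≡⟨ cong (λ z → z - (c27 * j) * (a * x ^ 3) + X) (expand x y) ⟨
    (c27 * j) * y ^ 2 - (c27 * j) * (a * x ^ 3) + X ≡⟨ cong (λ z → (c27 * j) * z - (c27 * j) * (a * x ^ 3) + X) eq ⟩
    (c27 * j) * (a * x ^ 3) - (c27 * j) * (a * x ^ 3) + X
                                                  ≡⟨ solve 2 (λ u v → u :- u :+ v := v) refl ((c27 * j) * (a * x ^ 3)) X ⟩
    X                                             ∎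
    where
    open ≡-Reasoning
    jD = j * (c4 * x ^ 3 + c27 * y ^ 2)
    X = 1728ℚ * (c4 * x ^ 3)

  4A³/1 : ∀ x → (+ 4 ℤ.* x ℤ.^ 3) / 1 ≡ c4 * (x / 1) ^ 3
  4A³/1 x = trans (/1-* (+ 4) (x ℤ.^ 3)) (cong (c4 *_) (/1-^ x 3))

  j-invariant≡⇔ : ∀ x y (E∈Ẽ : Ẽ (x , y)) → let X = x / 1; Y = y / 1 in
    j-invariant (x , y) E∈Ẽ ≡ j ⇔ j * (c4 * X ^ 3 + c27 * Y ^ 2) ≡ 1728ℚ * (c4 * X ^ 3)
  j-invariant≡⇔ x y E∈Ẽ = mk⇔ to from
    where
    open ≡-Reasoning
    X = x / 1
    Y = y / 1
    D = 4A³+27B² (x , y) / 1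
    F = (+ 4 ℤ.* x ℤ.^ 3) / 1
    instance
      D-nonZero : NonZero D
      D-nonZero = Ẽ⇒nonZero (x , y) E∈Ẽ
    to : 1728ℚ * (F * 1/ D) ≡ j → j * (c4 * X ^ 3 + c27 * Y ^ 2) ≡ 1728ℚ * (c4 * X ^ 3)
    to eq = begin
      j * (c4 * X ^ 3 + c27 * Y ^ 2)  ≡⟨ cong (j *_) (discriminant/1 x y) ⟨
      j * D                           ≡⟨ cong (_* D) eq ⟨
      1728ℚ * (F * 1/ D) * D          ≡⟨ solve 4 (λ k f r d → k :* (f :* r) :* d := k :* f :* (r :* d)) refl 1728ℚ F (1/ D) D ⟩
      1728ℚ * F * (1/ D * D)          ≡⟨ cong (1728ℚ * F *_) (*-inverseˡ D) ⟩
      1728ℚ * F * 1ℚ                  ≡⟨ *-identityʳ (1728ℚ * F) ⟩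
      1728ℚ * F                       ≡⟨ cong (1728ℚ *_) (4A³/1 x) ⟩
      1728ℚ * (c4 * X ^ 3)            ∎
    from : j * (c4 * X ^ 3 + c27 * Y ^ 2) ≡ 1728ℚ * (c4 * X ^ 3) → 1728ℚ * (F * 1/ D) ≡ j
    from eq = begin
      1728ℚ * (F * 1/ D)              ≡⟨ *-assoc 1728ℚ F (1/ D) ⟨
      1728ℚ * F * 1/ D                ≡⟨ cong (λ z → 1728ℚ * z * 1/ D) (4A³/1 x) ⟩
      1728ℚ * (c4 * X ^ 3) * 1/ D     ≡⟨ cong (_* 1/ D) eq ⟨
      j * (c4 * X ^ 3 + c27 * Y ^ 2) * 1/ D ≡⟨ cong (λ z → j * z * 1/ D) (discriminant/1 x y) ⟨
      j * D * 1/ D                    ≡⟨ *-assoc j D (1/ D) ⟩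
      j * (D * 1/ D)                  ≡⟨ cong (j *_) (*-inverseʳ D) ⟩
      j * 1ℚ                          ≡⟨ *-identityʳ j ⟩
      j                               ∎

  Ẽⱼ⇒ : ∀ x y → Ẽⱼ j (x , y) → x ≢ + 0 × (y / 1) ^ 2 ≡ a * (x / 1) ^ 3
  Ẽⱼ⇒ x y (E∈Ẽ , j≡) = x≢0 , B²≡aA³
    where
    B²≡aA³ : (y / 1) ^ 2 ≡ a * (x / 1) ^ 3
    B²≡aA³ = j*D⇒B²≡aA³ (x / 1) (y / 1) (Equivalence.to (j-invariant≡⇔ x y E∈Ẽ) j≡)
    x≢0 : x ≢ + 0
    -- If A = 0, then B² = a A³ = 0 and the discriminant vanishes.
    x≢0 refl = Ẽ⇒discriminant≢0 (x , y) E∈Ẽ (trans (discriminant/1 x y)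
      (cong (λ z → c4 * 0ℚ ^ 3 + c27 * z) (trans B²≡aA³ (*-zeroʳ a))))

  ⇒Ẽⱼ : ∀ x y → x ≢ + 0 → (y / 1) ^ 2 ≡ a * (x / 1) ^ 3 → Ẽⱼ j (x , y)
  ⇒Ẽⱼ x y x≢0 eq = E∈Ẽ , Equivalence.from (j-invariant≡⇔ x y E∈Ẽ) jD
    where
    jD = B²≡aA³⇒j*D (x / 1) (y / 1) eq
    D≢0 : 4A³+27B² (x , y) ≢ + 0
    -- If D = 0, then 1728 · 4 A³ = j D = 0, against A ≠ 0.
    D≢0 D≡0 = *-≢0 1728ℚ (c4 * (x / 1) ^ 3) (λ ())
      (*-≢0 c4 ((x / 1) ^ 3) (λ ()) (^-≢0 (/1-≢0 x≢0) 3))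
      (trans (sym jD) (trans (cong (j *_) (trans (sym (discriminant/1 x y)) (cong (_/ 1) D≡0))) (*-zeroʳ j)))
    E∈Ẽ : Ẽ (x , y)
    E∈Ẽ = ℤ*-≢0 {ℤ.- (+ 16)} {4A³+27B² (x , y)} (λ ()) D≢0

  -- The parametrised curves

  A-formula≡ : ∀ m → A-formula m ≡ (A₁ ℤ.* m ℤ.^ 2) / 1
  A-formula≡ m = trans
    (solve 3 (λ n M b → n :* M :* b := n :* b :* M) refl (N a ^ 2) ((m / 1) ^ 2) (1/ a))
    (integral-^ {Aq} {A₁} Aq-integral 2 m)

  B-formula≡ : ∀ m → B-formula m ≡ (B₁ ℤ.* m ℤ.^ 3) / 1
  B-formula≡ m = trans
    (solve 3 (λ n M b → n :* M :* b := n :* b :* M) refl (N a ^ 3) ((m / 1) ^ 3) (1/ a))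
    (integral-^ {Bq} {B₁} Bq-integral 3 m)

  A≡ : ∀ m → A m ≡ A₁ ℤ.* m ℤ.^ 2
  A≡ m = trans (cong ↥_ (A-formula≡ m)) (↥-/1 _)

  B≡ : ∀ m → B m ≡ B₁ ℤ.* m ℤ.^ 3
  B≡ m = trans (cong ↥_ (B-formula≡ m)) (↥-/1 _)

  A-integral : ∀ m → A-formula m ≡ A m / 1
  A-integral m = trans (A-formula≡ m) (cong (_/ 1) (sym (A≡ m)))

  B-integral : ∀ m → B-formula m ≡ B m / 1
  B-integral m = trans (B-formula≡ m) (cong (_/ 1) (sym (B≡ m)))

  A≢0 : ∀ {m} → m ≢ + 0 → A m ≢ + 0
  A≢0 {m} m≢0 = subst (_≢ + 0) (sym (A≡ m)) (ℤ*-≢0 A₁≢0 (ℤ^-≢0 m≢0 2))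

  B≢0 : ∀ {m} → m ≢ + 0 → B m ≢ + 0
  B≢0 {m} m≢0 = subst (_≢ + 0) (sym (B≡ m)) (ℤ*-≢0 B₁≢0 (ℤ^-≢0 m≢0 3))

  -- For `m ≢ + 0` both `A m` and `N a` can be cancelled, so the curve determines `m`. This yields
  -- `E-injective`, and with it the exact count.
  B/A : ∀ m → B m / 1 ≡ (A m / 1) * (N a * (m / 1))
  B/A m = begin
    B m / 1                             ≡⟨ B-integral m ⟨
    B-formula m                         ≡⟨ solve 3 (λ n M b → n :^ 3 :* M :^ 3 :* b := (n :^ 2 :* M :^ 2 :* b) :* (n :* M)) refl (N a) (m / 1) (1/ a) ⟩
    A-formula m * (N a * (m / 1))       ≡⟨ cong (_* (N a * (m / 1))) (A-integral m) ⟩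
    (A m / 1) * (N a * (m / 1))         ∎
    where open ≡-Reasoning

  E-injective : ∀ {m n} → m ≢ + 0 → E m ≡ E n → m ≡ n
  E-injective {m} {n} m≢0 Em≡En = /1-injective (*-cancelˡ-≢0 N≢0 (*-cancelˡ-≢0 (/1-≢0 (A≢0 m≢0)) (begin
    (A m / 1) * (N a * (m / 1))  ≡⟨ B/A m ⟨
    B m / 1                      ≡⟨ cong (λ E → proj₂ E / 1) Em≡En ⟩
    B n / 1                      ≡⟨ B/A n ⟩
    (A n / 1) * (N a * (n / 1))  ≡⟨ cong (λ E → (proj₁ E / 1) * (N a * (n / 1))) Em≡En ⟨
    (A m / 1) * (N a * (n / 1))  ∎)))
    where open ≡-Reasoning

  E∈Ẽⱼ : ∀ m → m ≢ + 0 → Ẽⱼ j (E m)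
  E∈Ẽⱼ m m≢0 = ⇒Ẽⱼ (A m) (B m) (A≢0 m≢0) (begin
    (B m / 1) ^ 2
      ≡⟨ cong (_^ 2) (B-integral m) ⟨
    B-formula m ^ 2
      -- The solver treats `1/ a` as an atom. The split-off `1ℚ` becomes `a * 1/ a` in the next
      -- step, which turns `(1/ a) ^ 2` into `a * (1/ a) ^ 3`.
      ≡⟨ solve 3 (λ n M b → (n :^ 3 :* M :^ 3 :* b) :^ 2 := con 1ℚ :* (n :^ 6 :* M :^ 6 :* b :^ 2)) refl (N a) (m / 1) (1/ a) ⟩
    1ℚ * (N a ^ 6 * (m / 1) ^ 6 * (1/ a) ^ 2)
      ≡⟨ cong (_* (N a ^ 6 * (m / 1) ^ 6 * (1/ a) ^ 2)) (*-inverseʳ a) ⟨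
    (a * 1/ a) * (N a ^ 6 * (m / 1) ^ 6 * (1/ a) ^ 2)
      ≡⟨ solve 4 (λ n M b a → (a :* b) :* (n :^ 6 :* M :^ 6 :* b :^ 2) := a :* (n :^ 2 :* M :^ 2 :* b) :^ 3) refl (N a) (m / 1) (1/ a) a ⟩
    a * A-formula m ^ 3
      ≡⟨ cong (λ z → a * z ^ 3) (A-integral m) ⟩
    a * (A m / 1) ^ 3
      ∎)
    where open ≡-Reasoning

  B²≡aA³⇒E : ∀ x y → x ≢ + 0 → (y / 1) ^ 2 ≡ a * (x / 1) ^ 3 → ∃[ m ] m ≢ + 0 × (x , y) ≡ E m
  B²≡aA³⇒E x y x≢0 Y²≡aX³ = m , m≢0 , cong₂ _,_
      (/1-injective (trans X≡ (A-integral m))) (/1-injective (trans Y≡ (B-integral m)))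
    where
    open ≡-Reasoning
    X Y : ℚ
    X = x / 1
    Y = y / 1
    X≢0 : X ≢ 0ℚ
    X≢0 = /1-≢0 x≢0
    instance
      X-nonZero : NonZero X
      X-nonZero = ≢-nonZero X≢0
    Y²≢0 : Y ^ 2 ≢ 0ℚ
    Y²≢0 Y²≡0 = *-≢0 a (X ^ 3) a≢0 (^-≢0 X≢0 3) (trans (sym Y²≡aX³) Y²≡0)
    y≢0 : y ≢ + 0
    y≢0 y≡0 = Y²≢0 (cong (λ z → (z / 1) ^ 2) y≡0)
    t : ℚ
    t = Y * 1/ X
    Xt≡Y : X * t ≡ Y
    Xt≡Y = trans (solve 3 (λ x y r → x :* (y :* r) := y :* (x :* r)) refl X Y (1/ X))
      (trans (cong (Y *_) (*-inverseʳ X)) (*-identityʳ Y))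
    t≢0 : t ≢ 0ℚ
    t≢0 t≡0 = /1-≢0 y≢0 (trans (sym Xt≡Y) (trans (cong (X *_) t≡0) (*-zeroʳ X)))
    t²≡aX : t ^ 2 ≡ a * X
    t²≡aX = *-cancelˡ-≢0 (^-≢0 X≢0 2) (begin
      X ^ 2 * t ^ 2     ≡⟨ solve 2 (λ x t → x :^ 2 :* t :^ 2 := (x :* t) :^ 2) refl X t ⟩
      (X * t) ^ 2       ≡⟨ cong (_^ 2) Xt≡Y ⟩
      Y ^ 2             ≡⟨ Y²≡aX³ ⟩
      a * X ^ 3         ≡⟨ solve 2 (λ a x → a :* x :^ 3 := x :^ 2 :* (a :* x)) refl a X ⟩
      X ^ 2 * (a * X)   ∎)
    t³≡aY : t ^ 3 ≡ a * Y
    t³≡aY = begin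
      t * t ^ 2         ≡⟨ cong (t *_) t²≡aX ⟩
      t * (a * X)       ≡⟨ solve 3 (λ t a x → t :* (a :* x) := a :* (x :* t)) refl t a X ⟩
      a * (X * t)       ≡⟨ cong (a *_) Xt≡Y ⟩
      a * Y             ∎
    m : ℤ
    m = proj₁ (ratio-integral t≢0 x≢0 y≢0 t²≡aX t³≡aY)
    t≡Nm : t ≡ N a * (m / 1)
    t≡Nm = proj₂ (ratio-integral t≢0 x≢0 y≢0 t²≡aX t³≡aY)
    m≢0 : m ≢ + 0
    m≢0 m≡0 = t≢0 (trans t≡Nm (trans (cong (λ z → N a * (z / 1)) m≡0) (*-zeroʳ (N a))))
    cancel-a : ∀ q → q ≡ a * q * 1/ a
    cancel-a q = sym (trans (solve 3 (λ a q b → a :* q :* b := q :* (a :* b)) refl a q (1/ a))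
      (trans (cong (q *_) (*-inverseʳ a)) (*-identityʳ q)))
    X≡ : X ≡ A-formula m
    X≡ = begin
      X                               ≡⟨ cancel-a X ⟩
      a * X * 1/ a                    ≡⟨ cong (_* 1/ a) t²≡aX ⟨
      t ^ 2 * 1/ a                    ≡⟨ cong (λ z → z ^ 2 * 1/ a) t≡Nm ⟩
      (N a * (m / 1)) ^ 2 * 1/ a      ≡⟨ solve 3 (λ n M b → (n :* M) :^ 2 :* b := n :^ 2 :* M :^ 2 :* b) refl (N a) (m / 1) (1/ a) ⟩
      A-formula m                     ∎
    Y≡ : Y ≡ B-formula m
    Y≡ = begin
      Y                               ≡⟨ cancel-a Y ⟩
      a * Y * 1/ a                    ≡⟨ cong (_* 1/ a) t³≡aY ⟨
      t ^ 3 * 1/ a                    ≡⟨ cong (λ z → z ^ 3 * 1/ a) t≡Nm ⟩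
      (N a * (m / 1)) ^ 3 * 1/ a      ≡⟨ solve 3 (λ n M b → (n :* M) :^ 3 :* b := n :^ 3 :* M :^ 3 :* b) refl (N a) (m / 1) (1/ a) ⟩
      B-formula m                     ∎

  Ẽⱼ⇒E : ∀ x y → Ẽⱼ j (x , y) → ∃[ m ] m ≢ + 0 × (x , y) ≡ E m
  Ẽⱼ⇒E x y E∈ = B²≡aA³⇒E x y (proj₁ (Ẽⱼ⇒ x y E∈)) (proj₂ (Ẽⱼ⇒ x y E∈))

  -- Heights and valuations of the parametrised curves

  private
    absolute : ∀ {q i m k} → q ≡ i / 1 → q ≡ N a ^ k * (m / 1) ^ k * 1/ a →
      (+ ℤ.∣ i ∣ / 1) * ∣ a ∣ ≡ N a ^ k * (+ ℤ.∣ m ∣ / 1) ^ k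
    absolute {q} {i} {m} {k} q≡i q≡ = begin
      (+ ℤ.∣ i ∣ / 1) * ∣ a ∣                 ≡⟨ cong (_* ∣ a ∣) (∣/1∣ i) ⟨
      ∣ i / 1 ∣ * ∣ a ∣                       ≡⟨ ∣p*q∣≡∣p∣*∣q∣ (i / 1) a ⟨
      ∣ (i / 1) * a ∣                         ≡⟨ cong (λ z → ∣ z * a ∣) (trans (sym q≡i) q≡) ⟩
      ∣ N a ^ k * (m / 1) ^ k * 1/ a * a ∣    ≡⟨ cong ∣_∣ (trans (*-assoc (N a ^ k * (m / 1) ^ k) (1/ a) a) (trans (cong (N a ^ k * (m / 1) ^ k *_) (*-inverseˡ a)) (*-identityʳ _))) ⟩
      ∣ N a ^ k * (m / 1) ^ k ∣               ≡⟨ ∣p*q∣≡∣p∣*∣q∣ (N a ^ k) ((m / 1) ^ k) ⟩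
      ∣ N a ^ k ∣ * ∣ (m / 1) ^ k ∣           ≡⟨ cong₂ _*_ (0≤p⇒∣p∣≡p (^-0≤ k (<⇒≤ (N-positive a)))) (trans (∣^∣ (m / 1) k) (cong (_^ k) (∣/1∣ m))) ⟩
      N a ^ k * (+ ℤ.∣ m ∣ / 1) ^ k           ∎
      where open ≡-Reasoning

  height-A : ∀ m → (+ (ℤ.∣ A m ∣ ℕ.^ 3) / 1) * ∣ a ∣ ^ 3 ≡ (N a * (+ ℤ.∣ m ∣ / 1)) ^ 6
  height-A m = cube-scale (A m) (N a) (+ ℤ.∣ m ∣ / 1) ∣ a ∣ (absolute {A-formula m} {A m} {m} {2} (A-integral m) refl)

  height-B : ∀ m → ((B m ℤ.^ 2) / 1) * ∣ a ∣ ^ 2 ≡ (N a * (+ ℤ.∣ m ∣ / 1)) ^ 6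
  height-B m = square-scale (B m) (N a) (+ ℤ.∣ m ∣ / 1) ∣ a ∣ (absolute {B-formula m} {B m} {m} {3} (B-integral m) refl)

  ord-A : ∀ {p m} → Prime p → m ≢ + 0 → ordℤ p (A m) ≡ ordℤ p A₁ ℕ.+ 2 ℕ.* ordℤ p m
  ord-A {p} {m} pr m≢0 = trans (cong (ordℤ p) (A≡ m))
    (trans (ordℤ-* pr A₁≢0 (ℤ^-≢0 m≢0 2)) (cong (ordℤ p A₁ ℕ.+_) (ordℤ-^ pr m≢0 2)))

  ord-B : ∀ {p m} → Prime p → m ≢ + 0 → ordℤ p (B m) ≡ ordℤ p B₁ ℕ.+ 3 ℕ.* ordℤ p m
  ord-B {p} {m} pr m≢0 = trans (cong (ordℤ p) (B≡ m))
    (trans (ordℤ-* pr B₁≢0 (ℤ^-≢0 m≢0 3)) (cong (ordℤ p B₁ ℕ.+_) (ordℤ-^ pr m≢0 3)))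

  private
    between-ℕ : ∀ {u k v d} → u ≡ v ℕ.+ k → v ℕ.≤ d → k ℕ.≤ u × u ℕ.≤ k ℕ.+ d
    between-ℕ {k = k} {v} {d} refl v≤d = ℕₚ.m≤n+m k v ,
      ℕₚ.≤-trans (ℕₚ.+-monoˡ-≤ k v≤d) (ℕₚ.≤-reflexive (ℕₚ.+-comm d k))

  ord-A-bounds : ∀ {p m} → Prime p → m ≢ + 0 → + 0 ℤ.≤ ord p a →
    2 ℕ.* ordℤ p m ℕ.≤ ordℤ p (A m) × ordℤ p (A m) ℕ.≤ 2 ℕ.* ordℤ p m ℕ.+ 1
  ord-A-bounds pr m≢0 0≤o = between-ℕ (ord-A pr m≢0) (ordA₁≤1 pr 0≤o)

  ord-B-bounds : ∀ {p m} → Prime p → m ≢ + 0 → ord p a ℤ.< + 0 →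
    3 ℕ.* ordℤ p m ℕ.≤ ordℤ p (B m) × ordℤ p (B m) ℕ.≤ 3 ℕ.* ordℤ p m ℕ.+ 2
  ord-B-bounds pr m≢0 o<0 = between-ℕ (ord-B pr m≢0) (ordB₁≤2 pr o<0)

  -- The sign of `ord p a` selects the coordinate with the sharp bound. With k = `ordℤ p m` this
  -- gives 4 ≤ 2 k + 1 or 6 ≤ 3 k + 2, and either forces k > 1.
  2≤ord : ∀ {p m} → Prime p → m ≢ + 0 →
    (+ (p ℕ.^ 4)) ℤ∣.∣ A m → (+ (p ℕ.^ 6)) ℤ∣.∣ B m → 2 ℕ.≤ ordℤ p m
  2≤ord {p} {m} pr m≢0 p⁴∣A p⁶∣B = [ ord≥0 , ord<0 ]′ (0≤⊎<0 (ord p a))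
    where
    ord≥0 : + 0 ℤ.≤ ord p a → 2 ℕ.≤ ordℤ p m
    ord≥0 0≤o = ℕₚ.*-cancelˡ-< 2 1 (ordℤ p m) (ℕₚ.+-cancelʳ-≤ 1 3 _ (ℕₚ.≤-trans
      (ordℕ-max {k = 4} pr (A≢0 m≢0 ∘ ℤₚ.∣i∣≡0⇒i≡0) p⁴∣A) (proj₂ (ord-A-bounds pr m≢0 0≤o))))
    ord<0 : ord p a ℤ.< + 0 → 2 ℕ.≤ ordℤ p m
    ord<0 o<0 = ℕₚ.*-cancelˡ-< 3 1 (ordℤ p m) (ℕₚ.+-cancelʳ-≤ 2 4 _ (ℕₚ.≤-trans
      (ordℕ-max {k = 6} pr (B≢0 m≢0 ∘ ℤₚ.∣i∣≡0⇒i≡0) p⁶∣B) (proj₂ (ord-B-bounds pr m≢0 o<0))))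

  private
    power-∣ : ∀ {p x y m} k → x ≡ y ℤ.* m ℤ.^ k → p ℕ.* p ℕ∣.∣ ℤ.∣ m ∣ → p ℕ.^ (2 ℕ.* k) ℕ∣.∣ ℤ.∣ x ∣
    power-∣ {p} {x} {y} {m} k x≡ p²∣m = subst₂ ℕ∣._∣_
      (trans (cong (ℕ._^ k) (cong (p ℕ.*_) (sym (ℕₚ.*-identityʳ p)))) (ℕₚ.^-*-assoc p 2 k))
      (sym (trans (cong ℤ.∣_∣ x≡) (trans (ℤₚ.abs-* y (m ℤ.^ k)) (cong (ℤ.∣ y ∣ ℕ.*_) (abs-^ m k)))))
      (ℕ∣.∣n⇒∣m*n ℤ.∣ y ∣ (^-mono-∣ k p²∣m))

  minimal⇔squareFree : ∀ m → m ≢ + 0 →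
    (¬ (∃[ p ] Prime p × (+ (p ℕ.^ 4)) ℤ∣.∣ A m × (+ (p ℕ.^ 6)) ℤ∣.∣ B m)) ⇔ SquareFree m
  minimal⇔squareFree m m≢0 = mk⇔ to from
    where
    to : (¬ (∃[ p ] Prime p × (+ (p ℕ.^ 4)) ℤ∣.∣ A m × (+ (p ℕ.^ 6)) ℤ∣.∣ B m)) → SquareFree m
    to minimal = squareFree {m} λ p pr p²∣m →
      minimal (p , pr , power-∣ {p} {A m} {A₁} {m} 2 (A≡ m) p²∣m , power-∣ {p} {B m} {B₁} {m} 3 (B≡ m) p²∣m)
    from : SquareFree m → ¬ (∃[ p ] Prime p × (+ (p ℕ.^ 4)) ℤ∣.∣ A m × (+ (p ℕ.^ 6)) ℤ∣.∣ B m)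
    from sf (p , pr , p⁴∣A , p⁶∣B) = ℕₚ.>⇒≢ (prime>1 pr) (sf p
      (subst (ℕ∣._∣ ℤ.∣ m ∣) (cong (p ℕ.*_) (ℕₚ.*-identityʳ p))
        (ℕ∣.∣-trans (^-monoʳ-∣ p (2≤ord pr m≢0 p⁴∣A p⁶∣B)) (ordℕ-∣ p ℤ.∣ m ∣))))

  -- Curves of bounded height

  module Bounded (α β X : ℝ) (1≤α : 1ᴿ ≤ᴿ α) (1≤β : 1ᴿ ≤ᴿ β) (0<X : 0ᴿ <ᴿ X) where

    bound : ℝ
    bound = c α β 1≤α 1≤β *ᴿ root 6 X

    private
      0<α : 0ᴿ <ᴿ α
      0<α = 1≤⇒positive α 1≤α
      0<β : 0ᴿ <ᴿ β
      0<β = 1≤⇒positive β 1≤β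
      0<wα : 0ᴿ <ᴿ ι (N a) *ᴿ root 6 α
      0<wα = denominator-positive α 1≤α
      0<wβ : 0ᴿ <ᴿ ι (N a) *ᴿ root 6 β
      0<wβ = denominator-positive β 1≤β
      u₁ u₂ z : ℝ
      u₁ = root 2 (ι ∣ a ∣) ÷ᴿ ι (N a) *ᴿ root 6 α ⟨ 0<wα ⟩
      u₂ = root 3 (ι ∣ a ∣) ÷ᴿ ι (N a) *ᴿ root 6 β ⟨ 0<wβ ⟩
      z = root 6 X
      0<∣a∣ : 0ℚ < ∣ a ∣
      0<∣a∣ = ∣∣-positive a≢0
      0<u₁ : 0ᴿ <ᴿ u₁
      0<u₁ = ÷ᴿ-positive (root 2 (ι ∣ a ∣)) (ι (N a) *ᴿ root 6 α) (root-positive 2 (ι ∣ a ∣) (ι-positive 0<∣a∣)) 0<wα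
      0<u₂ : 0ᴿ <ᴿ u₂
      0<u₂ = ÷ᴿ-positive (root 3 (ι ∣ a ∣)) (ι (N a) *ᴿ root 6 β) (root-positive 3 (ι ∣ a ∣) (ι-positive 0<∣a∣)) 0<wβ
      0<z : 0ᴿ <ᴿ z
      0<z = root-positive 6 X 0<X

    bound-positive : 0ᴿ <ᴿ bound
    bound-positive = *ᴿ-positive (u₁ ⊓ᴿ u₂) z (⊓ᴿ-positive u₁ u₂ 0<u₁ 0<u₂) 0<z

    -- The maximum in the height and the minimum in the bound split into the same two conditions,
    -- one for each coordinate, and `HeightBound` settles each of them.
    H≤X⇔ : ∀ m → m ≢ + 0 → H α β (E m) ≤ᴿ X ⇔ ιℤ (+ ℤ.∣ m ∣) ≤ᴿ bound
    H≤X⇔ m m≢0 = mk⇔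
      (λ H≤X q q<k → ⊓ᴿ-*ᴿ-below u₁ u₂ z 0<u₁ 0<u₂ 0<z
        (HA.height⇒bound (λ r br → H≤X r (inj₁ br)) q q<k)
        (HB.height⇒bound (λ r br → H≤X r (inj₂ br)) q q<k))
      (λ k≤ q → [ HA.bound⇒height (λ r r<k → proj₁ (⊓ᴿ-*ᴿ-below⁻ u₁ u₂ z 0<u₁ 0<u₂ 0<z (k≤ r r<k))) q
                , HB.bound⇒height (λ r r<k → proj₂ (⊓ᴿ-*ᴿ-below⁻ u₁ u₂ z 0<u₁ 0<u₂ 0<z (k≤ r r<k))) q ]′)
      where
      k : ℚ
      k = + ℤ.∣ m ∣ / 1
      0<k : 0ℚ < k
      0<k = subst (0ℚ <_) (∣/1∣ m) (∣∣-positive (/1-≢0 m≢0))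
      0<Nk : 0ℚ < (N a * k) ^ 6
      0<Nk = ^-0< 6 (0<* (N-positive a) 0<k)
      module HA = HeightBound α X 0<α 0<X {∣ a ∣} {N a} {k} {+ (ℤ.∣ A m ∣ ℕ.^ 3) / 1} 0<∣a∣ (N-positive a) 0<k
        (positive-factor {q = ∣ a ∣ ^ 3} (^-0< 3 0<∣a∣) (subst (0ℚ <_) (sym (height-A m)) 0<Nk)) 2 3 refl (height-A m) 0<wα
      module HB = HeightBound β X 0<β 0<X {∣ a ∣} {N a} {k} {(B m ℤ.^ 2) / 1} 0<∣a∣ (N-positive a) 0<k
        (positive-factor {q = ∣ a ∣ ^ 2} (^-0< 2 0<∣a∣) (subst (0ℚ <_) (sym (height-B m)) 0<Nk)) 3 2 refl (height-B m) 0<wβ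

    parametrised⇒ : ∀ E′ → (∃[ m ] m ≢ + 0 × ιℤ (+ ℤ.∣ m ∣) ≤ᴿ bound × E′ ≡ E m) → (Ẽⱼ j ⟨ X ⨾ H α β ⟩) E′
    parametrised⇒ E′ (m , m≢0 , m≤ , E′≡) = subst (Ẽⱼ j ⟨ X ⨾ H α β ⟩) (sym E′≡)
      (E∈Ẽⱼ m m≢0 , Equivalence.from (H≤X⇔ m m≢0) m≤)

    ⇒parametrised : ∀ E′ → (Ẽⱼ j ⟨ X ⨾ H α β ⟩) E′ → ∃[ m ] m ≢ + 0 × ιℤ (+ ℤ.∣ m ∣) ≤ᴿ bound × E′ ≡ E m
    ⇒parametrised (x , y) (E∈ , H≤X) = case Ẽⱼ⇒E x y E∈ of λ where
      (m , m≢0 , E′≡) → m , m≢0 , Equivalence.to (H≤X⇔ m m≢0) (subst (λ E′ → H α β E′ ≤ᴿ X) E′≡ H≤X) , E′≡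

    cardinality : ∀ n → IsFloor bound (+ n) → HasCardinality (Ẽⱼ j ⟨ X ⨾ H α β ⟩) (2 ℕ.* n)
    cardinality n floor = map E (nonZeroUpTo n)
      , Unique.map⁺ E-injective′ (nonZeroUpTo-unique n)
      , (λ E′ → mk⇔ (to E′) (from E′))
      , trans (length-map E (nonZeroUpTo n)) (length-nonZeroUpTo n)
      where
      -- `Unique.map⁺` wants injectivity on all of `ℤ`, while `E-injective` needs a nonzero first
      -- argument: symmetry covers a nonzero second one, and two zeros agree.
      E-injective′ : ∀ {m k} → E m ≡ E k → m ≡ k
      E-injective′ {m} {k} eq = case m ℤ.≟ + 0 of λ where
        (no  m≢0) → E-injective {m} {k} m≢0 eq
        (yes m≡0) → case k ℤ.≟ + 0 of λ where
          (no  k≢0) → sym (E-injective {k} {m} k≢0 (sym eq))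
          (yes k≡0) → trans m≡0 (sym k≡0)
      to : ∀ E′ → E′ ∈ map E (nonZeroUpTo n) → (Ẽⱼ j ⟨ X ⨾ H α β ⟩) E′
      to E′ E′∈ = case ∈-map⁻ E E′∈ of λ where
        (m , m∈ , E′≡) → parametrised⇒ E′ (m , proj₁ (∈-nonZeroUpTo⁻ n m∈)
          , ≤ᴿ-trans (ιℤ (+ ℤ.∣ m ∣)) (ιℤ (+ n)) bound
              (ι-mono-≤ (/1-mono-≤ (ℤ.+≤+ (proj₂ (∈-nonZeroUpTo⁻ n m∈))))) (proj₁ floor)
          , E′≡)
      from : ∀ E′ → (Ẽⱼ j ⟨ X ⨾ H α β ⟩) E′ → E′ ∈ map E (nonZeroUpTo n)
      from E′ E′∈ = case ⇒parametrised E′ E′∈ of λ where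
        (m , m≢0 , m≤ , E′≡) → subst (_∈ map E (nonZeroUpTo n)) (sym E′≡)
          (∈-map⁺ E (∈-nonZeroUpTo n m≢0 (floor-greatest bound floor m≤)))

    minimal⇔ : ∀ m → m ≢ + 0 → (ℰⱼ j ⟨ X ⨾ H α β ⟩) (E m) ⇔ (SquareFree m × ιℤ (+ ℤ.∣ m ∣) ≤ᴿ bound)
    minimal⇔ m m≢0 = mk⇔
      (λ E∈ → Equivalence.to (minimal⇔squareFree m m≢0) (proj₂ (Equivalence.to (ℰⱼ⇔ j (E m)) (proj₁ E∈)))
            , Equivalence.to (H≤X⇔ m m≢0) (proj₂ E∈))
      (λ h → Equivalence.from (ℰⱼ⇔ j (E m)) (E∈Ẽⱼ m m≢0 , Equivalence.from (minimal⇔squareFree m m≢0) (proj₁ h))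
           , Equivalence.from (H≤X⇔ m m≢0) (proj₂ h))

    squareFree⇒minimal : ∀ E′ → (∃[ m ] m ≢ + 0 × SquareFree m × ιℤ (+ ℤ.∣ m ∣) ≤ᴿ bound × E′ ≡ E m) →
      (ℰⱼ j ⟨ X ⨾ H α β ⟩) E′
    squareFree⇒minimal E′ (m , m≢0 , sf , m≤ , E′≡) = subst (ℰⱼ j ⟨ X ⨾ H α β ⟩) (sym E′≡)
      (Equivalence.from (minimal⇔ m m≢0) (sf , m≤))

    minimal⇒squareFree : ∀ E′ → (ℰⱼ j ⟨ X ⨾ H α β ⟩) E′ →
      ∃[ m ] m ≢ + 0 × SquareFree m × ιℤ (+ ℤ.∣ m ∣) ≤ᴿ bound × E′ ≡ E m
    minimal⇒squareFree E′ E′∈@(((E∈Ẽ , minimal) , j≡) , H≤X) =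
      case ⇒parametrised E′ ((E∈Ẽ , j≡) , H≤X) of λ where
        (m , m≢0 , m≤ , E′≡) → m , m≢0
          , proj₁ (Equivalence.to (minimal⇔ m m≢0) (subst (ℰⱼ j ⟨ X ⨾ H α β ⟩) E′≡ E′∈)) , m≤ , E′≡

theorem2p7 : (α β X : ℝ) (1≤α : 1ᴿ ≤ᴿ α) (1≤β : 1ᴿ ≤ᴿ β) (0<X : 0ᴿ <ᴿ X)
    (j : ℚ) (j≢0 : j ≢ 0ℚ) (j≢1728 : j ≢ 1728ℚ) →
    let open Parametrisation j j≢0 j≢1728
        bound : ℝ
        bound = c α β 1≤α 1≤β *ᴿ root 6 X
    in
    -- A(j,m) and B(j,m) are integers
    (∀ m → A-formula m ≡ A m / 1 × B-formula m ≡ B m / 1)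
    ×
    (Ẽⱼ j ⟨ X ⨾ H α β ⟩
      ≐ (λ E′ → ∃[ m ] m ≢ + 0 × ιℤ (+ ℤ.∣ m ∣) ≤ᴿ bound × E′ ≡ E m))
    ×
    -- the bound has a floor n, and the cardinality is 2 n
    (¬ ¬ (∃[ n ] IsFloor bound (+ n)))
    ×
    (∀ n → IsFloor bound (+ n) → HasCardinality (Ẽⱼ j ⟨ X ⨾ H α β ⟩) (2 ℕ.* n))
    ×
    (∀ m p → m ≢ + 0 → Prime p →
      (+ 0 ℤ.≤ ord p a →
        2 ℕ.* ordℤ p m ℕ.≤ ordℤ p (A m) × ordℤ p (A m) ℕ.≤ 2 ℕ.* ordℤ p m ℕ.+ 1)
      ×
      (ord p a ℤ.< + 0 →
        3 ℕ.* ordℤ p m ℕ.≤ ordℤ p (B m) × ordℤ p (B m) ℕ.≤ 3 ℕ.* ordℤ p m ℕ.+ 2))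
    ×
    (∀ m → m ≢ + 0 →
      (ℰⱼ j ⟨ X ⨾ H α β ⟩) (E m) ⇔ (SquareFree m × ιℤ (+ ℤ.∣ m ∣) ≤ᴿ bound))
    ×
    (ℰⱼ j ⟨ X ⨾ H α β ⟩
      ≐ (λ E′ → ∃[ m ] m ≢ + 0 × SquareFree m × ιℤ (+ ℤ.∣ m ∣) ≤ᴿ bound × E′ ≡ E m))
theorem2p7 α β X 1≤α 1≤β 0<X j j≢0 j≢1728 =
    (λ m → A-integral m , B-integral m)
  , ((λ {E′} → ⇒parametrised E′) , (λ {E′} → parametrised⇒ E′))
  , floor-¬¬exists bound bound-positive
  , cardinality
  , (λ m p m≢0 pr → ord-A-bounds pr m≢0 , ord-B-bounds pr m≢0)
  , minimal⇔
  , ((λ {E′} → minimal⇒squareFree E′) , (λ {E′} → squareFree⇒minimal E′))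
  where
  open CurvesWithInvariant j j≢0 j≢1728
  open Bounded α β X 1≤α 1≤β 0<X
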